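{- Let $N\ge 1$ and consider the multi-type TASEP on a ring of $N$ sites $1,\dots,N$ with exactly one particle of each label $1,\dots,N$ (so a state is a word $u=u_1u_2\cdots u_N$, a permutation of $[N]$, read along the ring). Let $u$ be sampled from its stationary distribution. Fix integers $N\ge x_n>x_{n-1}>\dots>x_2\ge 1$. Then the probability that $u_1u_2\cdots u_{n-1}=x_nx_{n-1}\cdots x_2$ equals \[\frac{1}{\prod_{i=1}^{n-1}\binom Ni}\det\left(\binom{x_{i+1}}{j-1}\right)_{i,j=1}^{n-1}.\]
   Context: Multi-type TASEP on a ring: the sites $1,\dots,N$ are arranged cyclically, each occupied by one particle with a label. In each transition a particle is chosen uniformly at random and tries to jump to the site on its left (cyclically): if that site is vacant it moves there; if that site holds a particle with a larger label, the two particles exchange places; otherwise nothing happens. The chain is irreducible on the set of states and has a unique stationary distribution. -}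

module Defs where

open import Data.Nat as ℕ using (ℕ; zero; suc; _<ᵇ_; NonZero)
open import Data.Nat.Combinatorics using (_C_)
open import Data.Bool using (Bool; true; false; if_then_else_)
open import Data.Fin as Fin using (Fin; punchIn)
open import Data.List as List using (List; []; _∷_; map; concatMap; upTo; foldr; filter; length; take)
open import Data.List.Properties using (≡-dec)
open import Data.Integer as ℤ using (ℤ; +_)
open import Data.Rational as ℚ using (ℚ; 0ℚ; 1ℚ)
open import Relation.Binary.PropositionalEquality using (_≡_)
open import Data.List.Membership.Propositional using (_∈_)

-- States: words u = u₁ u₂ ⋯ u_N (a list; position 0 is site 1) that are
-- permutations of [N] = {1,…,N}.

insertAll : ℕ → List ℕ → List (List ℕ)
insertAll x []       = (x ∷ []) ∷ []
insertAll x (y ∷ ys) = (x ∷ y ∷ ys) ∷ map (y ∷_) (insertAll x ys)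

perms : List ℕ → List (List ℕ)
perms []       = [] ∷ []
perms (x ∷ xs) = concatMap (insertAll x) (perms xs)

range : ℕ → List ℕ
range N = map suc (upTo N)

states : ℕ → List (List ℕ)
states N = perms (range N)

nth : List ℕ → ℕ → ℕ
nth []       _       = 0
nth (x ∷ _)  zero    = x
nth (_ ∷ xs) (suc i) = nth xs i

setAt : List ℕ → ℕ → ℕ → List ℕ
setAt []       _       _ = []
setAt (_ ∷ xs) zero    a = a ∷ xs
setAt (x ∷ xs) (suc i) a = x ∷ setAt xs i a

leftOf : ℕ → ℕ → ℕ
leftOf N zero    = N ℕ.∸ 1
leftOf N (suc i) = i

-- the particle at (0-based) site i tries to jump to the site on its left;
-- all sites are occupied, so it exchanges places with the particle there
-- iff that particle has a larger label; otherwise nothing happens.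
step : ℕ → ℕ → List ℕ → List ℕ
step N i u =
  let j = leftOf N i
      a = nth u i
      b = nth u j
  in if a <ᵇ b then setAt (setAt u i b) j a else u

moves : ℕ → List ℕ → List ℕ → ℕ
moves N u v = length (filter (λ i → ≡-dec ℕ._≟_ (step N i u) v) (upTo N))

-- transition probability: particle chosen uniformly among the N particles
P : (N : ℕ) → .{{_ : NonZero N}} → List ℕ → List ℕ → ℚ
P N u v = (+ moves N u v) ℚ./ N

sumℚ : List ℚ → ℚ
sumℚ = foldr ℚ._+_ 0ℚ

record Stationary (N : ℕ) .{{_ : NonZero N}} (π : List ℕ → ℚ) : Set where
  field
    nonneg  : ∀ u → u ∈ states N → 0ℚ ℚ.≤ π u
    total   : sumℚ (map π (states N)) ≡ 1ℚ
    balance : ∀ v → v ∈ states N →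
              π v ≡ sumℚ (map (λ u → π u ℚ.* P N u v) (states N))

probPrefix : (N : ℕ) → (π : List ℕ → ℚ) → List ℕ → ℚ
probPrefix N π w =
  sumℚ (map π (filter (λ u → ≡-dec ℕ._≟_ (take (length w) u) w) (states N)))

sumFin : ∀ n → (Fin n → ℤ) → ℤ
sumFin zero    f = + 0
sumFin (suc n) f = f Fin.zero ℤ.+ sumFin n (λ i → f (Fin.suc i))

sign : ℕ → ℤ
sign zero          = + 1
sign (suc zero)    = ℤ.- (+ 1)
sign (suc (suc k)) = sign k

det : ∀ n → (Fin n → Fin n → ℤ) → ℤ
det zero    M = + 1
det (suc n) M = sumFin (suc n) λ j →
  sign (Fin.toℕ j) ℤ.* M Fin.zero j ℤ.*
  det n (λ r c → M (Fin.suc r) (punchIn j c))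

prodBinom : ℕ → ℕ → ℕ
prodBinom N zero    = 1
prodBinom N (suc k) = prodBinom N k ℕ.* (N C suc k)

List-ℕ-ℚ : Set
List-ℕ-ℚ = List ℕ → ℚ

{-# OPTIONS --safe #-}

-- Cutting the labels at thresholds t₁ > ⋯ > t_k turns a state into k binary
-- words on which the chain acts by simultaneous jumps.  A sorting network of
-- jumps brings all k-tuples of words of sizes t₁, …, t_k to the same tuple, so
-- up to a scalar there is only one functional that is invariant under a
-- uniformly chosen jump.  Multiline queues give such a functional: the words of
-- a smaller multiline queue are the arrivals at a queue whose services form an
-- independent uniform word of size t₁.
--
-- On the event t₁ ≥ u₁ > t₂ ≥ u₂ > ⋯ > t_k ≥ u_k every queue is empty before and
-- throughout the first k sites, and on the other sites what remains are chains
-- of words in which each word can be served by the previous one.  Removing one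
-- site at a time, Pascal's rule counts them by det C(N − j, tᵢ − j), and
-- C(N, j) C(N − j, t − j) = C(N, t) C(t, j) gives the probability of the event as
-- det C(tᵢ, j) / ∏ C(N, j) with j = 1, …, k.  Inclusion and exclusion over
-- tᵢ ∈ {uᵢ, uᵢ − 1} replaces C(tᵢ, j) by C(uᵢ − 1, j − 1), and column operations
-- turn the latter into C(uᵢ, j − 1).

module Submission where

open import Defs
open import Data.Bool using (Bool; true; false; _∧_; _∨_; if_then_else_)
import Data.Bool as Bool
import Data.Bool.Properties as Boolₚ
open import Data.Empty using (⊥-elim)
open import Data.Fin using (Fin; toℕ; punchIn) renaming (_<_ to _<ᶠ_)
import Data.Fin as Fin
open import Data.Integer using (ℤ; +_)
import Data.Integer as ℤ
import Data.Integer.Properties as ℤₚ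
open import Data.List using (List; []; _∷_; _++_; map; concatMap; filter; upTo; length; tabulate; take; applyUpTo)
import Data.List.Properties as Listₚ
open import Data.List.Membership.Propositional using (_∈_; find; lose)
open import Data.List.Membership.Propositional.Properties using (∈-upTo⁺; ∈-map⁺; ∈-∃++; ∈-concatMap⁺)
open import Data.List.Relation.Unary.All using (All; []; _∷_)
import Data.List.Relation.Unary.All as All
import Data.List.Relation.Unary.All.Properties as Allₚ
open import Data.List.Relation.Unary.Any using (here; there)
open import Data.List.Relation.Unary.Linked using (Linked; []; [-]; _∷_)
import Data.List.Relation.Unary.Linked as Linked
open import Data.List.Relation.Binary.Pointwise using (Pointwise; []; _∷_; Pointwise-length)
open import Data.List.Relation.Binary.Disjoint.Propositional using (Disjoint)
open import Data.List.Relation.Binary.Permutation.Propositional using (_↭_; ↭-refl; ↭-prep; ↭-swap; ↭-trans; ↭-sym; ↭-reflexive)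
import Data.List.Relation.Binary.Permutation.Propositional.Properties as ↭ₚ
open import Data.List.Relation.Unary.AllPairs using (AllPairs; []; _∷_)
open import Data.List.Relation.Unary.Unique.Propositional using (Unique)
import Data.List.Relation.Unary.Unique.Propositional.Properties as Uniqueₚ
open import Data.Maybe using (Maybe; just; nothing)
open import Data.Nat using (ℕ; zero; suc; NonZero; _≤_; _<_; z≤n; s≤s)
import Data.Nat as ℕ
import Data.Nat.Properties as ℕₚ
open import Data.Nat.Tactic.RingSolver using () renaming (solve-∀ to ℕ-solve-∀)
open import Data.Nat.Combinatorics using (_C_; nCk+nC[k+1]≡[n+1]C[k+1])
open import Data.Nat.Combinatorics.Specification using (k>n⇒nCk≡0)
open import Data.Product using (_×_; _,_; proj₁; proj₂)
open import Data.Rational using (ℚ; _/_; _*_; _+_; _-_; -_; 0ℚ; 1ℚ)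
import Data.Rational as ℚ
import Data.Rational.Properties as ℚₚ
import Data.Rational.Unnormalised as ℚᵘ
import Data.Rational.Unnormalised.Properties as ℚᵘₚ
open import Data.Sum using (_⊎_; inj₁; inj₂)
open import Data.Unit using (⊤; tt)
open import Data.Vec using (Vec; []; _∷_; lookup; reverse; toList)
import Data.Vec as Vec
import Data.Vec.Properties as Vecₚ
open import Function using (_∘_; id)
open import Relation.Binary.PropositionalEquality using (_≡_; _≢_; refl; sym; trans; cong; cong₂; subst; subst₂; module ≡-Reasoning)
open import Relation.Nullary using (¬_; Dec; yes; no; does)
open import Relation.Nullary.Decidable using (_×-dec_; ¬?; from-yes; dec-true; dec-false)
open import Tactic.RingSolver using (solve-∀)
open import Tactic.RingSolver.Core.AlmostCommutativeRing using (AlmostCommutativeRing; fromCommutativeRing)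
open ≡-Reasoning

-- One operator, `shiftSum`, carries the computation: every positive entry of a list of sizes stays
-- or drops by one. Removing a site does this to the sizes of a chain of words, Pascal's rule does
-- it to the rows of the binomial determinant, and with weight -1 it is the inclusion and exclusion
-- over thresholds. Chains and determinant then agree because they satisfy the same recursion with
-- the same boundary values. The obstacle is that lowering entries of a strictly descending list can
-- make neighbours equal. The counting identities are therefore proved for weakly descending lists,
-- and a repeated entry gives 0 on both sides. Determinants are functionals on lists of columns, so
-- that linearity in the rows and linearity in the columns are both statements about functions.
-- Uniqueness is a maximum principle for the signed difference of the two functionals, scaled to
-- have total weight 0. It uses neither eigenvectors nor irreducibility, only that one fixed
-- sequence of jumps sends every tuple of the given sizes to the same tuple.

ℚ-ring : AlmostCommutativeRing _ _
ℚ-ring = fromCommutativeRing ℚₚ.+-*-commutativeRing isZero?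
  where
  isZero? : ∀ p → Maybe (0ℚ ≡ p)
  isZero? p with 0ℚ ℚₚ.≟ p
  ... | yes 0≡p = just 0≡p
  ... | no  _   = nothing


∏ : ∀ {A : Set} → List A → (A → ℚ) → ℚ
∏ []       f = 1ℚ
∏ (x ∷ xs) f = f x * ∏ xs f

-- Determinants as iterated contractions

-- A function on finite sequences of columns is contracted with a row by the
-- alternating sum that expands a determinant along its first row.
contract : ∀ {G : Set} → (G → ℚ) → (List G → ℚ) → List G → ℚ
contract v h []       = 0ℚ
contract v h (g ∷ gs) = v g * h gs - contract v (λ l → h (g ∷ l)) gs

module _ {G : Set} where

  contract-cong : ∀ {P : G → Set} {v v′ : G → ℚ} {h h′ : List G → ℚ} →
                  (∀ g → P g → v g ≡ v′ g) → (∀ l → All P l → h l ≡ h′ l) →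
                  ∀ gs → All P gs → contract v h gs ≡ contract v′ h′ gs
  contract-cong v≡ h≡ []       []       = refl
  contract-cong v≡ h≡ (g ∷ gs) (p ∷ ps) =
    cong₂ _-_ (cong₂ _*_ (v≡ g p) (h≡ gs ps)) (contract-cong v≡ (λ l ps′ → h≡ (g ∷ l) (p ∷ ps′)) gs ps)

  contract-congʳ : ∀ (v : G → ℚ) {h h′ : List G → ℚ} → (∀ l → h l ≡ h′ l) →
                   ∀ gs → contract v h gs ≡ contract v h′ gs
  contract-congʳ v h≡ gs =
    contract-cong {P = λ _ → ⊤} (λ _ _ → refl) (λ l _ → h≡ l) gs (All.universal (λ _ → tt) gs)

  contract-linearˡ : ∀ c (v w : G → ℚ) h gs →
    contract (λ g → v g + c * w g) h gs ≡ contract v h gs + c * contract w h gs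
  contract-linearˡ c v w h []       = lem c
    where lem : ∀ c → 0ℚ ≡ 0ℚ + c * 0ℚ
          lem = solve-∀ ℚ-ring
  contract-linearˡ c v w h (g ∷ gs)
    rewrite contract-linearˡ c v w (λ l → h (g ∷ l)) gs =
    lem c (v g) (w g) (h gs) (contract v (λ l → h (g ∷ l)) gs) (contract w (λ l → h (g ∷ l)) gs)
    where lem : ∀ c a b x y z → (a + c * b) * x - (y + c * z) ≡ (a * x - y) + c * (b * x - z)
          lem = solve-∀ ℚ-ring

  contract-linearʳ : ∀ c (v : G → ℚ) (h k : List G → ℚ) gs →
    contract v (λ l → h l + c * k l) gs ≡ contract v h gs + c * contract v k gs
  contract-linearʳ c v h k []       = lem c
    where lem : ∀ c → 0ℚ ≡ 0ℚ + c * 0ℚ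
          lem = solve-∀ ℚ-ring
  contract-linearʳ c v h k (g ∷ gs)
    rewrite contract-linearʳ c v (λ l → h (g ∷ l)) (λ l → k (g ∷ l)) gs =
    lem c (v g) (h gs) (k gs) (contract v (λ l → h (g ∷ l)) gs) (contract v (λ l → k (g ∷ l)) gs)
    where lem : ∀ c a x y z w → a * (x + c * y) - (z + c * w) ≡ (a * x - z) + c * (a * y - w)
          lem = solve-∀ ℚ-ring

  contract-zeroˡ : ∀ {v : G → ℚ} h gs → All (λ g → v g ≡ 0ℚ) gs → contract v h gs ≡ 0ℚ
  contract-zeroˡ h []       []       = refl
  contract-zeroˡ h (g ∷ gs) (e ∷ es)
    rewrite e | contract-zeroˡ (λ l → h (g ∷ l)) gs es = lem (h gs)
    where lem : ∀ a → 0ℚ * a - 0ℚ ≡ 0ℚ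
          lem = solve-∀ ℚ-ring

  contract-zeroʳ : ∀ (v : G → ℚ) {h : List G → ℚ} → (∀ l → h l ≡ 0ℚ) → ∀ gs → contract v h gs ≡ 0ℚ
  contract-zeroʳ v h≡0 []       = refl
  contract-zeroʳ v h≡0 (g ∷ gs)
    rewrite h≡0 gs | contract-zeroʳ v (λ l → h≡0 (g ∷ l)) gs = lem (v g)
    where lem : ∀ a → a * 0ℚ - 0ℚ ≡ 0ℚ
          lem = solve-∀ ℚ-ring

  -- The terms that select `g` in the outer contraction cancel those that select it in the inner
  -- one; what remains is the same claim for `h (g ∷ _)`. This is the vanishing of a determinant
  -- with two equal adjacent rows.
  contract-contract : ∀ (v : G → ℚ) h gs → contract v (contract v h) gs ≡ 0ℚ
  contract-contract v h []       = refl
  contract-contract v h (g ∷ gs) = begin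
    v g * contract v h gs - contract v (λ l → v g * h l - contract v (λ l′ → h (g ∷ l′)) l) gs
      ≡⟨ cong (λ z → v g * contract v h gs - z)
           (trans (contract-congʳ v (λ l → lem₁ (v g) (h l) (contract v (λ l′ → h (g ∷ l′)) l)) gs)
           (trans (contract-linearʳ (v g) v _ h gs)
                  (cong (_+ v g * contract v h gs)
                    (trans (contract-linearʳ (- 1ℚ) v (λ _ → 0ℚ) _ gs)
                           (cong₂ (λ a b → a + - 1ℚ * b) (contract-zeroʳ v (λ _ → refl) gs)
                             (contract-contract v (λ l → h (g ∷ l)) gs)))))) ⟩
    v g * contract v h gs - (0ℚ + - 1ℚ * 0ℚ + v g * contract v h gs)
      ≡⟨ lem₂ (v g * contract v h gs) ⟩
    0ℚ ∎
    where lem₁ : ∀ a b c → a * b - c ≡ (0ℚ + - 1ℚ * c) + a * b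
          lem₁ = solve-∀ ℚ-ring
          lem₂ : ∀ a → a - (0ℚ + - 1ℚ * 0ℚ + a) ≡ 0ℚ
          lem₂ = solve-∀ ℚ-ring

  -- Stated for adjacent equal columns, the situation that arises when one of the columns 0, 1, 2,
  -- ... is lowered onto its predecessor.
  Alternating : (List G → ℚ) → Set
  Alternating h = ∀ ps g gs → h (ps ++ g ∷ g ∷ gs) ≡ 0ℚ

  -- The two terms that select one of the equal columns have opposite signs; every other term leaves
  -- both copies to `h`.
  contract-alternating : ∀ (v : G → ℚ) h → Alternating h → Alternating (contract v h)
  contract-alternating v h alt [] g gs
    rewrite contract-zeroʳ v (alt [] g) gs = lem (v g * h (g ∷ gs))
    where lem : ∀ a → a - (a - 0ℚ) ≡ 0ℚ
          lem = solve-∀ ℚ-ring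
  contract-alternating v h alt (p ∷ ps) g gs
    rewrite alt ps g gs | contract-alternating v (λ l → h (p ∷ l)) (λ ps′ → alt (p ∷ ps′)) ps g gs = lem (v p)
    where lem : ∀ a → a * 0ℚ - 0ℚ ≡ 0ℚ
          lem = solve-∀ ℚ-ring

  contract-scale : ∀ (c : G → ℚ) (v : G → ℚ) h gs →
    contract (λ g → c g * v g) (λ l → ∏ l c * h l) gs
      ≡ ∏ gs c * contract v h gs
  contract-scale c v h []       = refl
  contract-scale c v h (g ∷ gs) = begin
    c g * v g * (∏ gs c * h gs) - contract (λ j → c j * v j) (λ l → c g * ∏ l c * h (g ∷ l)) gs
      ≡⟨ cong (λ z → c g * v g * (∏ gs c * h gs) - z)
           (trans (contract-congʳ _ (λ l → lem₁ (c g) (∏ l c) (h (g ∷ l))) gs)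
           (trans (contract-linearʳ (c g) _ (λ _ → 0ℚ) _ gs)
                  (cong₂ (λ a b → a + c g * b) (contract-zeroʳ _ (λ _ → refl) gs)
                    (contract-scale c v (λ l → h (g ∷ l)) gs)))) ⟩
    c g * v g * (∏ gs c * h gs) - (0ℚ + c g * (∏ gs c * contract v (λ l → h (g ∷ l)) gs))
      ≡⟨ lem₂ (c g) (v g) (∏ gs c) (h gs) (contract v (λ l → h (g ∷ l)) gs) ⟩
    c g * ∏ gs c * (v g * h gs - contract v (λ l → h (g ∷ l)) gs) ∎
    where
    lem₁ : ∀ a b d → a * b * d ≡ 0ℚ + a * (b * d)
    lem₁ = solve-∀ ℚ-ring
    lem₂ : ∀ a b p x y → a * b * (p * x) - (0ℚ + a * (p * y)) ≡ a * p * (b * x - y)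
    lem₂ = solve-∀ ℚ-ring

contract-map : ∀ {G G′ : Set} (f : G → G′) v h gs →
  contract v h (map f gs) ≡ contract (v ∘ f) (h ∘ map f) gs
contract-map f v h []       = refl
contract-map f v h (g ∷ gs) =
  cong (λ z → v (f g) * h (map f gs) - z) (contract-map f v (λ l → h (f g ∷ l)) gs)

-- The last entry of ls gives the topmost row of the determinant.
rowForm : ∀ {L G : Set} → (L → G → ℚ) → List L → (List G → ℚ) → List G → ℚ
rowForm R []       h = h
rowForm R (l ∷ ls) h = rowForm R ls (contract (R l) h)

module _ {L G : Set} where

  rowForm-cong : ∀ {P : G → Set} {R R′ : L → G → ℚ} ls {h h′} →
                 (∀ l g → P g → R l g ≡ R′ l g) → (∀ gs → All P gs → h gs ≡ h′ gs) →
                 ∀ gs → All P gs → rowForm R ls h gs ≡ rowForm R′ ls h′ gs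
  rowForm-cong []       R≡ h≡ = h≡
  rowForm-cong (l ∷ ls) R≡ h≡ = rowForm-cong ls R≡ (contract-cong (R≡ l) h≡)

  rowForm-congʳ : ∀ (R : L → G → ℚ) ls {h h′} → (∀ gs → h gs ≡ h′ gs) →
                  ∀ gs → rowForm R ls h gs ≡ rowForm R ls h′ gs
  rowForm-congʳ R ls h≡ gs =
    rowForm-cong {P = λ _ → ⊤} ls (λ _ _ _ → refl) (λ l _ → h≡ l) gs (All.universal (λ _ → tt) gs)

  rowForm-congˡ : ∀ {R R′ : L → G → ℚ} ls h → (∀ l g → R l g ≡ R′ l g) →
                  ∀ gs → rowForm R ls h gs ≡ rowForm R′ ls h gs
  rowForm-congˡ ls h R≡ gs =
    rowForm-cong {P = λ _ → ⊤} ls (λ l g _ → R≡ l g) (λ _ _ → refl) gs (All.universal (λ _ → tt) gs)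

  rowForm-linear : ∀ c (R : L → G → ℚ) ls h k gs →
    rowForm R ls (λ l → h l + c * k l) gs ≡ rowForm R ls h gs + c * rowForm R ls k gs
  rowForm-linear c R []       h k gs = refl
  rowForm-linear c R (l ∷ ls) h k gs =
    trans (rowForm-congʳ R ls (contract-linearʳ c (R l) h k) gs)
          (rowForm-linear c R ls (contract (R l) h) (contract (R l) k) gs)

  rowForm-zero : ∀ (R : L → G → ℚ) ls {h} → (∀ gs → h gs ≡ 0ℚ) → ∀ gs → rowForm R ls h gs ≡ 0ℚ
  rowForm-zero R []       h≡0 gs = h≡0 gs
  rowForm-zero R (l ∷ ls) h≡0 gs = rowForm-zero R ls (contract-zeroʳ (R l) h≡0) gs

  rowForm-repeated : ∀ (R : L → G → ℚ) l ls h gs → rowForm R (l ∷ l ∷ ls) h gs ≡ 0ℚ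
  rowForm-repeated R l ls h gs = rowForm-zero R ls (contract-contract (R l) h) gs

  rowForm-alternating : ∀ (R : L → G → ℚ) ls h → Alternating h → Alternating (rowForm R ls h)
  rowForm-alternating R []       h alt = alt
  rowForm-alternating R (l ∷ ls) h alt = rowForm-alternating R ls _ (contract-alternating (R l) h alt)

-- The functional whose contraction with n rows, evaluated at n columns, is the
-- n × n determinant.
unit : ∀ {G : Set} → List G → ℚ
unit []      = 1ℚ
unit (_ ∷ _) = 0ℚ

unit-alternating : ∀ {G : Set} → Alternating (unit {G})
unit-alternating []       g gs = refl
unit-alternating (_ ∷ _)  g gs = refl

-- The tensor product, over the positions of the list, of the one-variable operators `shift s`. An
-- entry 0 has nothing below it and stays.
shiftSum : ℚ → (List ℕ → ℚ) → List ℕ → ℚ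
shiftSum s h []           = h []
shiftSum s h (zero ∷ gs)  = shiftSum s (λ l → h (zero ∷ l)) gs
shiftSum s h (suc g ∷ gs) = shiftSum s (λ l → h (suc g ∷ l)) gs + s * shiftSum s (λ l → h (g ∷ l)) gs

shift : ℚ → (ℕ → ℚ) → ℕ → ℚ
shift s v zero    = v zero
shift s v (suc g) = v (suc g) + s * v g

data Lowered : ℕ → ℕ → Set where
  same  : ∀ {g} → Lowered g g
  lower : ∀ {g} → Lowered g (suc g)

-- The hypothesis is confined to the lists that the sum visits: the identities substituted later
-- hold only for lists obtained by lowering entries of a strictly descending one.
shiftSum-cong : ∀ s {h k} gs → (∀ ls → Pointwise Lowered ls gs → h ls ≡ k ls) →
                shiftSum s h gs ≡ shiftSum s k gs
shiftSum-cong s []           h≡k = h≡k [] []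
shiftSum-cong s (zero ∷ gs)  h≡k = shiftSum-cong s gs (λ ls p → h≡k (zero ∷ ls) (same ∷ p))
shiftSum-cong s (suc g ∷ gs) h≡k = cong₂ (λ a b → a + s * b)
  (shiftSum-cong s gs (λ ls p → h≡k (suc g ∷ ls) (same ∷ p)))
  (shiftSum-cong s gs (λ ls p → h≡k (g ∷ ls) (lower ∷ p)))

shiftSum-linear : ∀ s c h k gs →
  shiftSum s (λ l → h l + c * k l) gs ≡ shiftSum s h gs + c * shiftSum s k gs
shiftSum-linear s c h k []           = refl
shiftSum-linear s c h k (zero ∷ gs)  = shiftSum-linear s c _ _ gs
shiftSum-linear s c h k (suc g ∷ gs)
  rewrite shiftSum-linear s c (λ l → h (suc g ∷ l)) (λ l → k (suc g ∷ l)) gs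
        | shiftSum-linear s c (λ l → h (g ∷ l)) (λ l → k (g ∷ l)) gs =
  lem s c (S h (suc g)) (S k (suc g)) (S h g) (S k g)
  where S : (List ℕ → ℚ) → ℕ → ℚ
        S f g′ = shiftSum s (λ l → f (g′ ∷ l)) gs
        lem : ∀ s c a b x y → a + c * b + s * (x + c * y) ≡ (a + s * x) + c * (b + s * y)
        lem = solve-∀ ℚ-ring

shiftSum-zero : ∀ s {h} gs → (∀ l → h l ≡ 0ℚ) → shiftSum s h gs ≡ 0ℚ
shiftSum-zero s []           h≡0 = h≡0 []
shiftSum-zero s (zero ∷ gs)  h≡0 = shiftSum-zero s gs (λ l → h≡0 (zero ∷ l))
shiftSum-zero s (suc g ∷ gs) h≡0
  rewrite shiftSum-zero s gs (λ l → h≡0 (suc g ∷ l)) | shiftSum-zero s gs (λ l → h≡0 (g ∷ l)) = lem s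
  where lem : ∀ s → 0ℚ + s * 0ℚ ≡ 0ℚ
        lem = solve-∀ ℚ-ring

shiftSum-scale : ∀ s c h gs → shiftSum s (λ l → c * h l) gs ≡ c * shiftSum s h gs
shiftSum-scale s c h gs = begin
  shiftSum s (λ l → c * h l) gs
    ≡⟨ shiftSum-cong s gs (λ ls _ → sym (ℚₚ.+-identityˡ (c * h ls))) ⟩
  shiftSum s (λ l → 0ℚ + c * h l) gs
    ≡⟨ shiftSum-linear s c (λ _ → 0ℚ) h gs ⟩
  shiftSum s (λ _ → 0ℚ) gs + c * shiftSum s h gs
    ≡⟨ cong (_+ c * shiftSum s h gs) (shiftSum-zero s gs (λ _ → refl)) ⟩
  0ℚ + c * shiftSum s h gs
    ≡⟨ ℚₚ.+-identityˡ _ ⟩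
  c * shiftSum s h gs ∎

-- Multilinearity in the rows: each row is a sum of two, and the determinant expands into one term
-- for each choice.
rowForm-shift : ∀ {G : Set} s (R : ℕ → G → ℚ) ls h gs →
  rowForm (λ l g → shift s (λ l′ → R l′ g) l) ls h gs ≡ shiftSum s (λ ls′ → rowForm R ls′ h gs) ls
rowForm-shift s R []           h gs = refl
rowForm-shift s R (zero ∷ ls)  h gs = rowForm-shift s R ls (contract (R zero) h) gs
rowForm-shift s R (suc l ∷ ls) h gs = begin
  rowForm R′ ls (contract (λ g → R (suc l) g + s * R l g) h) gs
    ≡⟨ rowForm-congʳ R′ ls (contract-linearˡ s (R (suc l)) (R l) h) gs ⟩
  rowForm R′ ls (λ l′ → contract (R (suc l)) h l′ + s * contract (R l) h l′) gs
    ≡⟨ rowForm-linear s R′ ls (contract (R (suc l)) h) (contract (R l) h) gs ⟩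
  rowForm R′ ls (contract (R (suc l)) h) gs + s * rowForm R′ ls (contract (R l) h) gs
    ≡⟨ cong₂ (λ a b → a + s * b) (rowForm-shift s R ls (contract (R (suc l)) h) gs)
                                 (rowForm-shift s R ls (contract (R l) h) gs) ⟩
  shiftSum s (λ ls′ → rowForm R (suc l ∷ ls′) h gs) ls + s * shiftSum s (λ ls′ → rowForm R (l ∷ ls′) h gs) ls ∎
  where R′ = λ l′ g → shift s (λ l″ → R l″ g) l′

shiftSum-minus : ∀ s h k gs → shiftSum s (λ l → h l - k l) gs ≡ shiftSum s h gs - shiftSum s k gs
shiftSum-minus s h k gs = begin
  shiftSum s (λ l → h l - k l) gs
    ≡⟨ shiftSum-cong s gs (λ l _ → minus (h l) (k l)) ⟩
  shiftSum s (λ l → h l + - 1ℚ * k l) gs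
    ≡⟨ shiftSum-linear s (- 1ℚ) h k gs ⟩
  shiftSum s h gs + - 1ℚ * shiftSum s k gs
    ≡⟨ sym (minus (shiftSum s h gs) (shiftSum s k gs)) ⟩
  shiftSum s h gs - shiftSum s k gs ∎
  where minus : ∀ a b → a - b ≡ a + - 1ℚ * b
        minus = solve-∀ ℚ-ring

-- Multilinearity in the columns. A contraction takes one column and leaves the others to `h`, so
-- the shift has to act on `v` and on the arguments of `h` at the same time.
contract-shift : ∀ s v h gs → contract (shift s v) (shiftSum s h) gs ≡ shiftSum s (contract v h) gs
contract-shift s v h []           = refl
contract-shift s v h (zero ∷ gs)  = begin
  v zero * shiftSum s h gs - contract (shift s v) (shiftSum s h₀) gs
    ≡⟨ cong₂ _-_ (sym (shiftSum-scale s (v zero) h gs)) (contract-shift s v h₀ gs) ⟩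
  shiftSum s (λ l → v zero * h l) gs - shiftSum s (contract v h₀) gs
    ≡⟨ sym (shiftSum-minus s (λ l → v zero * h l) (contract v h₀) gs) ⟩
  shiftSum s (λ l → contract v h (zero ∷ l)) gs ∎
  where h₀ = λ l → h (zero ∷ l)
contract-shift s v h (suc g ∷ gs) = begin
  (v (suc g) + s * v g) * H - contract (shift s v) (λ l → shiftSum s h₁ l + s * shiftSum s h₀ l) gs
    ≡⟨ cong (λ z → (v (suc g) + s * v g) * H - z) (contract-linearʳ s (shift s v) (shiftSum s h₁) (shiftSum s h₀) gs) ⟩
  (v (suc g) + s * v g) * H - (contract (shift s v) (shiftSum s h₁) gs + s * contract (shift s v) (shiftSum s h₀) gs)
    ≡⟨ cong₂ (λ a b → (v (suc g) + s * v g) * H - (a + s * b)) (contract-shift s v h₁ gs) (contract-shift s v h₀ gs) ⟩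
  (v (suc g) + s * v g) * H - (S₁ + s * S₀)
    ≡⟨ lem (v (suc g)) (v g) s H S₁ S₀ ⟩
  (v (suc g) * H - S₁) + s * (v g * H - S₀)
    ≡⟨ cong₂ (λ a b → a + s * b) (split (v (suc g)) h₁) (split (v g) h₀) ⟩
  shiftSum s (λ l → contract v h (suc g ∷ l)) gs + s * shiftSum s (λ l → contract v h (g ∷ l)) gs ∎
  where
  h₁ = λ l → h (suc g ∷ l)
  h₀ = λ l → h (g ∷ l)
  H  = shiftSum s h gs
  S₁ = shiftSum s (contract v h₁) gs
  S₀ = shiftSum s (contract v h₀) gs
  lem : ∀ a b s x y z → (a + s * b) * x - (y + s * z) ≡ (a * x - y) + s * (b * x - z)
  lem = solve-∀ ℚ-ring
  split : ∀ c k → c * H - shiftSum s (contract v k) gs ≡ shiftSum s (λ l → c * h l - contract v k l) gs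
  split c k = trans (cong (_- shiftSum s (contract v k) gs) (sym (shiftSum-scale s c h gs)))
                    (sym (shiftSum-minus s (λ l → c * h l) (contract v k) gs))

rowForm-columnShift : ∀ {L : Set} s (R : L → ℕ → ℚ) ls h gs →
  rowForm (λ l → shift s (R l)) ls (shiftSum s h) gs ≡ shiftSum s (rowForm R ls h) gs
rowForm-columnShift s R []       h gs = refl
rowForm-columnShift s R (l ∷ ls) h gs =
  trans (rowForm-congʳ _ ls (contract-shift s (R l) h) gs)
        (rowForm-columnShift s R ls (contract (R l) h) gs)

shiftSum-unit : ∀ s gs → shiftSum s unit gs ≡ unit gs
shiftSum-unit s []           = refl
shiftSum-unit s (zero ∷ gs)  = shiftSum-zero s gs (λ _ → refl)
shiftSum-unit s (suc g ∷ gs) =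
  trans (cong₂ (λ a b → a + s * b) (shiftSum-zero s gs (λ _ → refl)) (shiftSum-zero s gs (λ _ → refl))) (lem s)
  where lem : ∀ s → 0ℚ + s * 0ℚ ≡ 0ℚ
        lem = solve-∀ ℚ-ring

from : ℕ → ℕ → List ℕ
from a zero    = []
from a (suc n) = a ∷ from (suc a) n

map-suc-from : ∀ a n → map suc (from a n) ≡ from (suc a) n
map-suc-from a zero    = refl
map-suc-from a (suc n) = cong (suc a ∷_) (map-suc-from (suc a) n)

private
  -- `vanish` records that the column `a` has just been used: lowering `suc a` would repeat it next
  -- to its first occurrence. Keeping `suc a` hands the same property on to the next column.
  shiftSum-from⁺ : ∀ s h a n → Alternating h → (∀ l → h (a ∷ l) ≡ 0ℚ) →
                   shiftSum s h (from (suc a) n) ≡ h (from (suc a) n)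
  shiftSum-from⁺ s h a zero    alt vanish = refl
  shiftSum-from⁺ s h a (suc n) alt vanish = trans
    (cong₂ (λ x y → x + s * y)
      (shiftSum-from⁺ s (λ l → h (suc a ∷ l)) (suc a) n (λ ps → alt (suc a ∷ ps)) (alt [] (suc a)))
      (shiftSum-zero s (from (suc (suc a)) n) vanish))
    (lem s _)
    where lem : ∀ s x → x + s * 0ℚ ≡ x
          lem = solve-∀ ℚ-ring

-- Lowering any of the consecutive columns 0, …, n − 1 makes two of them equal.
shiftSum-from : ∀ s h n → Alternating h → shiftSum s h (from 0 n) ≡ h (from 0 n)
shiftSum-from s h zero    alt = refl
shiftSum-from s h (suc n) alt =
  shiftSum-from⁺ s (λ l → h (0 ∷ l)) 0 n (λ ps → alt (0 ∷ ps)) (alt [] 0)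

-- Integers and binomial coefficients as rationals

fromℤ : ℤ → ℚ
fromℤ z = z / 1

fromℕ : ℕ → ℚ
fromℕ n = fromℤ (+ n)

private
  toℚᵘ-fromℤ : ∀ z → ℚ.toℚᵘ (fromℤ z) ℚᵘ.≃ ℚᵘ.mkℚᵘ z 0
  toℚᵘ-fromℤ z = ℚₚ.toℚᵘ-fromℚᵘ (ℚᵘ.mkℚᵘ z 0)

fromℤ-+ : ∀ a b → fromℤ (a ℤ.+ b) ≡ fromℤ a + fromℤ b
fromℤ-+ a b = ℚₚ.toℚᵘ-injective (ℚᵘₚ.≃-trans (toℚᵘ-fromℤ (a ℤ.+ b))
  (ℚᵘₚ.≃-trans (ℚᵘ.*≡* (cong (ℤ._* (+ 1)) (sym (cong₂ ℤ._+_ (ℤₚ.*-identityʳ a) (ℤₚ.*-identityʳ b)))))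
  (ℚᵘₚ.≃-trans (ℚᵘₚ.+-cong (ℚᵘₚ.≃-sym (toℚᵘ-fromℤ a)) (ℚᵘₚ.≃-sym (toℚᵘ-fromℤ b)))
               (ℚᵘₚ.≃-sym (ℚₚ.toℚᵘ-homo-+ (fromℤ a) (fromℤ b))))))

fromℤ-* : ∀ a b → fromℤ (a ℤ.* b) ≡ fromℤ a * fromℤ b
fromℤ-* a b = ℚₚ.toℚᵘ-injective (ℚᵘₚ.≃-trans (toℚᵘ-fromℤ (a ℤ.* b))
  (ℚᵘₚ.≃-trans (ℚᵘₚ.*-cong (ℚᵘₚ.≃-sym (toℚᵘ-fromℤ a)) (ℚᵘₚ.≃-sym (toℚᵘ-fromℤ b)))
               (ℚᵘₚ.≃-sym (ℚₚ.toℚᵘ-homo-* (fromℤ a) (fromℤ b)))))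

fromℤ-neg : ∀ a → fromℤ (ℤ.- a) ≡ - fromℤ a
fromℤ-neg a = begin
  fromℤ (ℤ.- a)           ≡⟨ cong fromℤ (sym (ℤₚ.-1*i≡-i a)) ⟩
  fromℤ (ℤ.-1ℤ ℤ.* a)     ≡⟨ fromℤ-* ℤ.-1ℤ a ⟩
  - 1ℚ * fromℤ a          ≡⟨ lem (fromℤ a) ⟩
  - fromℤ a               ∎
  where lem : ∀ a → - 1ℚ * a ≡ - a
        lem = solve-∀ ℚ-ring

fromℕ-+ : ∀ a b → fromℕ (a ℕ.+ b) ≡ fromℕ a + fromℕ b
fromℕ-+ a b = trans (cong fromℤ (ℤₚ.pos-+ a b)) (fromℤ-+ (+ a) (+ b))

fromℕ-* : ∀ a b → fromℕ (a ℕ.* b) ≡ fromℕ a * fromℕ b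
fromℕ-* a b = trans (cong fromℤ (ℤₚ.pos-* a b)) (fromℤ-* (+ a) (+ b))

-- C(n, l − j), which is 0 for l < j.
binom : ℕ → ℕ → ℕ → ℕ
binom n l       zero    = n C l
binom n zero    (suc j) = 0
binom n (suc l) (suc j) = binom n l j

binom-pascal : ∀ n l j → binom (suc n) (suc l) j ≡ binom n (suc l) j ℕ.+ binom n l j
binom-pascal n l       zero          = trans (sym (nCk+nC[k+1]≡[n+1]C[k+1] n l)) (ℕₚ.+-comm (n C l) _)
binom-pascal n zero    (suc zero)    = refl
binom-pascal n zero    (suc (suc j)) = refl
binom-pascal n (suc l) (suc j)       = binom-pascal n l j

binom-shift : ∀ n l j → fromℕ (binom (suc n) l j) ≡ shift 1ℚ (λ l′ → fromℕ (binom n l′ j)) l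
binom-shift n zero    zero    = refl
binom-shift n zero    (suc j) = refl
binom-shift n (suc l) j       = trans (cong fromℕ (binom-pascal n l j))
  (trans (fromℕ-+ (binom n (suc l) j) (binom n l j)) (cong (fromℕ (binom n (suc l) j) ℚ.+_) (sym (ℚₚ.*-identityˡ _))))

binom-> : ∀ n l j → n ℕ.+ j < l → binom n l j ≡ 0
binom-> n l       zero    n<l       = k>n⇒nCk≡0 (subst (_< l) (ℕₚ.+-identityʳ n) n<l)
binom-> n zero    (suc j) n<l       = refl
binom-> n (suc l) (suc j) n<l       = binom-> n l j (ℕ.s<s⁻¹ (subst (_< suc l) (ℕₚ.+-suc n j) n<l))

binom-< : ∀ n l j → l < j → binom n l j ≡ 0
binom-< n zero    (suc j) l<j       = refl
binom-< n (suc l) (suc j) (s≤s l<j) = binom-< n l j l<j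

-- Both sides count the pairs of a j-subset of a t-subset of an n-set.
subset-of-subset : ∀ n t j → (n C j) ℕ.* binom (n ℕ.∸ j) t j ≡ (n C t) ℕ.* (t C j)
subset-of-subset n       t       zero    = trans (ℕₚ.*-identityˡ _) (sym (ℕₚ.*-identityʳ _))
subset-of-subset n       zero    (suc j) = trans (ℕₚ.*-zeroʳ (n C suc j)) refl
subset-of-subset zero    (suc t) (suc j)
  rewrite k>n⇒nCk≡0 {0} {suc j} (s≤s z≤n) | k>n⇒nCk≡0 {0} {suc t} (s≤s z≤n) = refl
subset-of-subset (suc n) (suc t) (suc j) = begin
  (suc n C suc j) ℕ.* binom (n ℕ.∸ j) t j
    ≡⟨ cong (ℕ._* binom (n ℕ.∸ j) t j) (sym (nCk+nC[k+1]≡[n+1]C[k+1] n j)) ⟩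
  ((n C j) ℕ.+ (n C suc j)) ℕ.* binom (n ℕ.∸ j) t j
    ≡⟨ ℕₚ.*-distribʳ-+ (binom (n ℕ.∸ j) t j) (n C j) (n C suc j) ⟩
  (n C j) ℕ.* binom (n ℕ.∸ j) t j ℕ.+ (n C suc j) ℕ.* binom (n ℕ.∸ j) t j
    ≡⟨ cong ((n C j) ℕ.* binom (n ℕ.∸ j) t j ℕ.+_) upper ⟩
  (n C j) ℕ.* binom (n ℕ.∸ j) t j
    ℕ.+ ((n C suc j) ℕ.* binom (n ℕ.∸ suc j) (suc t) (suc j) ℕ.+ (n C suc j) ℕ.* binom (n ℕ.∸ suc j) t (suc j))
    ≡⟨ cong₂ ℕ._+_ (subset-of-subset n t j)
                   (cong₂ ℕ._+_ (subset-of-subset n (suc t) (suc j)) (subset-of-subset n t (suc j))) ⟩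
  (n C t) ℕ.* (t C j) ℕ.+ ((n C suc t) ℕ.* (suc t C suc j) ℕ.+ (n C t) ℕ.* (t C suc j))
    ≡⟨ arrange (n C t) (n C suc t) (t C j) (t C suc j) (suc t C suc j) ⟩
  (n C t) ℕ.* ((t C j) ℕ.+ (t C suc j)) ℕ.+ (n C suc t) ℕ.* (suc t C suc j)
    ≡⟨ cong (λ z → (n C t) ℕ.* z ℕ.+ (n C suc t) ℕ.* (suc t C suc j)) (nCk+nC[k+1]≡[n+1]C[k+1] t j) ⟩
  (n C t) ℕ.* (suc t C suc j) ℕ.+ (n C suc t) ℕ.* (suc t C suc j)
    ≡⟨ sym (ℕₚ.*-distribʳ-+ (suc t C suc j) (n C t) (n C suc t)) ⟩
  ((n C t) ℕ.+ (n C suc t)) ℕ.* (suc t C suc j)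
    ≡⟨ cong (ℕ._* (suc t C suc j)) (nCk+nC[k+1]≡[n+1]C[k+1] n t) ⟩
  (suc n C suc t) ℕ.* (suc t C suc j) ∎
  where
  arrange : ∀ a b x y z → a ℕ.* x ℕ.+ (b ℕ.* z ℕ.+ a ℕ.* y) ≡ a ℕ.* (x ℕ.+ y) ℕ.+ b ℕ.* z
  arrange = ℕ-solve-∀
  upper : (n C suc j) ℕ.* binom (n ℕ.∸ j) t j
        ≡ (n C suc j) ℕ.* binom (n ℕ.∸ suc j) (suc t) (suc j) ℕ.+ (n C suc j) ℕ.* binom (n ℕ.∸ suc j) t (suc j)
  upper with suc j ℕ.≤? n
  ... | yes j<n = begin
    (n C suc j) ℕ.* binom (n ℕ.∸ j) t j
      ≡⟨ cong (λ z → (n C suc j) ℕ.* binom z t j) (ℕₚ.+-∸-assoc 1 j<n) ⟩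
    (n C suc j) ℕ.* binom (suc (n ℕ.∸ suc j)) (suc t) (suc j)
      ≡⟨ cong ((n C suc j) ℕ.*_) (binom-pascal (n ℕ.∸ suc j) t (suc j)) ⟩
    (n C suc j) ℕ.* (binom (n ℕ.∸ suc j) (suc t) (suc j) ℕ.+ binom (n ℕ.∸ suc j) t (suc j))
      ≡⟨ ℕₚ.*-distribˡ-+ (n C suc j) _ _ ⟩
    _ ∎
  ... | no j≮n rewrite k>n⇒nCk≡0 {n} {suc j} (ℕₚ.≰⇒> j≮n) = refl

-- The determinant of the statement

sumFin-cong : ∀ n {f g : Fin n → ℤ} → (∀ i → f i ≡ g i) → sumFin n f ≡ sumFin n g
sumFin-cong zero    f≡g = refl
sumFin-cong (suc n) f≡g = cong₂ ℤ._+_ (f≡g Fin.zero) (sumFin-cong n (λ i → f≡g (Fin.suc i)))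

sumFin-neg : ∀ n (f : Fin n → ℤ) → sumFin n (λ i → ℤ.- f i) ≡ ℤ.- sumFin n f
sumFin-neg zero    f = refl
sumFin-neg (suc n) f = trans (cong (λ z → ℤ.- f Fin.zero ℤ.+ z) (sumFin-neg n (f ∘ Fin.suc)))
                             (sym (ℤₚ.neg-distrib-+ (f Fin.zero) _))

sign-suc : ∀ n → sign (suc n) ≡ ℤ.- sign n
sign-suc zero          = refl
sign-suc (suc zero)    = refl
sign-suc (suc (suc n)) = sign-suc n

private
  expansion : ∀ n → (ℕ → ℤ) → (Fin n → ℕ) → (Fin n → ℤ) → (Fin n → ℤ) → ℤ
  expansion n v c σ H = sumFin n (λ j → σ j ℤ.* v (c j) ℤ.* H j)

  expansion-neg : ∀ n v c (H : Fin n → ℤ) →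
    fromℤ (expansion n v c (λ j → sign (suc (toℕ j))) H) ≡ - fromℤ (expansion n v c (sign ∘ toℕ) H)
  expansion-neg n v c H = trans (cong fromℤ (trans (sumFin-cong n negate) (sumFin-neg n term)))
                                (fromℤ-neg (expansion n v c (sign ∘ toℕ) H))
    where
    term : Fin n → ℤ
    term j = sign (toℕ j) ℤ.* v (c j) ℤ.* H j
    negate : ∀ j → sign (suc (toℕ j)) ℤ.* v (c j) ℤ.* H j ≡ ℤ.- term j
    negate j = trans (cong (λ z → z ℤ.* v (c j) ℤ.* H j) (sign-suc (toℕ j)))
      (trans (cong (ℤ._* H j) (sym (ℤₚ.neg-distribˡ-* (sign (toℕ j)) (v (c j)))))
             (sym (ℤₚ.neg-distribˡ-* (sign (toℕ j) ℤ.* v (c j)) (H j))))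

-- The explicit signs come out of the nested subtractions: past the first column all signs flip, so
-- the rest is minus an expansion along the remaining columns. In each of its minors the first
-- column survives, since `punchIn (suc j) zero` is `zero`; hence the functional `h (c zero ∷ _)`.
contract-expand : ∀ n (v : ℕ → ℤ) h (c : Fin (suc n) → ℕ) (H : Fin (suc n) → ℤ) →
  (∀ j → fromℤ (H j) ≡ h (tabulate (c ∘ punchIn j))) →
  fromℤ (sumFin (suc n) (λ j → sign (toℕ j) ℤ.* v (c j) ℤ.* H j)) ≡ contract (fromℤ ∘ v) h (tabulate c)
contract-expand n v h c H H≡ = begin
  fromℤ (sign 0 ℤ.* v (c Fin.zero) ℤ.* H Fin.zero ℤ.+ rest)
    ≡⟨ fromℤ-+ (sign 0 ℤ.* v (c Fin.zero) ℤ.* H Fin.zero) rest ⟩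
  fromℤ (sign 0 ℤ.* v (c Fin.zero) ℤ.* H Fin.zero) + fromℤ rest
    ≡⟨ cong₂ _+_ (trans (fromℤ-* (sign 0 ℤ.* v (c Fin.zero)) (H Fin.zero))
                        (cong₂ _*_ (cong fromℤ (ℤₚ.*-identityˡ (v (c Fin.zero)))) (H≡ Fin.zero)))
                 (tail n c H H≡) ⟩
  fromℤ (v (c Fin.zero)) * h (tabulate (c ∘ Fin.suc))
    - contract (fromℤ ∘ v) (λ l → h (c Fin.zero ∷ l)) (tabulate (c ∘ Fin.suc)) ∎
  where
  rest = expansion n v (c ∘ Fin.suc) (λ j → sign (suc (toℕ j))) (H ∘ Fin.suc)
  tail : ∀ n (c : Fin (suc n) → ℕ) (H : Fin (suc n) → ℤ) →
    (∀ j → fromℤ (H j) ≡ h (tabulate (c ∘ punchIn j))) →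
    fromℤ (expansion n v (c ∘ Fin.suc) (λ j → sign (suc (toℕ j))) (H ∘ Fin.suc))
      ≡ - contract (fromℤ ∘ v) (λ l → h (c Fin.zero ∷ l)) (tabulate (c ∘ Fin.suc))
  tail zero    c H H≡ = refl
  tail (suc n) c H H≡ = trans (expansion-neg (suc n) v (c ∘ Fin.suc) (H ∘ Fin.suc))
    (cong -_ (contract-expand n v (λ l → h (c Fin.zero ∷ l)) (c ∘ Fin.suc) (H ∘ Fin.suc) (λ j → H≡ (Fin.suc j))))

-- Determinants of binomial coefficients

𝟙 : ∀ {P : Set} → Dec P → ℚ
𝟙 (yes _) = 1ℚ
𝟙 (no _)  = 0ℚ

𝟙-yes : ∀ {P : Set} (P? : Dec P) → P → 𝟙 P? ≡ 1ℚ
𝟙-yes (yes _) p = refl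
𝟙-yes (no ¬p) p = ⊥-elim (¬p p)

𝟙-no : ∀ {P : Set} (P? : Dec P) → ¬ P → 𝟙 P? ≡ 0ℚ
𝟙-no (yes p) ¬p = ⊥-elim (¬p p)
𝟙-no (no _)  ¬p = refl

𝟙-cong : ∀ {P Q : Set} (P? : Dec P) (Q? : Dec Q) → (P → Q) → (Q → P) → 𝟙 P? ≡ 𝟙 Q?
𝟙-cong (yes p) Q? f g = sym (𝟙-yes Q? (f p))
𝟙-cong (no ¬p) Q? f g = sym (𝟙-no Q? (λ q → ¬p (g q)))

𝟙-× : ∀ {P Q : Set} (P? : Dec P) (Q? : Dec Q) → 𝟙 (P? ×-dec Q?) ≡ 𝟙 P? * 𝟙 Q?
𝟙-× (yes _) (yes _) = refl
𝟙-× (yes _) (no _)  = refl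
𝟙-× (no _)  (yes _) = refl
𝟙-× (no _)  (no _)  = refl

module _ {L G : Set} where

  rowForm-zeroOn : ∀ {P : G → Set} (R : L → G → ℚ) ls {h} → (∀ gs → All P gs → h gs ≡ 0ℚ) →
                   ∀ gs → All P gs → rowForm R ls h gs ≡ 0ℚ
  rowForm-zeroOn R ls {h} h≡0 gs ps = trans
    (rowForm-cong ls {h = h} {h′ = λ _ → 0ℚ} (λ _ _ _ → refl) h≡0 gs ps) (rowForm-zero R ls (λ _ → refl) gs)

  contract-zeroOn : ∀ {P : G → Set} {v : G → ℚ} h → (∀ g → P g → v g ≡ 0ℚ) →
                    ∀ gs → All P gs → contract v h gs ≡ 0ℚ
  contract-zeroOn h v≡0 gs ps = contract-zeroˡ h gs (All.map (λ {g} → v≡0 g) ps)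

  rowForm-zeroRow : ∀ {P : G → Set} (R : L → G → ℚ) {l ls} h → l ∈ ls → (∀ g → P g → R l g ≡ 0ℚ) →
                    ∀ gs → All P gs → rowForm R ls h gs ≡ 0ℚ
  rowForm-zeroRow R {ls = _ ∷ ls} h (here refl) z = rowForm-zeroOn R ls (contract-zeroOn h z)
  rowForm-zeroRow R {ls = x ∷ ls} h (there l∈)  z = rowForm-zeroRow R (contract (R x) h) l∈ z

  rowForm-∷ʳ : ∀ (R : L → G → ℚ) x ls h gs →
               rowForm R (ls ++ x ∷ []) h gs ≡ contract (R x) (rowForm R ls h) gs
  rowForm-∷ʳ R x []       h gs = refl
  rowForm-∷ʳ R x (l ∷ ls) h gs = rowForm-∷ʳ R x ls (contract (R l) h) gs

  rowForm-scaleʳ : ∀ c (R : L → G → ℚ) ls h gs → rowForm R ls (λ l → c * h l) gs ≡ c * rowForm R ls h gs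
  rowForm-scaleʳ c R ls h gs = begin
    rowForm R ls (λ l → c * h l) gs
      ≡⟨ rowForm-congʳ R ls (λ l → sym (ℚₚ.+-identityˡ (c * h l))) gs ⟩
    rowForm R ls (λ l → 0ℚ + c * h l) gs
      ≡⟨ rowForm-linear c R ls (λ _ → 0ℚ) h gs ⟩
    rowForm R ls (λ _ → 0ℚ) gs + c * rowForm R ls h gs
      ≡⟨ cong (_+ c * rowForm R ls h gs) (rowForm-zero R ls (λ _ → refl) gs) ⟩
    0ℚ + c * rowForm R ls h gs
      ≡⟨ ℚₚ.+-identityˡ (c * rowForm R ls h gs) ⟩
    c * rowForm R ls h gs ∎

  rowForm-scaleRows : ∀ (d : L → ℚ) (R : L → G → ℚ) ls h gs →
    rowForm (λ l g → d l * R l g) ls h gs ≡ ∏ ls d * rowForm R ls h gs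
  rowForm-scaleRows d R []       h gs = sym (ℚₚ.*-identityˡ (h gs))
  rowForm-scaleRows d R (l ∷ ls) h gs = begin
    rowForm R′ ls (contract (λ g → d l * R l g) h) gs
      ≡⟨ rowForm-congʳ R′ ls scale gs ⟩
    rowForm R′ ls (λ l′ → d l * contract (R l) h l′) gs
      ≡⟨ rowForm-scaleʳ (d l) R′ ls (contract (R l) h) gs ⟩
    d l * rowForm R′ ls (contract (R l) h) gs
      ≡⟨ cong (d l *_) (rowForm-scaleRows d R ls (contract (R l) h) gs) ⟩
    d l * (∏ ls d * rowForm R ls (contract (R l) h) gs)
      ≡⟨ sym (ℚₚ.*-assoc (d l) (∏ ls d) (rowForm R ls (contract (R l) h) gs)) ⟩
    d l * ∏ ls d * rowForm R ls (contract (R l) h) gs ∎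
    where
    R′ : L → G → ℚ
    R′ l′ g = d l′ * R l′ g
    scale : ∀ gs → contract (λ g → d l * R l g) h gs ≡ d l * contract (R l) h gs
    scale gs = begin
      contract (λ g → d l * R l g) h gs
        ≡⟨ contract-cong {P = λ _ → ⊤} (λ g _ → sym (ℚₚ.+-identityˡ (d l * R l g))) (λ _ _ → refl) gs
             (All.universal (λ _ → tt) gs) ⟩
      contract (λ g → 0ℚ + d l * R l g) h gs
        ≡⟨ contract-linearˡ (d l) (λ _ → 0ℚ) (R l) h gs ⟩
      contract (λ _ → 0ℚ) h gs + d l * contract (R l) h gs
        ≡⟨ cong (_+ d l * contract (R l) h gs) (contract-zeroˡ h gs (All.universal (λ _ → refl) gs)) ⟩
      0ℚ + d l * contract (R l) h gs
        ≡⟨ ℚₚ.+-identityˡ (d l * contract (R l) h gs) ⟩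
      d l * contract (R l) h gs ∎

  rowForm-scaleColumns : ∀ (c : G → ℚ) (R : L → G → ℚ) ls h gs →
    rowForm (λ l g → c g * R l g) ls (λ l → ∏ l c * h l) gs
      ≡ ∏ gs c * rowForm R ls h gs
  rowForm-scaleColumns c R []       h gs = refl
  rowForm-scaleColumns c R (l ∷ ls) h gs = trans
    (rowForm-congʳ (λ l g → c g * R l g) ls (contract-scale c (R l) h) gs)
    (rowForm-scaleColumns c R ls (contract (R l) h) gs)

  rowForm-mapColumns : ∀ {G′ : Set} (f : G → G′) (R : L → G′ → ℚ) ls h gs →
    rowForm R ls h (map f gs) ≡ rowForm (λ l → R l ∘ f) ls (h ∘ map f) gs
  rowForm-mapColumns f R []       h gs = refl
  rowForm-mapColumns f R (l ∷ ls) h gs = trans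
    (rowForm-mapColumns f R ls (contract (R l) h) gs)
    (rowForm-congʳ (λ l → R l ∘ f) ls (contract-map f (R l) h) gs)

rowForm-mapRows : ∀ {L L′ G : Set} (f : L → L′) (R : L′ → G → ℚ) ls h gs →
  rowForm R (map f ls) h gs ≡ rowForm (R ∘ f) ls h gs
rowForm-mapRows f R []       h gs = refl
rowForm-mapRows f R (l ∷ ls) h gs = rowForm-mapRows f R ls (contract (R (f l)) h) gs

Descending StrictlyDescending : List ℕ → Set
Descending         = Linked ℕ._≥_
StrictlyDescending = Linked ℕ._>_

strictlyDescending? : ∀ ls → Dec (StrictlyDescending ls)
strictlyDescending? = Linked.linked? ℕ._>?_

-- A weakly descending list that is not strictly descending has two equal neighbours, hence the
-- determinant has two equal adjacent rows.
rowForm-degenerate : ∀ {G : Set} (R : ℕ → G → ℚ) {ls} h → Descending ls → ¬ StrictlyDescending ls →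
                     ∀ gs → rowForm R ls h gs ≡ 0ℚ
rowForm-degenerate R h []  ¬s gs = ⊥-elim (¬s [])
rowForm-degenerate R h [-] ¬s gs = ⊥-elim (¬s [-])
rowForm-degenerate R {x ∷ y ∷ ls} h (x≥y ∷ d) ¬s gs with ℕₚ.m≤n⇒m<n∨m≡n x≥y
... | inj₁ y<x  = rowForm-degenerate R (contract (R x) h) d (λ s → ¬s (y<x ∷ s)) gs
... | inj₂ refl = rowForm-repeated R x ls h gs

-- On the columns j = 1, ..., k the number `m + (k ∸ j)` is N - j with N = m + k. It is split in
-- this way because `k`, the length of the pattern, stays fixed while `m`, the number of the other
-- sites, is the induction variable.
pathDet : ℕ → ℕ → List ℕ → ℚ
pathDet k m ls = rowForm (λ l j → fromℕ (binom (m ℕ.+ (k ℕ.∸ j)) l j)) ls unit (from 1 k)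

pathDet-suc : ∀ k m ls → pathDet k (suc m) ls ≡ shiftSum 1ℚ (pathDet k m) ls
pathDet-suc k m ls = trans
  (rowForm-congˡ ls unit (λ l j → binom-shift (m ℕ.+ (k ℕ.∸ j)) l j) (from 1 k))
  (rowForm-shift 1ℚ (λ l j → fromℕ (binom (m ℕ.+ (k ℕ.∸ j)) l j)) ls unit (from 1 k))

from-≥ : ∀ a n → All (a ≤_) (from a n)
from-≥ a zero    = []
from-≥ a (suc n) = ℕₚ.≤-refl ∷ All.map (ℕₚ.≤-trans (ℕₚ.n≤1+n a)) (from-≥ (suc a) n)

from-< : ∀ a n → All (_< a ℕ.+ n) (from a n)
from-< a zero    = []
from-< a (suc n) = ℕₚ.m<m+n a (s≤s z≤n) ∷ subst (λ z → All (_< z) (from (suc a) n)) (sym (ℕₚ.+-suc a n)) (from-< (suc a) n)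

pathDet-large : ∀ k m {l ls} → l ∈ ls → m ℕ.+ k < l → pathDet k m ls ≡ 0ℚ
pathDet-large k m {l} l∈ls m+k<l =
  rowForm-zeroRow _ unit l∈ls (λ j j≤k → cong fromℕ (binom-> _ l j (m+k∸j+j<l j j≤k))) (from 1 k) (from-< 1 k)
  where
  m+k∸j+j<l : ∀ j → j < suc k → m ℕ.+ (k ℕ.∸ j) ℕ.+ j < l
  m+k∸j+j<l j (s≤s j≤k) = subst (_< l)
    (sym (trans (ℕₚ.+-assoc m (k ℕ.∸ j) j) (cong (m ℕ.+_) (ℕₚ.m∸n+n≡m j≤k)))) m+k<l

pathDet-0∈ : ∀ k m {ls} → 0 ∈ ls → pathDet k m ls ≡ 0ℚ
pathDet-0∈ k m 0∈ls =
  rowForm-zeroRow _ unit 0∈ls (λ j 1≤j → cong fromℕ (binom-< _ 0 j 1≤j)) (from 1 k) (from-≥ 1 k)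

down : ℕ → ℕ → List ℕ
down a zero    = []
down a (suc n) = a ℕ.+ suc n ∷ down a n

down-∷ʳ : ∀ a n → down a (suc n) ≡ down (suc a) n ++ suc a ∷ []
down-∷ʳ a zero    = cong (_∷ []) (ℕₚ.+-comm a 1)
down-∷ʳ a (suc n) = cong₂ _∷_ (ℕₚ.+-suc a (suc n)) (down-∷ʳ a n)

-- The last entry of `down 0 k` is the top row, so rows and columns both run through 1, ..., k. The
-- entry C(k - j, l - j) is 0 for l < j and 1 for l = j.
pathDet-down : ∀ k → pathDet k 0 (down 0 k) ≡ 1ℚ
pathDet-down k = unitriangular 0 k
  where
  R : ℕ → ℕ → ℚ
  R l j = fromℕ (binom (k ℕ.∸ j) l j)
  diagonal : ∀ n l → binom n l l ≡ 1
  diagonal n zero    = refl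
  diagonal n (suc l) = diagonal n l
  unitriangular : ∀ a n → rowForm R (down a n) unit (from (suc a) n) ≡ 1ℚ
  unitriangular a zero    = refl
  unitriangular a (suc n) = begin
    rowForm R (down a (suc n)) unit (from (suc a) (suc n))
      ≡⟨ cong (λ ls → rowForm R ls unit (from (suc a) (suc n))) (down-∷ʳ a n) ⟩
    rowForm R (down (suc a) n ++ suc a ∷ []) unit (from (suc a) (suc n))
      ≡⟨ rowForm-∷ʳ R (suc a) (down (suc a) n) unit (from (suc a) (suc n)) ⟩
    R (suc a) (suc a) * rowForm R (down (suc a) n) unit (from (suc (suc a)) n)
      - contract (R (suc a)) (λ l → rowForm R (down (suc a) n) unit (suc a ∷ l)) (from (suc (suc a)) n)
      ≡⟨ cong₂ (λ x y → x - y)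
           (cong₂ _*_ (cong fromℕ (diagonal (k ℕ.∸ suc a) (suc a))) (unitriangular (suc a) n))
           (contract-zeroˡ _ _ (All.map (λ {j} a<j → cong fromℕ (binom-< (k ℕ.∸ j) (suc a) j a<j)) (from-≥ (suc (suc a)) n))) ⟩
    1ℚ * 1ℚ - 0ℚ ∎

descending-below : ∀ {x ls} → StrictlyDescending (x ∷ ls) → All (_< x) ls
descending-below [-]       = []
descending-below (y<x ∷ s) = y<x ∷ All.map (λ z<y → ℕₚ.<-trans z<y y<x) (descending-below s)

strictlyDescending-small : ∀ {ls} → StrictlyDescending ls → All (_≤ length ls) ls →
                           0 ∈ ls ⊎ ls ≡ down 0 (length ls)
-- Pigeonhole: the list leaves out exactly one of the numbers 0, ..., k, where k is its length.
-- Together with the zero rows of `pathDet-large` and `pathDet-0∈` this evaluates `pathDet k 0` on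
-- all strictly descending lists of length k.
strictlyDescending-small {[]}         s _  = inj₂ refl
strictlyDescending-small {zero ∷ ls}  s _  = inj₁ (here refl)
strictlyDescending-small {suc x ∷ ls} s (s≤s x≤ ∷ _)
  with strictlyDescending-small (Linked.tail s) (All.map (λ y<1+x → ℕₚ.≤-trans (ℕ.s≤s⁻¹ y<1+x) x≤) (descending-below s))
... | inj₁ 0∈ls = inj₁ (there 0∈ls)
... | inj₂ ls≡  with ls | s | x≤
...   | []     | _           | z≤n = inj₂ refl
...   | y ∷ ls | s≤s y≤x ∷ _ | x≤  = inj₂ (cong₂ _∷_ (cong suc (ℕₚ.≤-antisym x≤ (subst (_≤ x) (Listₚ.∷-injectiveˡ ls≡) y≤x))) ls≡)

-- Column j is multiplied by C(N, j), and `subset-of-subset` turns this into a factor C(N, l) of row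
-- l. The bound j ≤ k identifies `m + (k ∸ j)` with `m + k ∸ j`. The factors that column scaling
-- places on `unit` disappear because `unit` is nonzero only on the empty list, where the product is
-- 1.
pathDet-scale : ∀ k m ls →
  pathDet k m ls * ∏ (from 1 k) (λ j → fromℕ ((m ℕ.+ k) C j))
    ≡ ∏ ls (λ l → fromℕ ((m ℕ.+ k) C l)) * rowForm (λ l j → fromℕ (l C j)) ls unit (from 1 k)
pathDet-scale k m ls = begin
  pathDet k m ls * ∏ (from 1 k) c
    ≡⟨ ℚₚ.*-comm (pathDet k m ls) (∏ (from 1 k) c) ⟩
  ∏ (from 1 k) c * pathDet k m ls
    ≡⟨ sym (rowForm-scaleColumns c _ ls unit (from 1 k)) ⟩
  rowForm (λ l j → c j * fromℕ (binom (m ℕ.+ (k ℕ.∸ j)) l j)) ls (λ l → ∏ l c * unit l) (from 1 k)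
    ≡⟨ rowForm-cong ls entry ∏-unit (from 1 k) (from-< 1 k) ⟩
  rowForm (λ l j → c l * fromℕ (l C j)) ls unit (from 1 k)
    ≡⟨ rowForm-scaleRows c _ ls unit (from 1 k) ⟩
  ∏ ls c * rowForm (λ l j → fromℕ (l C j)) ls unit (from 1 k) ∎
  where
  c : ℕ → ℚ
  c j = fromℕ ((m ℕ.+ k) C j)
  ∏-unit : ∀ l → All (_< suc k) l → ∏ l c * unit l ≡ unit l
  ∏-unit []      _ = refl
  ∏-unit (j ∷ l) _ = ℚₚ.*-zeroʳ (∏ (j ∷ l) c)
  entry : ∀ l j → j < suc k → c j * fromℕ (binom (m ℕ.+ (k ℕ.∸ j)) l j) ≡ c l * fromℕ (l C j)
  entry l j (s≤s j≤k) = begin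
    c j * fromℕ (binom (m ℕ.+ (k ℕ.∸ j)) l j)
      ≡⟨ cong (λ n → c j * fromℕ (binom n l j)) (sym (ℕₚ.+-∸-assoc m j≤k)) ⟩
    c j * fromℕ (binom (m ℕ.+ k ℕ.∸ j) l j)
      ≡⟨ sym (fromℕ-* ((m ℕ.+ k) C j) _) ⟩
    fromℕ (((m ℕ.+ k) C j) ℕ.* binom (m ℕ.+ k ℕ.∸ j) l j)
      ≡⟨ cong fromℕ (subset-of-subset (m ℕ.+ k) l j) ⟩
    fromℕ (((m ℕ.+ k) C l) ℕ.* (l C j))
      ≡⟨ fromℕ-* ((m ℕ.+ k) C l) (l C j) ⟩
    c l * fromℕ (l C j) ∎

-- Pascal's rule on the rows lowers the column index, and on the columns it
-- raises the row index.
shiftSum-binomials : ∀ k es →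
  shiftSum (- 1ℚ) (λ ls → rowForm (λ l j → fromℕ (l C j)) ls unit (from 1 k)) (map suc es)
    ≡ rowForm (λ l j → fromℕ (l C j)) (map suc es) unit (from 0 k)
shiftSum-binomials k es = begin
  shiftSum (- 1ℚ) (λ ls → rowForm B ls unit (from 1 k)) (map suc es)
    ≡⟨ sym (rowForm-shift (- 1ℚ) B (map suc es) unit (from 1 k)) ⟩
  rowForm (λ l j → shift (- 1ℚ) (λ l′ → B l′ j) l) (map suc es) unit (from 1 k)
    ≡⟨ rowForm-mapRows suc _ es unit (from 1 k) ⟩
  rowForm (λ e j → B (suc e) j + - 1ℚ * B e j) es unit (from 1 k)
    ≡⟨ cong (rowForm _ es unit) (sym (map-suc-from 0 k)) ⟩
  rowForm (λ e j → B (suc e) j + - 1ℚ * B e j) es unit (map suc (from 0 k))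
    ≡⟨ rowForm-mapColumns suc _ es unit (from 0 k) ⟩
  rowForm (λ e j → B (suc e) (suc j) + - 1ℚ * B e (suc j)) es (unit ∘ map suc) (from 0 k)
    ≡⟨ trans (rowForm-congˡ es (unit ∘ map suc) rows (from 0 k)) (rowForm-congʳ B es unit-map (from 0 k)) ⟩
  rowForm B es unit (from 0 k)
    ≡⟨ sym (shiftSum-from 1ℚ (rowForm B es unit) k (rowForm-alternating B es unit unit-alternating)) ⟩
  shiftSum 1ℚ (rowForm B es unit) (from 0 k)
    ≡⟨ sym (rowForm-columnShift 1ℚ B es unit (from 0 k)) ⟩
  rowForm (λ e → shift 1ℚ (B e)) es (shiftSum 1ℚ unit) (from 0 k)
    ≡⟨ trans (rowForm-congˡ es (shiftSum 1ℚ unit) columns (from 0 k))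
             (rowForm-congʳ (B ∘ suc) es (shiftSum-unit 1ℚ) (from 0 k)) ⟩
  rowForm (B ∘ suc) es unit (from 0 k)
    ≡⟨ sym (rowForm-mapRows suc B es unit (from 0 k)) ⟩
  rowForm B (map suc es) unit (from 0 k) ∎
  where
  B : ℕ → ℕ → ℚ
  B l j = fromℕ (l C j)
  pascal : ∀ e j → B (suc e) (suc j) ≡ B e j + B e (suc j)
  pascal e j = trans (cong fromℕ (sym (nCk+nC[k+1]≡[n+1]C[k+1] e j))) (fromℕ-+ (e C j) (e C suc j))
  rows : ∀ e j → B (suc e) (suc j) + - 1ℚ * B e (suc j) ≡ B e j
  rows e j = trans (cong (_+ - 1ℚ * B e (suc j)) (pascal e j)) (lem (B e j) (B e (suc j)))
    where lem : ∀ a b → a + b + - 1ℚ * b ≡ a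
          lem = solve-∀ ℚ-ring
  columns : ∀ e j → shift 1ℚ (B e) j ≡ B (suc e) j
  columns e zero    = refl
  columns e (suc j) = sym (trans (pascal e j) (lem (B e j) (B e (suc j))))
    where lem : ∀ a b → a + b ≡ b + 1ℚ * a
          lem = solve-∀ ℚ-ring
  unit-map : ∀ l → unit (map suc l) ≡ unit l
  unit-map []      = refl
  unit-map (_ ∷ _) = refl

toList-reverse-∷ : ∀ {k} x (xs : Vec ℕ k) → toList (reverse (x ∷ xs)) ≡ toList (reverse xs) ++ x ∷ []
toList-reverse-∷ x xs = trans (cong toList (Vecₚ.reverse-∷ x xs)) (Vecₚ.toList-∷ʳ x (reverse xs))

-- `rowForm` keeps the top row last, so the rows appear reversed. This is the same reversal that
-- turns x₂ < ⋯ < xₙ into the word xₙ ⋯ x₂.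
det-rowForm : ∀ n (R : ℕ → ℕ → ℤ) (xs : Vec ℕ n) (c : Fin n → ℕ) →
  fromℤ (det n (λ i j → R (lookup xs i) (c j)))
    ≡ rowForm (λ l j → fromℤ (R l j)) (toList (reverse xs)) unit (tabulate c)
det-rowForm zero    R []       c = refl
det-rowForm (suc n) R (x ∷ xs) c = begin
  fromℤ (det (suc n) (λ i j → R (lookup (x ∷ xs) i) (c j)))
    ≡⟨ contract-expand n (R x) (rowForm R′ (toList (reverse xs)) unit) c
         (λ j → det n (λ r i → R (lookup xs r) (c (punchIn j i))))
         (λ j → det-rowForm n R xs (c ∘ punchIn j)) ⟩
  contract (R′ x) (rowForm R′ (toList (reverse xs)) unit) (tabulate c)
    ≡⟨ sym (rowForm-∷ʳ R′ x (toList (reverse xs)) unit (tabulate c)) ⟩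
  rowForm R′ (toList (reverse xs) ++ x ∷ []) unit (tabulate c)
    ≡⟨ cong (λ ls → rowForm R′ ls unit (tabulate c))
         (sym (toList-reverse-∷ x xs)) ⟩
  rowForm R′ (toList (reverse (x ∷ xs))) unit (tabulate c) ∎
  where
  R′ : ℕ → ℕ → ℚ
  R′ l j = fromℤ (R l j)

-- Finite sums

∑ : ∀ {A : Set} → List A → (A → ℚ) → ℚ
∑ []       f = 0ℚ
∑ (x ∷ xs) f = f x + ∑ xs f

module _ {A : Set} where

  ∑-cong-All : ∀ {f g : A → ℚ} {xs} → All (λ x → f x ≡ g x) xs → ∑ xs f ≡ ∑ xs g
  ∑-cong-All []       = refl
  ∑-cong-All (e ∷ es) = cong₂ _+_ e (∑-cong-All es)

  ∑-cong : ∀ {f g : A → ℚ} xs → (∀ x → f x ≡ g x) → ∑ xs f ≡ ∑ xs g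
  ∑-cong xs f≡g = ∑-cong-All (All.universal f≡g xs)

  ∑-zero : ∀ (xs : List A) → ∑ xs (λ _ → 0ℚ) ≡ 0ℚ
  ∑-zero []       = refl
  ∑-zero (x ∷ xs) = trans (ℚₚ.+-identityˡ _) (∑-zero xs)

  ∑-linear : ∀ c (f g : A → ℚ) xs → ∑ xs (λ x → f x + c * g x) ≡ ∑ xs f + c * ∑ xs g
  ∑-linear c f g []       = lem c
    where lem : ∀ c → 0ℚ ≡ 0ℚ + c * 0ℚ
          lem = solve-∀ ℚ-ring
  ∑-linear c f g (x ∷ xs) = trans (cong (f x + c * g x ℚ.+_) (∑-linear c f g xs)) (lem c (f x) (g x) (∑ xs f) (∑ xs g))
    where lem : ∀ c a b x y → (a + c * b) + (x + c * y) ≡ (a + x) + c * (b + y)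
          lem = solve-∀ ℚ-ring

  ∑-scale : ∀ c (f : A → ℚ) xs → ∑ xs (λ x → c * f x) ≡ c * ∑ xs f
  ∑-scale c f []       = sym (ℚₚ.*-zeroʳ c)
  ∑-scale c f (x ∷ xs) = trans (cong (c * f x ℚ.+_) (∑-scale c f xs)) (sym (ℚₚ.*-distribˡ-+ c (f x) (∑ xs f)))

  ∑-+ : ∀ (f g : A → ℚ) xs → ∑ xs (λ x → f x + g x) ≡ ∑ xs f + ∑ xs g
  ∑-+ f g xs = trans (∑-cong xs (λ x → cong (f x ℚ.+_) (sym (ℚₚ.*-identityˡ (g x)))))
    (trans (∑-linear 1ℚ f g xs) (cong (∑ xs f ℚ.+_) (ℚₚ.*-identityˡ (∑ xs g))))

  ∑-++ : ∀ (f : A → ℚ) xs ys → ∑ (xs ++ ys) f ≡ ∑ xs f + ∑ ys f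
  ∑-++ f []       ys = sym (ℚₚ.+-identityˡ (∑ ys f))
  ∑-++ f (x ∷ xs) ys = trans (cong (f x ℚ.+_) (∑-++ f xs ys)) (sym (ℚₚ.+-assoc (f x) (∑ xs f) (∑ ys f)))

  ∑-filter : ∀ {P : A → Set} (P? : ∀ x → Dec (P x)) f xs → ∑ (filter P? xs) f ≡ ∑ xs (λ x → 𝟙 (P? x) * f x)
  ∑-filter P? f []       = refl
  ∑-filter P? f (x ∷ xs) with P? x
  ... | yes _ = cong₂ _+_ (sym (ℚₚ.*-identityˡ (f x))) (∑-filter P? f xs)
  ... | no  _ = trans (∑-filter P? f xs) (lem (f x) _)
    where lem : ∀ a b → b ≡ 0ℚ * a + b
          lem = solve-∀ ℚ-ring

∑-map : ∀ {A B : Set} (h : A → B) (f : B → ℚ) xs → ∑ (map h xs) f ≡ ∑ xs (f ∘ h)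
∑-map h f []       = refl
∑-map h f (x ∷ xs) = cong (f (h x) ℚ.+_) (∑-map h f xs)

∑-concatMap : ∀ {A B : Set} (h : A → List B) (f : B → ℚ) xs → ∑ (concatMap h xs) f ≡ ∑ xs (λ x → ∑ (h x) f)
∑-concatMap h f []       = refl
∑-concatMap h f (x ∷ xs) = trans (∑-++ f (h x) (concatMap h xs)) (cong (∑ (h x) f ℚ.+_) (∑-concatMap h f xs))

∑-swap : ∀ {A B : Set} (f : A → B → ℚ) xs ys → ∑ xs (λ x → ∑ ys (f x)) ≡ ∑ ys (λ y → ∑ xs (λ x → f x y))
∑-swap f []       ys = sym (∑-zero ys)
∑-swap f (x ∷ xs) ys = trans (cong (∑ ys (f x) ℚ.+_) (∑-swap f xs ys)) (sym (∑-+ (f x) _ ys))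

shiftSum-∑ : ∀ {A : Set} s (xs : List A) (h : A → List ℕ → ℚ) gs →
  shiftSum s (λ l → ∑ xs (λ x → h x l)) gs ≡ ∑ xs (λ x → shiftSum s (h x) gs)
shiftSum-∑ s xs h []           = refl
shiftSum-∑ s xs h (zero ∷ gs)  = shiftSum-∑ s xs (λ x l → h x (zero ∷ l)) gs
shiftSum-∑ s xs h (suc g ∷ gs) = trans
  (cong₂ (λ a b → a + s * b) (shiftSum-∑ s xs (λ x l → h x (suc g ∷ l)) gs) (shiftSum-∑ s xs (λ x l → h x (g ∷ l)) gs))
  (sym (∑-linear s (λ x → shiftSum s (λ l → h x (suc g ∷ l)) gs) (λ x → shiftSum s (λ l → h x (g ∷ l)) gs) xs))

-- Words and queues

Word : ℕ → Set
Word = Vec Bool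

words : ∀ n → List (Word n)
words zero    = [] ∷ []
words (suc n) = map (false ∷_) (words n) ++ map (true ∷_) (words n)

∑-words : ∀ n (f : Word (suc n) → ℚ) →
  ∑ (words (suc n)) f ≡ ∑ (words n) (λ w → f (false ∷ w)) + ∑ (words n) (λ w → f (true ∷ w))
∑-words n f = trans (∑-++ f (map (false ∷_) (words n)) (map (true ∷_) (words n)))
                    (cong₂ _+_ (∑-map (false ∷_) f (words n)) (∑-map (true ∷_) f (words n)))

bit : Bool → ℕ
bit false = 0
bit true  = 1

count : ∀ {n} → Word n → ℕ
count []      = 0
count (b ∷ w) = bit b ℕ.+ count w

-- At each site the arrival (first bit) precedes the service (second bit).
next : ℕ → Bool → Bool → ℕ
next q       false false = q
next q       true  false = suc q
next q       true  true  = q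
next zero    false true  = zero
next (suc q) false true  = q

departs : ℕ → Bool → Bool → Bool
departs q       a     false = false
departs q       true  true  = true
departs zero    false true  = false
departs (suc q) false true  = true

final : ∀ {n} → ℕ → Word n → Word n → ℕ
final q []      []      = q
final q (a ∷ A) (b ∷ B) = final (next q a b) A B

departures : ∀ {n} → ℕ → Word n → Word n → Word n
departures q []      []      = []
departures q (a ∷ A) (b ∷ B) = departs q a b ∷ departures (next q a b) A B

-- The final length is the maximum of `final 0 A B` and q + |A| - |B| (Lindley's formula), so it is
-- 0 exactly if neither is positive. The two directions are mutually recursive because an unserved
-- arrival at the first site changes the initial length.
final-0⇐ : ∀ {n} q (A B : Word n) → final 0 A B ≡ 0 → q ℕ.+ count A ≤ count B → final q A B ≡ 0
final-0⇒ : ∀ {n} q (A B : Word n) → final q A B ≡ 0 → final 0 A B ≡ 0 × q ℕ.+ count A ≤ count B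
final-0⇒ q       []          []          refl = refl , z≤n
final-0⇒ q       (false ∷ A) (false ∷ B) e    = final-0⇒ q A B e
final-0⇒ q       (true ∷ A)  (false ∷ B) e    with final-0⇒ (suc q) A B e
... | e₀ , le = final-0⇐ 1 A B e₀ (ℕₚ.≤-trans (s≤s (ℕₚ.m≤n+m (count A) q)) le) , subst (_≤ count B) (sym (ℕₚ.+-suc q (count A))) le
final-0⇒ q       (true ∷ A)  (true ∷ B)  e    with final-0⇒ q A B e
... | e₀ , le = e₀ , subst (_≤ suc (count B)) (sym (ℕₚ.+-suc q (count A))) (s≤s le)
final-0⇒ zero    (false ∷ A) (true ∷ B)  e    = e , ℕₚ.m≤n⇒m≤1+n (proj₂ (final-0⇒ 0 A B e))
final-0⇒ (suc q) (false ∷ A) (true ∷ B)  e    with final-0⇒ q A B e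
... | e₀ , le = e₀ , s≤s le

final-0⇐ zero    A           B           e le = e
final-0⇐ (suc q) []          []          e ()
final-0⇐ (suc q) (false ∷ A) (false ∷ B) e le = final-0⇐ (suc q) A B e le
final-0⇐ (suc q) (true ∷ A)  (false ∷ B) e le =
  final-0⇐ (suc (suc q)) A B (proj₁ (final-0⇒ 1 A B e)) (subst (_≤ count B) (ℕₚ.+-suc (suc q) (count A)) le)
final-0⇐ (suc q) (true ∷ A)  (true ∷ B)  e le =
  final-0⇐ (suc q) A B e (ℕ.s≤s⁻¹ (subst (_≤ suc (count B)) (ℕₚ.+-suc (suc q) (count A)) le))
final-0⇐ (suc q) (false ∷ A) (true ∷ B)  e le = final-0⇐ q A B e (ℕ.s≤s⁻¹ le)

-- Counting chains of words

-- The words live on the m sites outside the staircase pattern. A row of size t with `length ts`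
-- rows after it has `suc (length ts)` of its letters inside the pattern, which explains the offset
-- in the size condition.
chains : ∀ {m} → Word m → List ℕ → ℚ
chains         B []       = 1ℚ
chains {m = m} B (t ∷ ts) =
  ∑ (words m) (λ A → 𝟙 (suc (length ts) ℕ.+ count A ℕ.≟ t) * 𝟙 (final 0 A B ℕ.≟ 0) * chains A ts)

private
  final-0-∷ : ∀ {m} a b (A B : Word m) → final 0 (a ∷ A) (b ∷ B) ≡ 0 →
              final 0 A B ≡ 0 × count (a ∷ A) ≤ count (b ∷ B)
  final-0-∷ a b A B e = proj₁ (final-0⇒ (next 0 a b) A B e) , proj₂ (final-0⇒ 0 (a ∷ A) (b ∷ B) e)

  final-0-∷⁻ : ∀ {m} a b (A B : Word m) → final 0 A B ≡ 0 → count (a ∷ A) ≤ count (b ∷ B) →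
               final 0 (a ∷ A) (b ∷ B) ≡ 0
  final-0-∷⁻ false false A B e le = e
  final-0-∷⁻ true  false A B e le = final-0⇐ 1 A B e le
  final-0-∷⁻ true  true  A B e le = e
  final-0-∷⁻ false true  A B e le = e

-- The chain condition at the first site only involves the sizes of the words.
chains-∷ : ∀ {m} b (B : Word m) t ts → suc (length ts) ℕ.+ count (b ∷ B) ≡ t →
  chains (b ∷ B) ts ≡ 𝟙 (strictlyDescending? (t ∷ ts)) * shiftSum 1ℚ (chains B) ts
chains-∷         b B t []       eq = sym (cong (_* 1ℚ) (𝟙-yes (strictlyDescending? (t ∷ [])) [-]))
chains-∷ {m = m} b B t (u ∷ ts) eq = begin
  ∑ (words (suc m)) (λ A → 𝟙 (L ℕ.+ count A ℕ.≟ u) * 𝟙 (final 0 A (b ∷ B) ℕ.≟ 0) * chains A ts)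
    ≡⟨ ∑-words m _ ⟩
  ∑ (words m) (G false) + ∑ (words m) (G true)
    ≡⟨ cong₂ _+_ (trans (∑-cong (words m) (G≡ false)) (∑-scale S (G′ false) (words m)))
                 (trans (∑-cong (words m) (G≡ true)) (∑-scale S (G′ true) (words m))) ⟩
  S * ∑ (words m) (G′ false) + S * ∑ (words m) (G′ true)
    ≡⟨ sym (ℚₚ.*-distribˡ-+ S (∑ (words m) (G′ false)) (∑ (words m) (G′ true))) ⟩
  S * (∑ (words m) (G′ false) + ∑ (words m) (G′ true))
    ≡⟨ cong (S *_) (collect u) ⟩
  S * shiftSum 1ℚ (chains B) (u ∷ ts) ∎
  where
  L = suc (length ts)
  S = 𝟙 (strictlyDescending? (t ∷ u ∷ ts))
  G G′ : Bool → Word m → ℚ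
  G  a A = 𝟙 (L ℕ.+ count (a ∷ A) ℕ.≟ u) * 𝟙 (final 0 (a ∷ A) (b ∷ B) ℕ.≟ 0) * chains (a ∷ A) ts
  G′ a A = 𝟙 (L ℕ.+ count (a ∷ A) ℕ.≟ u) * (𝟙 (final 0 A B ℕ.≟ 0) * shiftSum 1ℚ (chains A) ts)

  G≡ : ∀ a A → G a A ≡ S * G′ a A
  G≡ a A with L ℕ.+ count (a ∷ A) ℕ.≟ u
  ... | no _    = lem (𝟙 (final 0 (a ∷ A) (b ∷ B) ℕ.≟ 0)) (chains (a ∷ A) ts) S (𝟙 (final 0 A B ℕ.≟ 0) * shiftSum 1ℚ (chains A) ts)
    where lem : ∀ x y z w → 0ℚ * x * y ≡ z * (0ℚ * w)
          lem = solve-∀ ℚ-ring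
  ... | yes eq′ = begin
    1ℚ * 𝟙 F * chains (a ∷ A) ts
      ≡⟨ cong (1ℚ * 𝟙 F *_) (chains-∷ a A u ts eq′) ⟩
    1ℚ * 𝟙 F * (𝟙 D * X)
      ≡⟨ lem₁ (𝟙 F) (𝟙 D) X ⟩
    𝟙 F * 𝟙 D * X
      ≡⟨ cong (_* X) (trans (sym (𝟙-× F D)) (trans (𝟙-cong (F ×-dec D) (strictlyDescending? (t ∷ u ∷ ts) ×-dec F′) to fro)
                       (𝟙-× (strictlyDescending? (t ∷ u ∷ ts)) F′))) ⟩
    S * 𝟙 F′ * X
      ≡⟨ lem₂ S (𝟙 F′) X ⟩
    S * (1ℚ * (𝟙 F′ * X)) ∎
    where
    X = shiftSum 1ℚ (chains A) ts
    D = strictlyDescending? (u ∷ ts)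
    F = final 0 (a ∷ A) (b ∷ B) ℕ.≟ 0
    F′ = final 0 A B ℕ.≟ 0
    lem₁ : ∀ f d x → 1ℚ * f * (d * x) ≡ f * d * x
    lem₁ = solve-∀ ℚ-ring
    lem₂ : ∀ s f x → s * f * x ≡ s * (1ℚ * (f * x))
    lem₂ = solve-∀ ℚ-ring
    -- Here u = L + |a ∷ A| and t = L + 1 + |b ∷ B|, so the size condition |a ∷ A| ≤ |b ∷ B| is
    -- exactly u < t, the one inequality that `t` adds.
    to : final 0 (a ∷ A) (b ∷ B) ≡ 0 × StrictlyDescending (u ∷ ts) →
         StrictlyDescending (t ∷ u ∷ ts) × final 0 A B ≡ 0
    to (f , d) with final-0-∷ a b A B f
    ... | f′ , le = (u<t ∷ d) , f′
      where u<t : u < t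
            u<t = ℕ-subst₂ (s≤s (ℕₚ.+-monoʳ-≤ L le))
              where ℕ-subst₂ : L ℕ.+ count (a ∷ A) < suc L ℕ.+ count (b ∷ B) → u < t
                    ℕ-subst₂ rewrite eq′ | eq = id
    fro : StrictlyDescending (t ∷ u ∷ ts) × final 0 A B ≡ 0 →
          final 0 (a ∷ A) (b ∷ B) ≡ 0 × StrictlyDescending (u ∷ ts)
    fro (u<t ∷ d , f) = final-0-∷⁻ a b A B f (ℕₚ.+-cancelˡ-≤ L _ _ (ℕ.s≤s⁻¹ (back u<t))) , d
      where back : u < t → L ℕ.+ count (a ∷ A) < suc L ℕ.+ count (b ∷ B)
            back rewrite eq′ | eq = id

  H : ℕ → ℚ
  H l = shiftSum 1ℚ (λ ls → chains B (l ∷ ls)) ts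

  H≡ : ∀ l → ∑ (words m) (λ A → 𝟙 (L ℕ.+ count A ℕ.≟ l) * (𝟙 (final 0 A B ℕ.≟ 0) * shiftSum 1ℚ (chains A) ts)) ≡ H l
  H≡ l = sym (begin
    shiftSum 1ℚ (λ ls → chains B (l ∷ ls)) ts
      ≡⟨ shiftSum-cong 1ℚ ts (λ ls p → ∑-cong (words m) (λ A → trans
           (cong (λ k → 𝟙 (suc k ℕ.+ count A ℕ.≟ l) * 𝟙 (final 0 A B ℕ.≟ 0) * chains A ls) (Pointwise-length p))
           (ℚₚ.*-assoc (𝟙 (L ℕ.+ count A ℕ.≟ l)) (𝟙 (final 0 A B ℕ.≟ 0)) (chains A ls)))) ⟩
    shiftSum 1ℚ (λ ls → ∑ (words m) (λ A → 𝟙 (L ℕ.+ count A ℕ.≟ l) * (𝟙 (final 0 A B ℕ.≟ 0) * chains A ls))) ts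
      ≡⟨ shiftSum-∑ 1ℚ (words m) (λ A ls → 𝟙 (L ℕ.+ count A ℕ.≟ l) * (𝟙 (final 0 A B ℕ.≟ 0) * chains A ls)) ts ⟩
    ∑ (words m) (λ A → shiftSum 1ℚ (λ ls → 𝟙 (L ℕ.+ count A ℕ.≟ l) * (𝟙 (final 0 A B ℕ.≟ 0) * chains A ls)) ts)
      ≡⟨ ∑-cong (words m) (λ A → trans
           (shiftSum-scale 1ℚ (𝟙 (L ℕ.+ count A ℕ.≟ l)) (λ ls → 𝟙 (final 0 A B ℕ.≟ 0) * chains A ls) ts)
           (cong (𝟙 (L ℕ.+ count A ℕ.≟ l) *_) (shiftSum-scale 1ℚ (𝟙 (final 0 A B ℕ.≟ 0)) (chains A) ts))) ⟩
    ∑ (words m) (λ A → 𝟙 (L ℕ.+ count A ℕ.≟ l) * (𝟙 (final 0 A B ℕ.≟ 0) * shiftSum 1ℚ (chains A) ts)) ∎)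

  raised : ∀ l A → 𝟙 (L ℕ.+ suc (count A) ℕ.≟ suc l) ≡ 𝟙 (L ℕ.+ count A ℕ.≟ l)
  raised l A = 𝟙-cong (L ℕ.+ suc (count A) ℕ.≟ suc l) (L ℕ.+ count A ℕ.≟ l)
    (λ e → ℕₚ.suc-injective (trans (sym (ℕₚ.+-suc L (count A))) e))
    (λ e → trans (ℕₚ.+-suc L (count A)) (cong suc e))

  -- The two values of the first letter give the two terms of `shiftSum` at u: a letter `true`
  -- leaves one less for the rest of the word. At u = 0 it is impossible, just as 0 is not lowered.
  collect : ∀ u → ∑ (words m) (λ A → 𝟙 (L ℕ.+ count A ℕ.≟ u) * (𝟙 (final 0 A B ℕ.≟ 0) * shiftSum 1ℚ (chains A) ts))
                + ∑ (words m) (λ A → 𝟙 (L ℕ.+ suc (count A) ℕ.≟ u) * (𝟙 (final 0 A B ℕ.≟ 0) * shiftSum 1ℚ (chains A) ts))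
                ≡ shiftSum 1ℚ (chains B) (u ∷ ts)
  collect zero    = trans (cong₂ _+_ (H≡ zero)
    (trans (∑-cong (words m) (λ A → ℚₚ.*-zeroˡ (𝟙 (final 0 A B ℕ.≟ 0) * shiftSum 1ℚ (chains A) ts))) (∑-zero (words m)))) (ℚₚ.+-identityʳ (H zero))
  collect (suc u) = cong₂ _+_ (H≡ (suc u))
    (trans (∑-cong (words m) (λ A → cong (_* (𝟙 (final 0 A B ℕ.≟ 0) * shiftSum 1ℚ (chains A) ts)) (raised u A)))
           (trans (H≡ u) (sym (ℚₚ.*-identityˡ (H u)))))

chains-[] : ∀ ts → chains [] ts ≡ 𝟙 (Listₚ.≡-dec ℕ._≟_ ts (down 0 (length ts)))
chains-[] []       = refl
chains-[] (t ∷ ts) = begin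
  𝟙 T * 1ℚ * chains [] ts + 0ℚ
    ≡⟨ trans (lem (𝟙 T) (chains [] ts)) (cong (𝟙 T *_) (chains-[] ts)) ⟩
  𝟙 T * 𝟙 (Listₚ.≡-dec ℕ._≟_ ts (down 0 (length ts)))
    ≡⟨ sym (𝟙-× T (Listₚ.≡-dec ℕ._≟_ ts (down 0 (length ts)))) ⟩
  𝟙 (T ×-dec Listₚ.≡-dec ℕ._≟_ ts (down 0 (length ts)))
    ≡⟨ 𝟙-cong (T ×-dec Listₚ.≡-dec ℕ._≟_ ts (down 0 (length ts))) (Listₚ.≡-dec ℕ._≟_ (t ∷ ts) (down 0 (length (t ∷ ts))))
         (λ (e , es) → cong₂ _∷_ (trans (sym e) (ℕₚ.+-identityʳ _)) es)
         (λ es → trans (ℕₚ.+-identityʳ _) (sym (Listₚ.∷-injectiveˡ es)) , Listₚ.∷-injectiveʳ es) ⟩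
  𝟙 (Listₚ.≡-dec ℕ._≟_ (t ∷ ts) (down 0 (length (t ∷ ts)))) ∎
  where
  T = suc (length ts) ℕ.+ 0 ℕ.≟ t
  lem : ∀ a b → a * 1ℚ * b + 0ℚ ≡ a * b
  lem = solve-∀ ℚ-ring

lowered-≤ : ∀ {x y} → Lowered x y → x ≤ y
lowered-≤ same  = ℕₚ.≤-refl
lowered-≤ lower = ℕₚ.n≤1+n _

lowered-≥ : ∀ {x y} → Lowered x y → y ≤ suc x
lowered-≥ same  = ℕₚ.n≤1+n _
lowered-≥ lower = ℕₚ.≤-refl

lowered-descending : ∀ {ls ds} → StrictlyDescending ds → Pointwise Lowered ls ds → Descending ls
lowered-descending s         []           = []
lowered-descending s         (p ∷ [])     = [-]
lowered-descending (y<x ∷ s) (p ∷ p′ ∷ ps) =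
  ℕₚ.≤-trans (lowered-≤ p′) (ℕ.s≤s⁻¹ (ℕₚ.≤-trans y<x (lowered-≥ p))) ∷ lowered-descending s (p′ ∷ ps)

count-true : ∀ m → count (Vec.replicate m true) ≡ m
count-true zero    = refl
count-true (suc m) = cong suc (count-true m)

-- Induction on m, the services being all present. Removing a site (`chains-∷`) and Pascal's rule
-- (`pathDet-suc`) give the same recursion `shiftSum 1ℚ`; for m = 0 both sides are the indicator of
-- the list k, ..., 1. The list is only weakly descending because the recursion lowers entries;
-- where the indicator of `chains-∷` fails, the determinant has equal rows or a zero row.
chains-pathDet : ∀ m ts → Descending ts → chains (Vec.replicate m true) ts ≡ pathDet (length ts) m ts
chains-pathDet zero ts d = trans (chains-[] ts) (base (Listₚ.≡-dec ℕ._≟_ ts (down 0 (length ts))) (strictlyDescending? ts)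
                                                      (All.all? (ℕ._≤? length ts) ts))
  where
  base : (e : Dec (ts ≡ down 0 (length ts))) → Dec (StrictlyDescending ts) → Dec (All (_≤ length ts) ts) →
         𝟙 e ≡ pathDet (length ts) 0 ts
  base (yes e) _       _      = sym (trans (cong (pathDet (length ts) 0) e) (pathDet-down (length ts)))
  base (no ¬e) (no ¬s) _      = sym (rowForm-degenerate _ unit d ¬s (from 1 (length ts)))
  base (no ¬e) (yes s) (no ¬small) with find (Allₚ.¬All⇒Any¬ (ℕ._≤? length ts) ts ¬small)
  ... | l , l∈ts , l≰k = sym (pathDet-large (length ts) 0 l∈ts (ℕₚ.≰⇒> l≰k))
  base (no ¬e) (yes s) (yes small) with strictlyDescending-small s small
  ... | inj₁ 0∈ts = sym (pathDet-0∈ (length ts) 0 0∈ts)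
  ... | inj₂ e    = ⊥-elim (¬e e)
chains-pathDet (suc m) []       d = refl
chains-pathDet (suc m) (t ∷ ts) d = trans
  -- The full service word counts as a row of threshold N + 1, where N = k + suc m, so the first
  -- inequality reads t ≤ N. A larger t is handled by `pathDet-large`.
  (chains-∷ true B (suc k ℕ.+ suc m) (t ∷ ts) (cong (suc k ℕ.+_) (count-true (suc m))))
  (case (strictlyDescending? (suc k ℕ.+ suc m ∷ t ∷ ts)) (strictlyDescending? (t ∷ ts)) (t ℕ.<? suc k ℕ.+ suc m))
  where
  k = length (t ∷ ts)
  B = Vec.replicate m true
  S = shiftSum 1ℚ (chains B) (t ∷ ts)
  case : (s : Dec (StrictlyDescending (suc k ℕ.+ suc m ∷ t ∷ ts))) → Dec (StrictlyDescending (t ∷ ts)) →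
         Dec (t < suc k ℕ.+ suc m) → 𝟙 s * shiftSum 1ℚ (chains B) (t ∷ ts) ≡ pathDet k (suc m) (t ∷ ts)
  case (yes (_ ∷ s)) _ _ = begin
    1ℚ * shiftSum 1ℚ (chains B) (t ∷ ts)
      ≡⟨ ℚₚ.*-identityˡ S ⟩
    shiftSum 1ℚ (chains B) (t ∷ ts)
      ≡⟨ shiftSum-cong 1ℚ (t ∷ ts) (λ ls p → trans (chains-pathDet m ls (lowered-descending s p))
                                                   (cong (λ k → pathDet k m ls) (Pointwise-length p))) ⟩
    shiftSum 1ℚ (pathDet k m) (t ∷ ts)
      ≡⟨ sym (pathDet-suc k m (t ∷ ts)) ⟩
    pathDet k (suc m) (t ∷ ts) ∎
  case (no ¬s) (no ¬s′) _        = trans (ℚₚ.*-zeroˡ S) (sym (rowForm-degenerate _ unit d ¬s′ (from 1 k)))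
  case (no ¬s) (yes s′) (yes lt) = ⊥-elim (¬s (lt ∷ s′))
  case (no ¬s) (yes s′) (no ≮)   = trans (ℚₚ.*-zeroˡ S) (sym (pathDet-large k (suc m) {ls = t ∷ ts} (here refl)
    (ℕₚ.≤-trans (s≤s (ℕₚ.≤-reflexive (ℕₚ.+-comm (suc m) k))) (ℕₚ.≮⇒≥ ≮))))

-- Multiline queues

wordsOfSize : ∀ n → ℕ → List (Word n)
wordsOfSize n t = filter (λ w → count w ℕ.≟ t) (words n)

-- The departure process of the stationary queue on the ring: when A has fewer
-- letters than B, final 0 A B is the only queue length that is preserved by
-- one turn around the ring.
queue : ∀ {n} → Word n → Word n → Word n
queue A B = departures (final 0 A B) A B

-- Either every service was used, and customers are conserved, or some service found the queue
-- empty. In that case a shorter queue is empty at that moment too, and from then on the two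
-- coincide.
final-or-emptied : ∀ {n} q (A B : Word n) →
  final q A B ℕ.+ count B ≡ q ℕ.+ count A ⊎ (∀ {q′} → q′ ≤ q → final q′ A B ≡ final q A B)
final-or-emptied q       []          []          = inj₁ refl
final-or-emptied q       (false ∷ A) (false ∷ B) = final-or-emptied q A B
final-or-emptied q       (true ∷ A)  (false ∷ B) with final-or-emptied (suc q) A B
... | inj₁ e = inj₁ (trans e (sym (ℕₚ.+-suc q (count A))))
... | inj₂ h = inj₂ (λ q′≤q → h (s≤s q′≤q))
final-or-emptied q       (true ∷ A)  (true ∷ B)  with final-or-emptied q A B
... | inj₁ e = inj₁ (trans (ℕₚ.+-suc (final q A B) (count B)) (trans (cong suc e) (sym (ℕₚ.+-suc q (count A)))))
... | inj₂ h = inj₂ h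
final-or-emptied zero    (false ∷ A) (true ∷ B)  = inj₂ (λ { z≤n → refl })
final-or-emptied (suc q) (false ∷ A) (true ∷ B)  with final-or-emptied q A B
... | inj₁ e = inj₁ (trans (ℕₚ.+-suc (final q A B) (count B)) (cong suc e))
... | inj₂ h = inj₂ (λ { z≤n → h z≤n ; (s≤s q′≤q) → h q′≤q })

next-mono : ∀ {q q′} a b → q ≤ q′ → next q a b ≤ next q′ a b
next-mono false false le       = le
next-mono true  false le       = s≤s le
next-mono true  true  le       = le
next-mono false true  z≤n      = z≤n
next-mono false true  (s≤s le) = le

final-mono : ∀ {n q q′} (A B : Word n) → q ≤ q′ → final q A B ≤ final q′ A B
final-mono []      []      le = le
final-mono (a ∷ A) (b ∷ B) le = final-mono A B (next-mono a b le)

final-steady : ∀ {n} (A B : Word n) → count A < count B → final (final 0 A B) A B ≡ final 0 A B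
final-steady A B A<B with final-or-emptied (final 0 A B) A B
... | inj₂ h = sym (h z≤n)
... | inj₁ e = ⊥-elim (ℕₚ.<⇒≱ (ℕₚ.+-monoʳ-< (final 0 A B) A<B)
  (ℕₚ.≤-trans (ℕₚ.+-monoˡ-≤ (count B) (final-mono A B z≤n)) (ℕₚ.≤-reflexive e)))

steady-unique : ∀ {n} q (A B : Word n) → count A < count B → final q A B ≡ q → q ≡ final 0 A B
steady-unique q A B A<B fixed with final-or-emptied q A B
... | inj₂ h = sym (trans (h z≤n) fixed)
... | inj₁ e = ⊥-elim (ℕₚ.<⇒≢ A<B (sym (ℕₚ.+-cancelˡ-≡ q _ _ (trans (cong (ℕ._+ count B) (sym fixed)) e))))

count-departures : ∀ {n} q (A B : Word n) → count (departures q A B) ℕ.+ final q A B ≡ q ℕ.+ count A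
count-departures q       []          []          = sym (ℕₚ.+-identityʳ q)
count-departures q       (false ∷ A) (false ∷ B) = count-departures q A B
count-departures q       (true ∷ A)  (false ∷ B) = trans (count-departures (suc q) A B) (sym (ℕₚ.+-suc q (count A)))
count-departures q       (true ∷ A)  (true ∷ B)  = trans (cong suc (count-departures q A B)) (sym (ℕₚ.+-suc q (count A)))
count-departures zero    (false ∷ A) (true ∷ B)  = count-departures 0 A B
count-departures (suc q) (false ∷ A) (true ∷ B)  = cong suc (count-departures q A B)

count-queue : ∀ {n} (A B : Word n) → count A < count B → count (queue A B) ≡ count A
count-queue A B A<B = ℕₚ.+-cancelʳ-≡ (final 0 A B) _ _ (trans
  (trans (cong (count (queue A B) ℕ.+_) (sym (final-steady A B A<B))) (count-departures (final 0 A B) A B))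
  (ℕₚ.+-comm (final 0 A B) (count A)))

-- A list with multiplicities: one entry for each choice of service words of the sizes `ts`, so that
-- uniform independent choices become a plain sum. The word with index i has passed through all the
-- queues above it.
mlqs : ∀ n → List ℕ → List (List (Word n))
mlqs n []       = [] ∷ []
mlqs n (t ∷ ts) =
  concatMap (λ B → map (λ S → B ∷ map (λ A → queue A B) S) (mlqs n ts)) (wordsOfSize n t)

∑-mlqs : ∀ n t ts φ → ∑ (mlqs n (t ∷ ts)) φ ≡
  ∑ (words n) (λ B → 𝟙 (count B ℕ.≟ t) * ∑ (mlqs n ts) (λ S → φ (B ∷ map (λ A → queue A B) S)))
∑-mlqs n t ts φ = begin
  ∑ (mlqs n (t ∷ ts)) φ
    ≡⟨ ∑-concatMap _ φ (wordsOfSize n t) ⟩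
  ∑ (wordsOfSize n t) (λ B → ∑ (map (λ S → B ∷ map (λ A → queue A B) S) (mlqs n ts)) φ)
    ≡⟨ ∑-filter (λ w → count w ℕ.≟ t) _ (words n) ⟩
  ∑ (words n) (λ B → 𝟙 (count B ℕ.≟ t) * ∑ (map (λ S → B ∷ map (λ A → queue A B) S) (mlqs n ts)) φ)
    ≡⟨ ∑-cong (words n) (λ B → cong (𝟙 (count B ℕ.≟ t) *_) (∑-map (λ S → B ∷ map (λ A → queue A B) S) φ (mlqs n ts))) ⟩
  ∑ (words n) (λ B → 𝟙 (count B ℕ.≟ t) * ∑ (mlqs n ts) (λ S → φ (B ∷ map (λ A → queue A B) S))) ∎

Sizes : ∀ {n} → List (Word n) → List ℕ → Set
Sizes = Pointwise (λ w t → count w ≡ t)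

mlqs-sizes : ∀ n ts → StrictlyDescending ts → All (λ S → Sizes S ts) (mlqs n ts)
mlqs-sizes n []       s = [] ∷ []
mlqs-sizes n (t ∷ ts) s = Allₚ.concat⁺ (Allₚ.map⁺ (All.map rows (Allₚ.all-filter (λ w → count w ℕ.≟ t) (words n))))
  where
  queues : ∀ B {S ts} → StrictlyDescending (t ∷ ts) → count B ≡ t → Sizes S ts → Sizes (map (λ A → queue A B) S) ts
  queues B s             B≡ []       = []
  queues B {A ∷ _} (u<t ∷ [-])     refl (refl ∷ []) = count-queue A B u<t ∷ []
  queues B {A ∷ _} (u<t ∷ v<u ∷ s) refl (refl ∷ p)  = count-queue A B u<t ∷ queues B (ℕₚ.<-trans v<u u<t ∷ s) refl p
  rows : ∀ {B} → count B ≡ t →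
         All (λ S → Sizes S (t ∷ ts)) (map (λ S → B ∷ map (λ A → queue A B) S) (mlqs n ts))
  rows {B} B≡ = Allₚ.map⁺ (All.map (λ p → B≡ ∷ queues B s B≡ p) (mlqs-sizes n ts (Linked.tail s)))

∑-size : ∀ n t → ∑ (words n) (λ w → 𝟙 (count w ℕ.≟ t)) ≡ fromℕ (n C t)
∑-size zero    zero    = refl
∑-size zero    (suc t) = cong fromℕ (sym (k>n⇒nCk≡0 {0} {suc t} (s≤s z≤n)))
∑-size (suc n) t       = trans (∑-words n _) (pascal t)
  where
  pascal : ∀ t → ∑ (words n) (λ w → 𝟙 (count w ℕ.≟ t)) + ∑ (words n) (λ w → 𝟙 (suc (count w) ℕ.≟ t)) ≡ fromℕ (suc n C t)
  pascal zero    = trans (cong₂ _+_ (∑-size n zero) (∑-zero (words n))) (ℚₚ.+-identityʳ (fromℕ (n C zero)))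
  pascal (suc t) = begin
    ∑ (words n) (λ w → 𝟙 (count w ℕ.≟ suc t)) + ∑ (words n) (λ w → 𝟙 (suc (count w) ℕ.≟ suc t))
      ≡⟨ cong₂ _+_ (∑-size n (suc t))
           (trans (∑-cong (words n) (λ w → 𝟙-cong (suc (count w) ℕ.≟ suc t) (count w ℕ.≟ t) ℕₚ.suc-injective (cong suc)))
                  (∑-size n t)) ⟩
    fromℕ (n C suc t) + fromℕ (n C t)
      ≡⟨ ℚₚ.+-comm (fromℕ (n C suc t)) (fromℕ (n C t)) ⟩
    fromℕ (n C t) + fromℕ (n C suc t)
      ≡⟨ sym (fromℕ-+ (n C t) (n C suc t)) ⟩
    fromℕ ((n C t) ℕ.+ (n C suc t))
      ≡⟨ cong fromℕ (nCk+nC[k+1]≡[n+1]C[k+1] n t) ⟩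
    fromℕ (suc n C suc t) ∎

∑-mlqs-1 : ∀ n ts → ∑ (mlqs n ts) (λ _ → 1ℚ) ≡ ∏ ts (λ t → fromℕ (n C t))
∑-mlqs-1 n []       = refl
∑-mlqs-1 n (t ∷ ts) = begin
  ∑ (mlqs n (t ∷ ts)) (λ _ → 1ℚ)
    ≡⟨ ∑-mlqs n t ts (λ _ → 1ℚ) ⟩
  ∑ (words n) (λ B → 𝟙 (count B ℕ.≟ t) * T)
    ≡⟨ ∑-cong (words n) (λ B → ℚₚ.*-comm (𝟙 (count B ℕ.≟ t)) T) ⟩
  ∑ (words n) (λ B → T * 𝟙 (count B ℕ.≟ t))
    ≡⟨ ∑-scale T (λ B → 𝟙 (count B ℕ.≟ t)) (words n) ⟩
  T * ∑ (words n) (λ B → 𝟙 (count B ℕ.≟ t))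
    ≡⟨ trans (ℚₚ.*-comm T _) (cong₂ _*_ (∑-size n t) (∑-mlqs-1 n ts)) ⟩
  fromℕ (n C t) * ∏ ts (λ t → fromℕ (n C t)) ∎
  where T = ∑ (mlqs n ts) (λ _ → 1ℚ)

-- The staircase pattern

step-word : ∀ k → ℕ → Word k
step-word zero    z       = []
step-word (suc k) zero    = true ∷ step-word k zero
step-word (suc k) (suc z) = false ∷ step-word k z

_≟ʷ_ : ∀ {n} (v w : Word n) → Dec (v ≡ w)
_≟ʷ_ = Vecₚ.≡-dec Bool._≟_

module _ {m : ℕ} where

  -- Row z, counted from 0, reads 0...01...1 with z zeros on the first k sites: the labels exceed
  -- the threshold at the first z sites and nowhere else among these k. On the other m sites the row
  -- must be servable by `r` from an empty queue. `r` is a parameter of the induction: it starts as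
  -- the full word and becomes the end of the row just removed.
  staircase : ∀ k → ℕ → Word m → List (Word (k ℕ.+ m)) → ℚ
  staircase k z r []      = 1ℚ
  staircase k z r (w ∷ S) =
    𝟙 (Vec.take k w ≟ʷ step-word k z ×-dec final 0 (Vec.drop k w) r ℕ.≟ 0) * staircase k (suc z) r S

  departures-all-served : ∀ k (A B : Word (k ℕ.+ m)) → Vec.take k B ≡ step-word k 0 →
    Vec.take k (departures 0 A B) ≡ Vec.take k A
  departures-all-served zero    A           B           e = refl
  departures-all-served (suc k) (false ∷ A) (true ∷ B)  e = cong (false ∷_) (departures-all-served k A B (Vecₚ.∷-injectiveʳ e))
  departures-all-served (suc k) (true ∷ A)  (true ∷ B)  e = cong (true ∷_) (departures-all-served k A B (Vecₚ.∷-injectiveʳ e))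
  departures-all-served (suc k) A           (false ∷ B) ()

  -- Site z has the first service, yet by z < y nothing departs there. So the queue is empty and has
  -- no arrival at z, and as nothing could leave earlier, it was empty at the start and had no
  -- arrival before z. From z on every arrival is served at once.
  departures-step⇒ : ∀ k {z y} q (A B : Word (k ℕ.+ m)) → z < k → z < y →
    Vec.take k B ≡ step-word k z → Vec.take k (departures q A B) ≡ step-word k y →
    q ≡ 0 × Vec.take k A ≡ step-word k y
  departures-step⇒ (suc k) {zero}  {suc y} q       (true ∷ A)  (true ∷ B)  z<k z<y e ()
  departures-step⇒ (suc k) {zero}  {suc y} zero    (false ∷ A) (true ∷ B)  z<k z<y e e′ =
    refl , cong (false ∷_) (trans (sym (departures-all-served k A B (Vecₚ.∷-injectiveʳ e))) (Vecₚ.∷-injectiveʳ e′))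
  departures-step⇒ (suc k) {zero}  {suc y} (suc q) (false ∷ A) (true ∷ B)  z<k z<y e ()
  departures-step⇒ (suc k) {zero}  {suc y} q       (a ∷ A)     (false ∷ B) z<k z<y () e′
  departures-step⇒ (suc k) {suc z} {suc y} q       (a ∷ A)     (true ∷ B)  z<k z<y () e′
  departures-step⇒ (suc k) {suc z} {suc y} q       (false ∷ A) (false ∷ B) (s≤s z<k) (s≤s z<y) e e′
    with departures-step⇒ k q A B z<k z<y (Vecₚ.∷-injectiveʳ e) (Vecₚ.∷-injectiveʳ e′)
  ... | q≡0 , e″ = q≡0 , cong (false ∷_) e″
  departures-step⇒ (suc k) {suc z} {suc y} q       (true ∷ A)  (false ∷ B) (s≤s z<k) (s≤s z<y) e e′
    with departures-step⇒ k (suc q) A B z<k z<y (Vecₚ.∷-injectiveʳ e) (Vecₚ.∷-injectiveʳ e′)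
  ... | () , _

  departures-step⇐ : ∀ k {z y} (A B : Word (k ℕ.+ m)) → z ≤ y →
    Vec.take k B ≡ step-word k z → Vec.take k A ≡ step-word k y → Vec.take k (departures 0 A B) ≡ step-word k y
  departures-step⇐ zero    A B z≤y e e′ = refl
  departures-step⇐ (suc k) {zero} A B z≤y e e′ = trans (departures-all-served (suc k) A B e) e′
  departures-step⇐ (suc k) {suc z} {suc y} (false ∷ A) (false ∷ B) (s≤s z≤y) e e′ =
    cong (false ∷_) (departures-step⇐ k A B z≤y (Vecₚ.∷-injectiveʳ e) (Vecₚ.∷-injectiveʳ e′))
  departures-step⇐ (suc k) {suc z} {suc y} (true ∷ A)  (false ∷ B) z≤y e ()
  departures-step⇐ (suc k) {suc z} {suc y} A           (true ∷ B)  z≤y () e′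

  final-drop : ∀ k {z y} (A B : Word (k ℕ.+ m)) → z ≤ y →
    Vec.take k B ≡ step-word k z → Vec.take k A ≡ step-word k y →
    final 0 A B ≡ final 0 (Vec.drop k A) (Vec.drop k B)
  final-drop zero    A           B           z≤y e e′ = refl
  final-drop (suc k) {zero}  {zero}  (true ∷ A)  (true ∷ B)  z≤y e e′ = final-drop k A B z≤n (Vecₚ.∷-injectiveʳ e) (Vecₚ.∷-injectiveʳ e′)
  final-drop (suc k) {zero}  {suc y} (false ∷ A) (true ∷ B)  z≤y e e′ = final-drop k A B z≤n (Vecₚ.∷-injectiveʳ e) (Vecₚ.∷-injectiveʳ e′)
  final-drop (suc k) {suc z} {suc y} (false ∷ A) (false ∷ B) (s≤s z≤y) e e′ = final-drop k A B z≤y (Vecₚ.∷-injectiveʳ e) (Vecₚ.∷-injectiveʳ e′)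
  final-drop (suc k) {zero}  {y}     A           (false ∷ B) z≤y () e′
  final-drop (suc k) {zero}  {zero}  (false ∷ A) B           z≤y e ()
  final-drop (suc k) {zero}  {suc y} (true ∷ A)  B           z≤y e ()
  final-drop (suc k) {suc z} {y}     A           (true ∷ B)  z≤y () e′
  final-drop (suc k) {suc z} {suc y} (true ∷ A)  B           z≤y e ()

  -- Departures occur only at services of `B`, so as arrivals at `r` they are dominated by `B`.
  final-departures-≤ : ∀ {n p p′} q (A B r : Word n) → p ≤ p′ → final p (departures q A B) r ≤ final p′ B r
  final-departures-≤ q []      []      []      le = le
  final-departures-≤ q (a ∷ A) (b ∷ B) (c ∷ r) le = final-departures-≤ (next q a b) A B r (served q a b c le)
    where
    served : ∀ {p p′} q a b c → p ≤ p′ → next p (departs q a b) c ≤ next p′ b c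
    served q       a     false c     le       = next-mono false c le
    served q       true  true  c     le       = next-mono true c le
    served (suc q) false true  c     le       = next-mono true c le
    served zero    false true  false le       = ℕₚ.m≤n⇒m≤1+n le
    served zero    false true  true  z≤n      = z≤n
    served zero    false true  true  (s≤s le) = ℕₚ.m≤n⇒m≤1+n le

  final-drop-departures-≤ : ∀ k q (A B : Word (k ℕ.+ m)) r →
    final 0 (Vec.drop k (departures q A B)) r ≤ final 0 (Vec.drop k B) r
  final-drop-departures-≤ zero    q A       B       r = final-departures-≤ q A B r z≤n
  final-drop-departures-≤ (suc k) q (a ∷ A) (b ∷ B) r = final-drop-departures-≤ k (next q a b) A B r

  -- The prefix of a departure word forces an empty queue and the same prefix for its arrival word.
  -- An empty queue at the start means that the end of `B` serves the end of `A`; conversely, once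
  -- this holds, `r` serves the departures because it serves `B`.
  staircase-queue : ∀ k {z y} (B : Word (k ℕ.+ m)) r → z < k → z < y →
    Vec.take k B ≡ step-word k z → final 0 (Vec.drop k B) r ≡ 0 →
    ∀ S → staircase k y r (map (λ A → queue A B) S) ≡ staircase k y (Vec.drop k B) S
  staircase-queue k             B r z<k z<y e f []      = refl
  staircase-queue k {z} {y = y} B r z<k z<y e f (A ∷ S) = cong₂ _*_
    (𝟙-cong (Vec.take k (queue A B) ≟ʷ step-word k y ×-dec final 0 (Vec.drop k (queue A B)) r ℕ.≟ 0)
            (Vec.take k A ≟ʷ step-word k y ×-dec final 0 (Vec.drop k A) (Vec.drop k B) ℕ.≟ 0) to fro)
    (staircase-queue k B r z<k (ℕₚ.m≤n⇒m≤1+n z<y) e f S)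
    where
    to : Vec.take k (queue A B) ≡ step-word k y × final 0 (Vec.drop k (queue A B)) r ≡ 0 →
         Vec.take k A ≡ step-word k y × final 0 (Vec.drop k A) (Vec.drop k B) ≡ 0
    to (e′ , _) with departures-step⇒ k (final 0 A B) A B z<k z<y e e′
    ... | q≡0 , e″ = e″ , trans (sym (final-drop k A B (ℕₚ.<⇒≤ z<y) e e″)) q≡0
    fro : Vec.take k A ≡ step-word k y × final 0 (Vec.drop k A) (Vec.drop k B) ≡ 0 →
          Vec.take k (queue A B) ≡ step-word k y × final 0 (Vec.drop k (queue A B)) r ≡ 0
    fro (e′ , f′) =
      trans (cong (λ q → Vec.take k (departures q A B)) (trans (final-drop k A B (ℕₚ.<⇒≤ z<y) e e′) f′))
            (departures-step⇐ k A B (ℕₚ.<⇒≤ z<y) e e′) ,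
      ℕₚ.n≤0⇒n≡0 (ℕₚ.≤-trans (final-drop-departures-≤ k (final 0 A B) A B r) (ℕₚ.≤-reflexive f))

  ∑-words-prefix : ∀ k (p : Word k) (g : Word m → ℚ) →
    ∑ (words (k ℕ.+ m)) (λ w → 𝟙 (Vec.take k w ≟ʷ p) * g (Vec.drop k w)) ≡ ∑ (words m) g
  ∑-words-prefix zero    []      g = ∑-cong (words m) (λ w → ℚₚ.*-identityˡ (g w))
  ∑-words-prefix (suc k) (b ∷ p) g = trans (∑-words (k ℕ.+ m) _) (branch b)
    where
    F : Bool → Bool → ℚ
    F a b = ∑ (words (k ℕ.+ m)) (λ w → 𝟙 ((a ∷ Vec.take k w) ≟ʷ (b ∷ p)) * g (Vec.drop k w))
    good : ∀ b → F b b ≡ ∑ (words m) g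
    good b = trans (∑-cong (words (k ℕ.+ m)) (λ w → cong (_* g (Vec.drop k w))
      (𝟙-cong ((b ∷ Vec.take k w) ≟ʷ (b ∷ p)) (Vec.take k w ≟ʷ p) Vecₚ.∷-injectiveʳ (cong (b ∷_))))) (∑-words-prefix k p g)
    bad : ∀ a b → a ≢ b → F a b ≡ 0ℚ
    bad a b a≢b = trans (∑-cong (words (k ℕ.+ m)) (λ w → trans
      (cong (_* g (Vec.drop k w)) (𝟙-no ((a ∷ Vec.take k w) ≟ʷ (b ∷ p)) (λ e → a≢b (Vecₚ.∷-injectiveˡ e))))
      (ℚₚ.*-zeroˡ (g (Vec.drop k w))))) (∑-zero (words (k ℕ.+ m)))
    branch : ∀ b → F false b + F true b ≡ ∑ (words m) g
    branch false = trans (cong₂ _+_ (good false) (bad true false (λ ()))) (ℚₚ.+-identityʳ (∑ (words m) g))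
    branch true  = trans (cong₂ _+_ (bad false true (λ ())) (good true)) (ℚₚ.+-identityˡ (∑ (words m) g))

  count-take-drop : ∀ k (w : Word (k ℕ.+ m)) → count w ≡ count (Vec.take k w) ℕ.+ count (Vec.drop k w)
  count-take-drop zero    w       = refl
  count-take-drop (suc k) (b ∷ w) =
    trans (cong (bit b ℕ.+_) (count-take-drop k w)) (sym (ℕₚ.+-assoc (bit b) (count (Vec.take k w)) _))

  count-step-word : ∀ k z l → z ℕ.+ l ≡ k → count (step-word k z) ≡ l
  count-step-word zero    z       l       e = sym (ℕₚ.m+n≡0⇒n≡0 z e)
  count-step-word (suc k) zero    (suc l) e = cong suc (count-step-word k zero l (ℕₚ.suc-injective e))
  count-step-word (suc k) (suc z) l       e = count-step-word k z l (ℕₚ.suc-injective e)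

  -- The prefix of the first row B is prescribed, so the sum over B runs over its last m letters,
  -- and these are the services for all the remaining rows. The condition on z says that as many
  -- rows remain as the prefix of the first of them has ones.
  staircase-chains : ∀ k z r ts → z ℕ.+ length ts ≡ k → ∑ (mlqs (k ℕ.+ m) ts) (staircase k z r) ≡ chains r ts
  staircase-chains k z r []       e = refl
  staircase-chains k z r (t ∷ ts) e = begin
    ∑ (mlqs (k ℕ.+ m) (t ∷ ts)) (staircase k z r)
      ≡⟨ ∑-mlqs (k ℕ.+ m) t ts (staircase k z r) ⟩
    ∑ (words (k ℕ.+ m)) (λ B → 𝟙 (count B ℕ.≟ t) *
        ∑ (mlqs (k ℕ.+ m) ts) (λ S → staircase k z r (B ∷ map (λ A → queue A B) S)))
      ≡⟨ ∑-cong (words (k ℕ.+ m)) first-row ⟩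
    ∑ (words (k ℕ.+ m)) (λ B → 𝟙 (Vec.take k B ≟ʷ step-word k z) * g (Vec.drop k B))
      ≡⟨ ∑-words-prefix k (step-word k z) g ⟩
    chains r (t ∷ ts) ∎
    where
    L = suc (length ts)
    g : Word m → ℚ
    g A = 𝟙 (L ℕ.+ count A ℕ.≟ t) * 𝟙 (final 0 A r ℕ.≟ 0) * chains A ts
    z<k : z < k
    z<k = subst (z <_) e (ℕₚ.m<m+n z (s≤s z≤n))
    first-row : ∀ B → 𝟙 (count B ℕ.≟ t) * ∑ (mlqs (k ℕ.+ m) ts) (λ S → staircase k z r (B ∷ map (λ A → queue A B) S))
                    ≡ 𝟙 (Vec.take k B ≟ʷ step-word k z) * g (Vec.drop k B)
    first-row B = begin
      c * ∑ (mlqs (k ℕ.+ m) ts) (λ S → 𝟙 (T ×-dec F) * staircase k (suc z) r (map (λ A → queue A B) S))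
        ≡⟨ cong (c *_) (∑-scale (𝟙 (T ×-dec F)) (λ S → staircase k (suc z) r (map (λ A → queue A B) S)) (mlqs (k ℕ.+ m) ts)) ⟩
      c * (𝟙 (T ×-dec F) * X)
        ≡⟨ cong (λ x → c * (x * X)) (𝟙-× T F) ⟩
      c * (𝟙 T * 𝟙 F * X)
        ≡⟨ decide T F ⟩
      𝟙 T * (𝟙 (L ℕ.+ count (Vec.drop k B) ℕ.≟ t) * 𝟙 F * chains (Vec.drop k B) ts) ∎
      where
      c = 𝟙 (count B ℕ.≟ t)
      T = Vec.take k B ≟ʷ step-word k z
      F = final 0 (Vec.drop k B) r ℕ.≟ 0
      X = ∑ (mlqs (k ℕ.+ m) ts) (λ S → staircase k (suc z) r (map (λ A → queue A B) S))
      c′ = 𝟙 (L ℕ.+ count (Vec.drop k B) ℕ.≟ t)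
      Y = chains (Vec.drop k B) ts
      decide : (T : Dec (Vec.take k B ≡ step-word k z)) (F : Dec (final 0 (Vec.drop k B) r ≡ 0)) →
               c * (𝟙 T * 𝟙 F * X) ≡ 𝟙 T * (c′ * 𝟙 F * Y)
      decide (no _)  F       = lem c (𝟙 F) X (c′ * 𝟙 F * Y)
        where lem : ∀ a b x y → a * (0ℚ * b * x) ≡ 0ℚ * y
              lem = solve-∀ ℚ-ring
      decide (yes _) (no _)  = lem c X c′ Y
        where lem : ∀ a x b y → a * (1ℚ * 0ℚ * x) ≡ 1ℚ * (b * 0ℚ * y)
              lem = solve-∀ ℚ-ring
      decide (yes T) (yes F) = trans (cong₂ (λ a x → a * (1ℚ * 1ℚ * x))
        (cong (λ n → 𝟙 (n ℕ.≟ t)) (trans (count-take-drop k B)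
          (cong (ℕ._+ count (Vec.drop k B)) (trans (cong count T) (count-step-word k z L e)))))
        (trans (∑-cong (mlqs (k ℕ.+ m) ts) (staircase-queue k B r z<k (ℕₚ.n<1+n z) T F))
               (staircase-chains k (suc z) (Vec.drop k B) ts (trans (sym (ℕₚ.+-suc z (length ts))) e))))
        (lem c′ Y)
        where lem : ∀ a x → a * (1ℚ * 1ℚ * x) ≡ 1ℚ * (a * 1ℚ * x)
              lem = solve-∀ ℚ-ring

-- Jumps on the ring

module _ {A : Set} (lo hi : A → A → A) where

  -- `lo` and `hi` are abstract so that one definition moves labels, with minimum and maximum, and
  -- binary words, with `_∨_` and `_∧_`; `true` stands for a small label.
  exchange : ∀ {n} → ℕ → Vec A n → Vec A n
  exchange zero    (x ∷ y ∷ v) = lo x y ∷ hi x y ∷ v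
  exchange (suc i) (x ∷ v)     = x ∷ exchange i v
  exchange _       v           = v

rotate rotate⁻¹ : ∀ {A : Set} {n} → Vec A n → Vec A n
rotate []      = []
rotate (x ∷ v) = v Vec.∷ʳ x
rotate⁻¹ {n = zero}  v = v
rotate⁻¹ {n = suc n} v = Vec.last v ∷ Vec.init v

module _ {A : Set} where

  init∷ʳlast : ∀ {n} (v : Vec A (suc n)) → Vec.init v Vec.∷ʳ Vec.last v ≡ v
  init∷ʳlast (x ∷ [])    = refl
  init∷ʳlast (x ∷ y ∷ v) = cong (x ∷_) (init∷ʳlast (y ∷ v))

  rotate-rotate⁻¹ : ∀ {n} (v : Vec A n) → rotate (rotate⁻¹ v) ≡ v
  rotate-rotate⁻¹ []        = refl
  rotate-rotate⁻¹ v@(_ ∷ _) = init∷ʳlast v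

  rotate⁻¹-rotate : ∀ {n} (v : Vec A n) → rotate⁻¹ (rotate v) ≡ v
  rotate⁻¹-rotate []      = refl
  rotate⁻¹-rotate (x ∷ v) = cong₂ _∷_ (Vecₚ.last-∷ʳ x v) (Vecₚ.init-∷ʳ x v)

-- Index i is the site that jumps, so `suc i` acts on the places i and i + 1. Site 0 jumps to the
-- last site; a rotation makes the two adjacent.
move : ∀ {A : Set} (lo hi : A → A → A) {n} → ℕ → Vec A n → Vec A n
move lo hi zero    v = rotate (exchange lo hi zero (rotate⁻¹ v))
move lo hi (suc i) v = exchange lo hi i v

swap : ∀ {n} → ℕ → Word n → Word n
swap = exchange _∨_ _∧_

jump : ∀ {n} → ℕ → Word n → Word n
jump = move _∨_ _∧_

count-swap : ∀ {n} i (w : Word n) → count (swap i w) ≡ count w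
count-swap zero    []                  = refl
count-swap zero    (x ∷ [])            = refl
count-swap zero    (false ∷ y ∷ w)     = refl
count-swap zero    (true ∷ y ∷ w)      = refl
count-swap (suc i) []                  = refl
count-swap (suc i) (x ∷ w)             = cong (bit x ℕ.+_) (count-swap i w)

count-∷ʳ : ∀ {n} (w : Word n) x → count (w Vec.∷ʳ x) ≡ bit x ℕ.+ count w
count-∷ʳ []      x = refl
count-∷ʳ (y ∷ w) x = begin
  bit y ℕ.+ count (w Vec.∷ʳ x)    ≡⟨ cong (bit y ℕ.+_) (count-∷ʳ w x) ⟩
  bit y ℕ.+ (bit x ℕ.+ count w)   ≡⟨ lem (bit y) (bit x) (count w) ⟩
  bit x ℕ.+ (bit y ℕ.+ count w)   ∎
  where lem : ∀ a b c → a ℕ.+ (b ℕ.+ c) ≡ b ℕ.+ (a ℕ.+ c)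
        lem = ℕ-solve-∀

count-rotate : ∀ {n} (w : Word n) → count (rotate w) ≡ count w
count-rotate []      = refl
count-rotate (x ∷ w) = count-∷ʳ w x

count-rotate⁻¹ : ∀ {n} (w : Word n) → count (rotate⁻¹ w) ≡ count w
count-rotate⁻¹ w = trans (sym (count-rotate (rotate⁻¹ w))) (cong count (rotate-rotate⁻¹ w))

count-jump : ∀ {n} i (w : Word n) → count (jump i w) ≡ count w
count-jump zero    w = trans (count-rotate (swap 0 (rotate⁻¹ w))) (trans (count-swap 0 (rotate⁻¹ w)) (count-rotate⁻¹ w))
count-jump (suc i) w = count-swap i w

-- For the jumping site and its left neighbour: at a `rise` the jump changes the word, a `fall` is
-- what it then leaves, and `flat` covers the rest.
data Kind : Set where
  flat rise fall : Kind

kindAt : ∀ {n} → ℕ → Word n → Kind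
kindAt i       []                  = flat
kindAt zero    (x ∷ [])            = flat
kindAt zero    (false ∷ true  ∷ w) = rise
kindAt zero    (true  ∷ false ∷ w) = fall
kindAt zero    (false ∷ false ∷ w) = flat
kindAt zero    (true  ∷ true  ∷ w) = flat
kindAt (suc i) (x ∷ w)             = kindAt i w

kind : ∀ {n} → ℕ → Word n → Kind
kind zero    w = kindAt zero (rotate⁻¹ w)
kind (suc i) w = kindAt i w

-- How a jump at a given site acts on the departures, according to what the
-- services do at that site.
Compatible : ∀ {n} → (Word n → Word n) → Kind → Word n → Word n → Set
Compatible T flat A B = T (queue A B) ≡ queue (T A) B
Compatible T rise A B = T (queue A B) ≡ queue (T A) (T B) × queue (T A) B ≡ queue A B
Compatible T fall A B = T (queue A B) ≡ queue A B

private
  swap-flat : ∀ {n} i q (A B : Word n) → kindAt i B ≡ flat →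
    swap i (departures q A B) ≡ departures q (swap i A) B × final q (swap i A) B ≡ final q A B
  swap-flat zero    q             []                  []                  e = refl , refl
  swap-flat zero    q             (a ∷ [])            (b ∷ [])            e = refl , refl
  swap-flat zero    q             (false ∷ false ∷ A) (false ∷ false ∷ B) e = refl , refl
  swap-flat zero    q             (false ∷ true ∷ A)  (false ∷ false ∷ B) e = refl , refl
  swap-flat zero    q             (true ∷ a ∷ A)      (false ∷ false ∷ B) e = refl , refl
  swap-flat zero    q             (true ∷ a ∷ A)      (true ∷ true ∷ B)   e = refl , refl
  swap-flat zero    zero          (false ∷ true ∷ A)  (true ∷ true ∷ B)   e = refl , refl
  swap-flat zero    (suc q)       (false ∷ true ∷ A)  (true ∷ true ∷ B)   e = refl , refl
  swap-flat zero    zero          (false ∷ false ∷ A) (true ∷ true ∷ B)   e = refl , refl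
  swap-flat zero    (suc q)       (false ∷ false ∷ A) (true ∷ true ∷ B)   e = refl , refl
  swap-flat zero    q             (a ∷ a′ ∷ A)        (false ∷ true ∷ B)  ()
  swap-flat zero    q             (a ∷ a′ ∷ A)        (true ∷ false ∷ B)  ()
  swap-flat (suc i) q             []                  []                  e = refl , refl
  swap-flat (suc i) q             (a ∷ A)             (b ∷ B)             e with swap-flat i (next q a b) A B e
  ... | d , f = cong (departs q a b ∷_) d , f

  -- The only service of the pair is at its right site, after both arrivals, so the order of these
  -- does not affect the departures. If the service moves left and the arrivals move with it, the
  -- same customer is still in time, and the departure moves left as well.
  swap-rise : ∀ {n} i q (A B : Word n) → kindAt i B ≡ rise →
    (swap i (departures q A B) ≡ departures q (swap i A) (swap i B) × final q (swap i A) (swap i B) ≡ final q A B) ×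
    (departures q (swap i A) B ≡ departures q A B × final q (swap i A) B ≡ final q A B)
  swap-rise zero    zero    (false ∷ false ∷ A) (false ∷ true ∷ B)  e = (refl , refl) , (refl , refl)
  swap-rise zero    (suc q) (false ∷ false ∷ A) (false ∷ true ∷ B)  e = (refl , refl) , (refl , refl)
  swap-rise zero    q       (false ∷ true ∷ A)  (false ∷ true ∷ B)  e = (refl , refl) , (refl , refl)
  swap-rise zero    q       (true ∷ false ∷ A)  (false ∷ true ∷ B)  e = (refl , refl) , (refl , refl)
  swap-rise zero    q       (true ∷ true ∷ A)   (false ∷ true ∷ B)  e = (refl , refl) , (refl , refl)
  swap-rise zero    q       (a ∷ a′ ∷ A)        (false ∷ false ∷ B) ()
  swap-rise zero    q       (a ∷ a′ ∷ A)        (true ∷ false ∷ B)  ()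
  swap-rise zero    q       (a ∷ a′ ∷ A)        (true ∷ true ∷ B)   ()
  swap-rise zero    q       (a ∷ [])            (b ∷ [])            ()
  swap-rise (suc i) q       (a ∷ A)             (b ∷ B)             e with swap-rise i (next q a b) A B e
  ... | (d , f) , (d′ , f′) = (cong (departs q a b ∷_) d , f) , (cong (departs q a b ∷_) d′ , f′)

  -- The right site of the pair has no service, so a departure can occur only at the left one and
  -- has nowhere to move.
  swap-fall : ∀ {n} i q (A B : Word n) → kindAt i B ≡ fall → swap i (departures q A B) ≡ departures q A B
  swap-fall zero    q (a ∷ a′ ∷ A) (true ∷ false ∷ B)  e =
    cong₂ (λ x y → x ∷ y ∷ departures (next (next q a true) a′ false) A B) (Boolₚ.∨-identityʳ (departs q a true)) (Boolₚ.∧-zeroʳ (departs q a true))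
  swap-fall zero    q (a ∷ a′ ∷ A) (false ∷ false ∷ B) ()
  swap-fall zero    q (a ∷ a′ ∷ A) (false ∷ true ∷ B)  ()
  swap-fall zero    q (a ∷ a′ ∷ A) (true ∷ true ∷ B)   ()
  swap-fall zero    q (a ∷ [])     (b ∷ [])            ()
  swap-fall (suc i) q (a ∷ A)      (b ∷ B)             e = cong (departs q a b ∷_) (swap-fall i (next q a b) A B e)

compatible-swap : ∀ {n} i (A B : Word n) → Compatible (swap i) (kindAt i B) A B
compatible-swap i A B with kindAt i B in e
... | flat = trans (proj₁ (swap-flat i (final 0 A B) A B e))
                   (cong (λ q → departures q (swap i A) B) (sym (proj₂ (swap-flat i 0 A B e))))
... | rise = trans (proj₁ (proj₁ (swap-rise i (final 0 A B) A B e)))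
                   (cong (λ q → departures q (swap i A) (swap i B)) (sym (proj₂ (proj₁ (swap-rise i 0 A B e))))) ,
             trans (cong (λ q → departures q (swap i A) B) (proj₂ (proj₂ (swap-rise i 0 A B e))))
                   (proj₁ (proj₂ (swap-rise i (final 0 A B) A B e)))
... | fall = swap-fall i (final 0 A B) A B e

final-∷ʳ : ∀ {n} q (A B : Word n) a b → final q (A Vec.∷ʳ a) (B Vec.∷ʳ b) ≡ next (final q A B) a b
final-∷ʳ q []       []       a b = refl
final-∷ʳ q (a′ ∷ A) (b′ ∷ B) a b = final-∷ʳ (next q a′ b′) A B a b

departures-∷ʳ : ∀ {n} q (A B : Word n) a b →
  departures q (A Vec.∷ʳ a) (B Vec.∷ʳ b) ≡ departures q A B Vec.∷ʳ departs (final q A B) a b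
departures-∷ʳ q []       []       a b = refl
departures-∷ʳ q (a′ ∷ A) (b′ ∷ B) a b = cong (departs q a′ b′ ∷_) (departures-∷ʳ (next q a′ b′) A B a b)

-- Moving the cut of the ring past one site turns the steady length q into `next q a b`. A turn from
-- the new cut preserves it, so by `steady-unique` it is the steady length there.
queue-rotate : ∀ {n} (A B : Word n) → count A < count B → queue (rotate A) (rotate B) ≡ rotate (queue A B)
queue-rotate []      []      A<B = refl
queue-rotate (a ∷ A) (b ∷ B) A<B = begin
  departures (final 0 (A Vec.∷ʳ a) (B Vec.∷ʳ b)) (A Vec.∷ʳ a) (B Vec.∷ʳ b)
    ≡⟨ cong (λ p → departures p (A Vec.∷ʳ a) (B Vec.∷ʳ b)) (sym q′-steady) ⟩
  departures q′ (A Vec.∷ʳ a) (B Vec.∷ʳ b)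
    ≡⟨ departures-∷ʳ q′ A B a b ⟩
  departures q′ A B Vec.∷ʳ departs (final q′ A B) a b
    ≡⟨ cong (λ p → departures q′ A B Vec.∷ʳ departs p a b) steady ⟩
  departures q′ A B Vec.∷ʳ departs q a b ∎
  where
  q  = final 0 (a ∷ A) (b ∷ B)
  q′ = next q a b
  steady : final q′ A B ≡ q
  steady = final-steady (a ∷ A) (b ∷ B) A<B
  q′-steady : q′ ≡ final 0 (A Vec.∷ʳ a) (B Vec.∷ʳ b)
  q′-steady = steady-unique q′ (A Vec.∷ʳ a) (B Vec.∷ʳ b)
    (subst (_< count (B Vec.∷ʳ b)) (sym (count-∷ʳ A a)) (subst (count (a ∷ A) <_) (sym (count-∷ʳ B b)) A<B))
    (trans (final-∷ʳ q′ A B a b) (cong (λ p → next p a b) steady))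

compatible-jump : ∀ {n} i (A B : Word n) → count A < count B → Compatible (jump i) (kind i B) A B
compatible-jump (suc i) A B A<B = compatible-swap i A B
compatible-jump zero    A B A<B = conjugate (kindAt 0 B′) (compatible-swap 0 A′ B′)
  where
  A′ = rotate⁻¹ A
  B′ = rotate⁻¹ B
  A′<B′ : count A′ < count B′
  A′<B′ = subst (_< count B′) (sym (count-rotate⁻¹ A)) (subst (count A <_) (sym (count-rotate⁻¹ B)) A<B)
  sA′<B′ : count (swap 0 A′) < count B′
  sA′<B′ = subst (_< count B′) (sym (count-swap 0 A′)) A′<B′
  sA′<sB′ : count (swap 0 A′) < count (swap 0 B′)
  sA′<sB′ = subst (count (swap 0 A′) <_) (sym (count-swap 0 B′)) sA′<B′
  queue′ : queue A B ≡ rotate (queue A′ B′)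
  queue′ = trans (cong₂ queue (sym (rotate-rotate⁻¹ A)) (sym (rotate-rotate⁻¹ B))) (queue-rotate A′ B′ A′<B′)
  jump-queue : jump 0 (queue A B) ≡ rotate (swap 0 (queue A′ B′))
  jump-queue = cong (rotate ∘ swap 0) (trans (cong rotate⁻¹ queue′) (rotate⁻¹-rotate (queue A′ B′)))
  queue-jump : queue (jump 0 A) B ≡ rotate (queue (swap 0 A′) B′)
  queue-jump = trans (cong (queue (jump 0 A)) (sym (rotate-rotate⁻¹ B))) (queue-rotate (swap 0 A′) B′ sA′<B′)
  conjugate : ∀ k → Compatible (swap 0) k A′ B′ → Compatible (jump 0) k A B
  conjugate flat e        = trans jump-queue (trans (cong rotate e) (sym queue-jump))
  conjugate rise (e , e′) = trans jump-queue (trans (cong rotate e) (sym (queue-rotate (swap 0 A′) (swap 0 B′) sA′<sB′))) ,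
                            trans queue-jump (trans (cong rotate e′) (sym queue′))
  conjugate fall e        = trans jump-queue (trans (cong rotate e) (sym queue′))

isRise isFall : Kind → ℚ
isRise rise = 1ℚ
isRise _    = 0ℚ
isFall fall = 1ℚ
isFall _    = 0ℚ

-- A jump turns the words with a rise at site i into those with a fall there.
∑-swap-rise : ∀ n i (g : Word n → ℚ) →
  ∑ (words n) (λ w → isRise (kindAt i w) * g (swap i w)) ≡ ∑ (words n) (λ w → isFall (kindAt i w) * g w)
∑-swap-rise zero          zero    g = refl
∑-swap-rise zero          (suc i) g = refl
∑-swap-rise (suc zero)    zero    g = refl
∑-swap-rise (suc (suc n)) zero    g = begin
  ∑ (words (suc (suc n))) (λ w → isRise (kindAt 0 w) * g (swap 0 w))
    ≡⟨ four (λ w → isRise (kindAt 0 w) * g (swap 0 w)) ⟩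
  (Z false false + X) + (Z true false + Z true true)
    ≡⟨ cong₂ _+_ (cong (_+ X) (Z≡0 false false)) (cong₂ _+_ (Z≡0 true false) (Z≡0 true true)) ⟩
  (0ℚ + X) + (0ℚ + 0ℚ)
    ≡⟨ lem X ⟩
  (0ℚ + 0ℚ) + (X + 0ℚ)
    ≡⟨ sym (cong₂ _+_ (cong₂ _+_ (Z≡0 false false) (Z≡0 false true)) (cong (X ℚ.+_) (Z≡0 true true))) ⟩
  (Z false false + Z false true) + (X + Z true true)
    ≡⟨ sym (four (λ w → isFall (kindAt 0 w) * g w)) ⟩
  ∑ (words (suc (suc n))) (λ w → isFall (kindAt 0 w) * g w) ∎
  where
  X = ∑ (words n) (λ w → 1ℚ * g (true ∷ false ∷ w))
  Z : Bool → Bool → ℚ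
  Z a b = ∑ (words n) (λ w → 0ℚ * g (a ∷ b ∷ w))
  Z≡0 : ∀ a b → Z a b ≡ 0ℚ
  Z≡0 a b = trans (∑-scale 0ℚ (λ w → g (a ∷ b ∷ w)) (words n)) (ℚₚ.*-zeroˡ (∑ (words n) (λ w → g (a ∷ b ∷ w))))
  lem : ∀ x → (0ℚ + x) + (0ℚ + 0ℚ) ≡ (0ℚ + 0ℚ) + (x + 0ℚ)
  lem = solve-∀ ℚ-ring
  four : ∀ f → ∑ (words (suc (suc n))) f ≡
    (∑ (words n) (λ w → f (false ∷ false ∷ w)) + ∑ (words n) (λ w → f (false ∷ true ∷ w)))
      + (∑ (words n) (λ w → f (true ∷ false ∷ w)) + ∑ (words n) (λ w → f (true ∷ true ∷ w)))
  four f = trans (∑-words (suc n) f)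
    (cong₂ _+_ (∑-words n (λ w → f (false ∷ w))) (∑-words n (λ w → f (true ∷ w))))
∑-swap-rise (suc n)       (suc i) g = trans (∑-words n _) (trans
  (cong₂ _+_ (∑-swap-rise n i (λ w → g (false ∷ w))) (∑-swap-rise n i (λ w → g (true ∷ w))))
  (sym (∑-words n _)))

∑-rotate : ∀ n (f : Word n → ℚ) → ∑ (words n) (λ w → f (rotate w)) ≡ ∑ (words n) f
∑-rotate zero    f = refl
∑-rotate (suc n) f = trans (∑-words n _) (last-letter n f)
  where
  last-letter : ∀ n (f : Word (suc n) → ℚ) →
    ∑ (words n) (λ w → f (w Vec.∷ʳ false)) + ∑ (words n) (λ w → f (w Vec.∷ʳ true)) ≡ ∑ (words (suc n)) f
  last-letter zero    f = lem (f (false ∷ [])) (f (true ∷ []))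
    where lem : ∀ a b → (a + 0ℚ) + (b + 0ℚ) ≡ a + (b + 0ℚ)
          lem = solve-∀ ℚ-ring
  last-letter (suc n) f = begin
    ∑ (words (suc n)) (λ w → f (w Vec.∷ʳ false)) + ∑ (words (suc n)) (λ w → f (w Vec.∷ʳ true))
      ≡⟨ cong₂ _+_ (∑-words n _) (∑-words n _) ⟩
    (F false false + F true false) + (F false true + F true true)
      ≡⟨ lem (F false false) (F true false) (F false true) (F true true) ⟩
    (F false false + F false true) + (F true false + F true true)
      ≡⟨ cong₂ _+_ (last-letter n (λ w → f (false ∷ w))) (last-letter n (λ w → f (true ∷ w))) ⟩
    ∑ (words (suc n)) (λ w → f (false ∷ w)) + ∑ (words (suc n)) (λ w → f (true ∷ w))
      ≡⟨ sym (∑-words (suc n) f) ⟩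
    ∑ (words (suc (suc n))) f ∎
    where
    F : Bool → Bool → ℚ
    F a b = ∑ (words n) (λ w → f (a ∷ (w Vec.∷ʳ b)))
    lem : ∀ a b c d → (a + b) + (c + d) ≡ (a + c) + (b + d)
    lem = solve-∀ ℚ-ring

∑-jump-rise : ∀ n i (g : Word n → ℚ) →
  ∑ (words n) (λ w → isRise (kind i w) * g (jump i w)) ≡ ∑ (words n) (λ w → isFall (kind i w) * g w)
∑-jump-rise n (suc i) g = ∑-swap-rise n i g
∑-jump-rise n zero    g = begin
  ∑ (words n) (λ w → isRise (kindAt 0 (rotate⁻¹ w)) * g (rotate (swap 0 (rotate⁻¹ w))))
    ≡⟨ sym (∑-rotate n _) ⟩
  ∑ (words n) (λ w → isRise (kindAt 0 (rotate⁻¹ (rotate w))) * g (rotate (swap 0 (rotate⁻¹ (rotate w)))))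
    ≡⟨ ∑-cong (words n) (λ w → cong (λ v → isRise (kindAt 0 v) * g (rotate (swap 0 v))) (rotate⁻¹-rotate w)) ⟩
  ∑ (words n) (λ w → isRise (kindAt 0 w) * g (rotate (swap 0 w)))
    ≡⟨ ∑-swap-rise n 0 (g ∘ rotate) ⟩
  ∑ (words n) (λ w → isFall (kindAt 0 w) * g (rotate w))
    ≡⟨ ∑-cong (words n) (λ w → cong (λ v → isFall (kindAt 0 v) * g (rotate w)) (sym (rotate⁻¹-rotate w))) ⟩
  ∑ (words n) (λ w → isFall (kindAt 0 (rotate⁻¹ (rotate w))) * g (rotate w))
    ≡⟨ ∑-rotate n (λ w → isFall (kindAt 0 (rotate⁻¹ w)) * g w) ⟩
  ∑ (words n) (λ w → isFall (kindAt 0 (rotate⁻¹ w)) * g w) ∎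

∑-applyUpTo : ∀ (g : ℕ → ℕ) n f → ∑ (applyUpTo g n) f ≡ ∑ (upTo n) (f ∘ g)
∑-applyUpTo g zero    f = refl
∑-applyUpTo g (suc n) f = cong (f (g 0) ℚ.+_)
  (trans (∑-applyUpTo (g ∘ suc) n f) (sym (∑-applyUpTo suc n (f ∘ g))))

-- Falls and rises alternate around the ring.
∑-falls-rises : ∀ {n} (w : Word n) → ∑ (upTo n) (λ i → isFall (kind i w) - isRise (kind i w)) ≡ 0ℚ
∑-falls-rises []          = refl
∑-falls-rises (x ∷ [])    = refl
∑-falls-rises {suc (suc n)} (x ∷ y ∷ w) = begin
  ∑ (upTo (suc (suc n))) (λ i → slope (kind i (x ∷ y ∷ w)))
    ≡⟨ cong (slope (kind 0 (x ∷ y ∷ w)) ℚ.+_) (∑-applyUpTo suc (suc n) (λ i → slope (kind i (x ∷ y ∷ w)))) ⟩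
  slope (kind 0 (x ∷ y ∷ w)) + ∑ (upTo (suc n)) (λ i → slope (kindAt i (x ∷ y ∷ w)))
    ≡⟨ cong₂ _+_ (slope-0 (Vec.last (y ∷ w)) x (Vec.init (y ∷ w))) (telescope x (y ∷ w)) ⟩
  (height (Vec.last (y ∷ w)) - height x) + (height x - height (Vec.last (y ∷ w)))
    ≡⟨ lem (height (Vec.last (y ∷ w))) (height x) ⟩
  0ℚ ∎
  where
  slope : Kind → ℚ
  slope k = isFall k - isRise k
  height : Bool → ℚ
  height false = 0ℚ
  height true  = 1ℚ
  lem : ∀ a b → (a - b) + (b - a) ≡ 0ℚ
  lem = solve-∀ ℚ-ring
  slope-0 : ∀ {n} a b (v : Word n) → slope (kindAt 0 (a ∷ b ∷ v)) ≡ height a - height b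
  slope-0 false false v = refl
  slope-0 false true  v = refl
  slope-0 true  false v = refl
  slope-0 true  true  v = refl
  telescope : ∀ {n} a (v : Word n) → ∑ (upTo n) (λ i → slope (kindAt i (a ∷ v))) ≡ height a - height (Vec.last (a ∷ v))
  telescope a []      = sym (ℚₚ.+-inverseʳ (height a))
  telescope {suc n} a (b ∷ v) = begin
    slope (kindAt 0 (a ∷ b ∷ v)) + ∑ (applyUpTo suc n) (λ i → slope (kindAt i (a ∷ b ∷ v)))
      ≡⟨ cong₂ _+_ (slope-0 a b v) (trans (∑-applyUpTo suc n _) (telescope b v)) ⟩
    (height a - height b) + (height b - height (Vec.last (b ∷ v)))
      ≡⟨ lem′ (height a) (height b) (height (Vec.last (b ∷ v))) ⟩
    height a - height (Vec.last (b ∷ v)) ∎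
    where lem′ : ∀ a b c → (a - b) + (b - c) ≡ a - c
          lem′ = solve-∀ ℚ-ring

-- Invariance of the sum over multiline queues under a random jump

sizes-< : ∀ {n} {S : List (Word n)} {t ts} → StrictlyDescending (t ∷ ts) → Sizes S ts → All (λ w → count w < t) S
sizes-< s             []         = []
sizes-< (u<t ∷ [-])     (refl ∷ []) = u<t ∷ []
sizes-< (u<t ∷ v<u ∷ s) (refl ∷ p)  = u<t ∷ sizes-< (ℕₚ.<-trans v<u u<t ∷ s) p

map-compatible : ∀ {n} i (B : Word n) {S} → All (λ w → count w < count B) S →
  ((kind i B ≡ flat → map (jump i) (map (λ A → queue A B) S) ≡ map (λ A → queue A B) (map (jump i) S)) ×
   (kind i B ≡ fall → map (jump i) (map (λ A → queue A B) S) ≡ map (λ A → queue A B) S)) ×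
  ((kind i B ≡ rise → map (jump i) (map (λ A → queue A B) S) ≡ map (λ A → queue A (jump i B)) (map (jump i) S)) ×
   (kind i B ≡ rise → map (λ A → queue A B) (map (jump i) S) ≡ map (λ A → queue A B) S))
map-compatible i B []             = ((λ _ → refl) , (λ _ → refl)) , ((λ _ → refl) , (λ _ → refl))
map-compatible i B {A ∷ S} (A<B ∷ p) with kind i B | compatible-jump i A B A<B | map-compatible i B p
... | flat | c        | (h , _) , _ = ((λ e → cong₂ _∷_ c (h e)) , (λ ())) , ((λ ()) , (λ ()))
... | rise | c , c′   | _ , (h , h′) = ((λ ()) , (λ ())) , ((λ e → cong₂ _∷_ c (h e)) , (λ e → cong₂ _∷_ c′ (h′ e)))
... | fall | c        | (_ , h) , _ = ((λ ()) , (λ e → cong₂ _∷_ c (h e))) , ((λ ()) , (λ ()))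

swap-fixed : ∀ {n} i (w : Word n) → kindAt i w ≢ rise → swap i w ≡ w
swap-fixed zero    []                  e = refl
swap-fixed zero    (x ∷ [])            e = refl
swap-fixed zero    (false ∷ false ∷ w) e = refl
swap-fixed zero    (false ∷ true ∷ w)  e = ⊥-elim (e refl)
swap-fixed zero    (true ∷ y ∷ w)      e = refl
swap-fixed (suc i) []                  e = refl
swap-fixed (suc i) (x ∷ w)             e = cong (x ∷_) (swap-fixed i w e)

jump-fixed : ∀ {n} i (w : Word n) → kind i w ≢ rise → jump i w ≡ w
jump-fixed zero    w e = trans (cong rotate (swap-fixed 0 (rotate⁻¹ w) e)) (rotate-rotate⁻¹ w)
jump-fixed (suc i) w e = swap-fixed i w e

-- For a service word B let ψ₀ be the sum over arrival queues S and ψ₁ the same with S jumped. A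
-- jump at a flat site of B contributes ψ₁. At a fall it contributes ψ₀, plus the ψ₁ that comes in
-- from the word with a rise there. At a rise the contribution moves away, leaving 0, which is ψ₁ -
-- ψ₀ because the queue of B does not notice the jump of S. In all cases this is ψ₁ + (isFall -
-- isRise) ψ₀. Summed over the sites, ψ₁ is settled by induction and the second term vanishes, as
-- falls and rises are equally many.
mlqs-stationary : ∀ n ts → StrictlyDescending ts → ∀ φ →
  ∑ (upTo n) (λ i → ∑ (mlqs n ts) (λ S → φ (map (jump i) S))) ≡ ∑ (upTo n) (λ _ → ∑ (mlqs n ts) φ)
mlqs-stationary n []       s φ = refl
mlqs-stationary n (t ∷ ts) s φ = begin
  ∑ (upTo n) (λ i → ∑ (mlqs n (t ∷ ts)) (λ S → φ (map (jump i) S)))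
    ≡⟨ ∑-cong (upTo n) one-site ⟩
  ∑ (upTo n) (λ i → ∑ (words n) (λ B → c B * (ψ₁ i B + slope i B * ψ₀ B)))
    ≡⟨ ∑-swap (λ i B → c B * (ψ₁ i B + slope i B * ψ₀ B)) (upTo n) (words n) ⟩
  ∑ (words n) (λ B → ∑ (upTo n) (λ i → c B * (ψ₁ i B + slope i B * ψ₀ B)))
    ≡⟨ ∑-cong (words n) all-sites ⟩
  ∑ (words n) (λ B → ∑ (upTo n) (λ _ → c B * ψ₀ B))
    ≡⟨ ∑-swap (λ B _ → c B * ψ₀ B) (words n) (upTo n) ⟩
  ∑ (upTo n) (λ _ → ∑ (words n) (λ B → c B * ψ₀ B))
    ≡⟨ ∑-cong (upTo n) (λ _ → sym (∑-mlqs n t ts φ)) ⟩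
  ∑ (upTo n) (λ _ → ∑ (mlqs n (t ∷ ts)) φ) ∎
  where
  Q = mlqs n ts
  c : Word n → ℚ
  c B = 𝟙 (count B ℕ.≟ t)
  Ψ : Word n → List (Word n) → ℚ
  Ψ B S = φ (B ∷ map (λ A → queue A B) S)
  ψ₀ : Word n → ℚ
  ψ₀ B = ∑ Q (Ψ B)
  ψ₁ : ℕ → Word n → ℚ
  ψ₁ i B = ∑ Q (λ S → Ψ B (map (jump i) S))
  slope : ℕ → Word n → ℚ
  slope i B = isFall (kind i B) - isRise (kind i B)

  all-sites : ∀ B → ∑ (upTo n) (λ i → c B * (ψ₁ i B + slope i B * ψ₀ B)) ≡ ∑ (upTo n) (λ _ → c B * ψ₀ B)
  all-sites B = begin
    ∑ (upTo n) (λ i → c B * (ψ₁ i B + slope i B * ψ₀ B))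
      ≡⟨ ∑-scale (c B) _ (upTo n) ⟩
    c B * ∑ (upTo n) (λ i → ψ₁ i B + slope i B * ψ₀ B)
      ≡⟨ cong (c B *_) (trans (∑-cong (upTo n) (λ i → cong (ψ₁ i B ℚ.+_) (ℚₚ.*-comm (slope i B) (ψ₀ B))))
                              (∑-linear (ψ₀ B) (λ i → ψ₁ i B) (λ i → slope i B) (upTo n))) ⟩
    c B * (∑ (upTo n) (λ i → ψ₁ i B) + ψ₀ B * ∑ (upTo n) (λ i → slope i B))
      ≡⟨ cong₂ (λ x y → c B * (x + ψ₀ B * y)) (mlqs-stationary n ts (Linked.tail s) (Ψ B)) (∑-falls-rises B) ⟩
    c B * (∑ (upTo n) (λ _ → ψ₀ B) + ψ₀ B * 0ℚ)
      ≡⟨ cong (c B *_) (lem (∑ (upTo n) (λ _ → ψ₀ B)) (ψ₀ B)) ⟩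
    c B * ∑ (upTo n) (λ _ → ψ₀ B)
      ≡⟨ sym (∑-scale (c B) (λ _ → ψ₀ B) (upTo n)) ⟩
    ∑ (upTo n) (λ _ → c B * ψ₀ B) ∎
    where lem : ∀ x y → x + y * 0ℚ ≡ x
          lem = solve-∀ ℚ-ring

  one-site : ∀ i → ∑ (mlqs n (t ∷ ts)) (λ S → φ (map (jump i) S))
                 ≡ ∑ (words n) (λ B → c B * (ψ₁ i B + slope i B * ψ₀ B))
  one-site i = begin
    ∑ (mlqs n (t ∷ ts)) (λ S → φ (map (jump i) S))
      ≡⟨ ∑-mlqs n t ts (λ S → φ (map (jump i) S)) ⟩
    ∑ (words n) (λ B → c B * E B)
      ≡⟨ ∑-cong (words n) (λ B → split B (count B ℕ.≟ t)) ⟩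
    ∑ (words n) (λ B → X B + isRise (kind i B) * h (jump i B))
      ≡⟨ ∑-+ X (λ B → isRise (kind i B) * h (jump i B)) (words n) ⟩
    ∑ (words n) X + ∑ (words n) (λ B → isRise (kind i B) * h (jump i B))
      ≡⟨ cong (∑ (words n) X ℚ.+_) (∑-jump-rise n i h) ⟩
    ∑ (words n) X + ∑ (words n) (λ B → isFall (kind i B) * h B)
      ≡⟨ sym (∑-+ X (λ B → isFall (kind i B) * h B) (words n)) ⟩
    ∑ (words n) (λ B → X B + isFall (kind i B) * h B)
      ≡⟨ ∑-cong (words n) (λ B → collect B (count B ℕ.≟ t)) ⟩
    ∑ (words n) (λ B → c B * (ψ₁ i B + slope i B * ψ₀ B)) ∎
    where
    E X h : Word n → ℚ
    E B = ∑ Q (λ S → φ (jump i B ∷ map (jump i) (map (λ A → queue A B) S)))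
    -- `X` is what stays attached to B after the jump. On a rise the contribution goes to `jump i B`
    -- instead and is expressed there by `h`.
    X B = c B * ((1ℚ - isRise (kind i B) - isFall (kind i B)) * ψ₁ i B + isFall (kind i B) * ψ₀ B)
    h B = c B * ψ₁ i B

    smaller : ∀ B → count B ≡ t → All (λ S → All (λ w → count w < count B) S) Q
    smaller B refl = All.map (sizes-< s) (mlqs-sizes n ts (Linked.tail s))

    split : ∀ B (d : Dec (count B ≡ t)) →
      𝟙 d * E B ≡ 𝟙 d * ((1ℚ - isRise (kind i B) - isFall (kind i B)) * ψ₁ i B + isFall (kind i B) * ψ₀ B)
                  + isRise (kind i B) * h (jump i B)
    split B (no ¬e) = trans (lem (E B) Z (isRise (kind i B)) (ψ₁ i (jump i B)))
      (cong (λ x → 0ℚ * Z + isRise (kind i B) * (x * ψ₁ i (jump i B)))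
            (sym (𝟙-no (count (jump i B) ℕ.≟ t) (λ e → ¬e (trans (sym (count-jump i B)) e)))))
      where
      Z = (1ℚ - isRise (kind i B) - isFall (kind i B)) * ψ₁ i B + isFall (kind i B) * ψ₀ B
      lem : ∀ a z r y → 0ℚ * a ≡ 0ℚ * z + r * (0ℚ * y)
      lem = solve-∀ ℚ-ring
    split B (yes e) = trans (cases (kind i B) refl)
      (cong (λ x → 1ℚ * Z + isRise (kind i B) * (x * ψ₁ i (jump i B)))
            (sym (𝟙-yes (count (jump i B) ℕ.≟ t) (trans (count-jump i B) e))))
      where
      Z = (1ℚ - isRise (kind i B) - isFall (kind i B)) * ψ₁ i B + isFall (kind i B) * ψ₀ B
      cases : ∀ k → kind i B ≡ k →
        1ℚ * E B ≡ 1ℚ * ((1ℚ - isRise k - isFall k) * ψ₁ i B + isFall k * ψ₀ B) + isRise k * (1ℚ * ψ₁ i (jump i B))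
      cases flat k≡ = trans (cong (1ℚ *_) (∑-cong-All (All.map (λ p →
          cong₂ (λ b S → φ (b ∷ S)) (jump-fixed i B (λ r → flat≢rise (trans (sym k≡) r)))
                                    (proj₁ (proj₁ (map-compatible i B p)) k≡)) (smaller B e))))
          (lem (ψ₁ i B) (ψ₀ B) (ψ₁ i (jump i B)))
        where
        flat≢rise : flat ≢ rise
        flat≢rise ()
        lem : ∀ x y z → 1ℚ * x ≡ 1ℚ * ((1ℚ - 0ℚ - 0ℚ) * x + 0ℚ * y) + 0ℚ * (1ℚ * z)
        lem = solve-∀ ℚ-ring
      cases rise k≡ = trans (cong (1ℚ *_) (∑-cong-All (All.map (λ p →
          cong (λ S → φ (jump i B ∷ S)) (proj₁ (proj₂ (map-compatible i B p)) k≡)) (smaller B e))))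
          (lem (ψ₁ i B) (ψ₀ B) (ψ₁ i (jump i B)))
        where
        lem : ∀ x y z → 1ℚ * z ≡ 1ℚ * ((1ℚ - 1ℚ - 0ℚ) * x + 0ℚ * y) + 1ℚ * (1ℚ * z)
        lem = solve-∀ ℚ-ring
      cases fall k≡ = trans (cong (1ℚ *_) (∑-cong-All (All.map (λ p →
          cong₂ (λ b S → φ (b ∷ S)) (jump-fixed i B (λ r → fall≢rise (trans (sym k≡) r)))
                                    (proj₂ (proj₁ (map-compatible i B p)) k≡)) (smaller B e))))
          (lem (ψ₁ i B) (ψ₀ B) (ψ₁ i (jump i B)))
        where
        fall≢rise : fall ≢ rise
        fall≢rise ()
        lem : ∀ x y z → 1ℚ * y ≡ 1ℚ * ((1ℚ - 0ℚ - 1ℚ) * x + 1ℚ * y) + 0ℚ * (1ℚ * z)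
        lem = solve-∀ ℚ-ring

    collect : ∀ B (d : Dec (count B ≡ t)) →
      𝟙 d * ((1ℚ - isRise (kind i B) - isFall (kind i B)) * ψ₁ i B + isFall (kind i B) * ψ₀ B)
        + isFall (kind i B) * (𝟙 d * ψ₁ i B)
        ≡ 𝟙 d * (ψ₁ i B + (isFall (kind i B) - isRise (kind i B)) * ψ₀ B)
    collect B (no _)  = lem (1ℚ - isRise (kind i B) - isFall (kind i B)) (isFall (kind i B)) (isRise (kind i B)) (ψ₁ i B) (ψ₀ B)
      where lem : ∀ a f r x y → 0ℚ * (a * x + f * y) + f * (0ℚ * x) ≡ 0ℚ * (x + (f - r) * y)
            lem = solve-∀ ℚ-ring
    collect B (yes e) = trans (lem (isRise (kind i B)) (isFall (kind i B)) (ψ₁ i B) (ψ₀ B))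
      (trans (cong (λ z → 1ℚ * (ψ₁ i B + isFall (kind i B) * ψ₀ B) - z) (same-on-rise (kind i B) refl))
             (lem′ (isRise (kind i B)) (isFall (kind i B)) (ψ₁ i B) (ψ₀ B)))
      where
      same-on-rise : ∀ k → kind i B ≡ k → isRise k * ψ₁ i B ≡ isRise k * ψ₀ B
      same-on-rise flat k≡ = trans (ℚₚ.*-zeroˡ (ψ₁ i B)) (sym (ℚₚ.*-zeroˡ (ψ₀ B)))
      same-on-rise fall k≡ = trans (ℚₚ.*-zeroˡ (ψ₁ i B)) (sym (ℚₚ.*-zeroˡ (ψ₀ B)))
      same-on-rise rise k≡ = cong (1ℚ *_) (∑-cong-All (All.map (λ p →
        cong (λ S → φ (B ∷ S)) (proj₂ (proj₂ (map-compatible i B p)) k≡)) (smaller B e)))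
      lem : ∀ r f x y → 1ℚ * ((1ℚ - r - f) * x + f * y) + f * (1ℚ * x) ≡ 1ℚ * (x + f * y) - r * x
      lem = solve-∀ ℚ-ring
      lem′ : ∀ r f x y → 1ℚ * (x + f * y) - r * y ≡ 1ℚ * (x + (f - r) * y)
      lem′ = solve-∀ ℚ-ring

-- Uniqueness of stationary functionals

nonneg-* : ∀ {a b} → 0ℚ ℚ.≤ a → 0ℚ ℚ.≤ b → 0ℚ ℚ.≤ a * b
nonneg-* {a} {b} 0≤a 0≤b = subst (ℚ._≤ a * b) (ℚₚ.*-zeroʳ a) (ℚₚ.*-monoˡ-≤-nonNeg a {{ℚ.nonNegative 0≤a}} 0≤b)

≤⇒0≤- : ∀ {a b} → a ℚ.≤ b → 0ℚ ℚ.≤ b - a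
≤⇒0≤- {a} {b} a≤b = subst (ℚ._≤ b - a) (ℚₚ.+-inverseʳ a) (ℚₚ.+-monoˡ-≤ (- a) a≤b)

0≤-⇒≤ : ∀ {a b} → 0ℚ ℚ.≤ b - a → a ℚ.≤ b
0≤-⇒≤ {a} {b} le = subst₂ ℚ._≤_ (ℚₚ.+-identityˡ a) (lem a b) (ℚₚ.+-monoˡ-≤ a le)
  where lem : ∀ a b → b - a + a ≡ b
        lem = solve-∀ ℚ-ring

∑-mono : ∀ {A : Set} {f g : A → ℚ} xs → (∀ x → f x ℚ.≤ g x) → ∑ xs f ℚ.≤ ∑ xs g
∑-mono []       f≤g = ℚₚ.≤-refl
∑-mono (x ∷ xs) f≤g = ℚₚ.+-mono-≤ (f≤g x) (∑-mono xs f≤g)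

∑-squeeze : ∀ {A : Set} {f g : A → ℚ} xs → (∀ x → f x ℚ.≤ g x) → ∑ xs f ≡ ∑ xs g → All (λ x → f x ≡ g x) xs
∑-squeeze         []       f≤g e = []
∑-squeeze {f = f} {g} (x ∷ xs) f≤g e =
  ℚₚ.≤-antisym (f≤g x) (ℚₚ.≮⇒≥ (λ lt → ℚₚ.<⇒≢ (ℚₚ.+-mono-<-≤ lt (∑-mono xs f≤g)) e)) ∷
  ∑-squeeze xs f≤g (ℚₚ.≤-antisym (∑-mono xs f≤g)
    (ℚₚ.≮⇒≥ (λ lt → ℚₚ.<⇒≢ (ℚₚ.+-mono-≤-< (f≤g x) lt) e)))

run : ∀ {X : Set} → (ℕ → X → X) → List ℕ → X → X
run T []       x = x
run T (i ∷ is) x = run T is (T i x)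

Bounded : ∀ {X : Set} → (X → ℚ) → Set
Bounded φ = ∀ x → - 1ℚ ℚ.≤ φ x × φ x ℚ.≤ 1ℚ

weigh : ∀ {X : Set} → List (ℚ × X) → (X → ℚ) → ℚ
weigh L φ = ∑ L (λ (c , x) → c * φ x)

module _ {X : Set} (L : List (ℚ × X)) where

  weigh-linear : ∀ c φ ψ → weigh L (λ x → φ x + c * ψ x) ≡ weigh L φ + c * weigh L ψ
  weigh-linear c φ ψ = trans (∑-cong L (λ (a , x) → lem a (φ x) c (ψ x)))
                             (∑-linear c (λ (a , x) → a * φ x) (λ (a , x) → a * ψ x) L)
    where lem : ∀ a p c q → a * (p + c * q) ≡ a * p + c * (a * q)
          lem = solve-∀ ℚ-ring

  weigh-const : ∀ c → weigh L (λ _ → c) ≡ c * weigh L (λ _ → 1ℚ)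
  weigh-const c = trans (∑-cong L (λ (a , x) → lem a c)) (∑-scale c (λ (a , x) → a * 1ℚ) L)
    where lem : ∀ a c → a * c ≡ c * (a * 1ℚ)
          lem = solve-∀ ℚ-ring

  module _ (_≟_ : (x y : X) → Dec (x ≡ y)) where

    weight : X → ℚ
    weight y = weigh L (λ x → 𝟙 (x ≟ y))

    -- `L` may list a point several times with weights of both signs, so signs are tested on the
    -- total `weight`. The points are removed from the support of `h` one at a time; by linearity,
    -- clearing the value at y costs exactly `weight y * h y`.
    weigh-nonneg : ∀ h → (∀ y → 0ℚ ℚ.≤ weight y * h y) → 0ℚ ℚ.≤ weigh L h
    weigh-nonneg h h≥0 =
      supported (map proj₂ L) h (All.tabulate (λ cx∈L → inj₁ (∈-map⁺ proj₂ cx∈L))) h≥0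
      where
      supported : ∀ ys h → All (λ cx → proj₂ cx ∈ ys ⊎ h (proj₂ cx) ≡ 0ℚ) L →
                  (∀ y → 0ℚ ℚ.≤ weight y * h y) → 0ℚ ℚ.≤ weigh L h
      supported []       h supp h≥0 = ℚₚ.≤-reflexive (sym (trans (∑-cong-All (All.map (λ {cx} → vanish cx) supp)) (∑-zero L)))
        where
        vanish : ∀ cx → proj₂ cx ∈ [] ⊎ h (proj₂ cx) ≡ 0ℚ → proj₁ cx * h (proj₂ cx) ≡ 0ℚ
        vanish (c , x) (inj₂ e) = trans (cong (c *_) e) (ℚₚ.*-zeroʳ c)
      supported (y ∷ ys) h supp h≥0 = subst (0ℚ ℚ.≤_)
        (trans (cong (_+ weight y * h y) (weigh-linear (- h y) h (λ x → 𝟙 (x ≟ y)))) (lem (weigh L h) (h y) (weight y)))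
        (ℚₚ.+-mono-≤ (supported ys h′ (All.map (λ {cx} → remove cx) supp) h′≥0) (h≥0 y))
        where
        lem : ∀ a b c → a + (- b) * c + c * b ≡ a
        lem = solve-∀ ℚ-ring
        h′ : X → ℚ
        h′ x = h x + (- h y) * 𝟙 (x ≟ y)
        h′-y : h′ y ≡ 0ℚ
        h′-y = trans (cong (λ z → h y + (- h y) * z) (𝟙-yes (y ≟ y) refl)) (lem′ (h y))
          where lem′ : ∀ a → a + (- a) * 1ℚ ≡ 0ℚ
                lem′ = solve-∀ ℚ-ring
        h′-other : ∀ x → x ≢ y → h′ x ≡ h x
        h′-other x x≢y = trans (cong (λ z → h x + (- h y) * z) (𝟙-no (x ≟ y) x≢y)) (lem′ (h x) (h y))
          where lem′ : ∀ a b → a + (- b) * 0ℚ ≡ a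
                lem′ = solve-∀ ℚ-ring
        remove : ∀ cx → proj₂ cx ∈ (y ∷ ys) ⊎ h (proj₂ cx) ≡ 0ℚ → proj₂ cx ∈ ys ⊎ h′ (proj₂ cx) ≡ 0ℚ
        remove (c , x) p with x ≟ y in eq | p
        ... | yes refl | _                = inj₂ (subst (λ d → h y + (- h y) * 𝟙 d ≡ 0ℚ) eq h′-y)
        ... | no x≢y   | inj₁ (here x≡y)  = ⊥-elim (x≢y x≡y)
        ... | no x≢y   | inj₁ (there x∈)  = inj₁ x∈
        ... | no x≢y   | inj₂ e           = inj₂ (trans (subst (λ d → h x + (- h y) * 𝟙 d ≡ h x) eq (h′-other x x≢y)) e)
        h′≥0 : ∀ x → 0ℚ ℚ.≤ weight x * h′ x
        h′≥0 x = decide (x ≟ y)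
          where
          decide : Dec (x ≡ y) → 0ℚ ℚ.≤ weight x * h′ x
          decide (yes refl) = ℚₚ.≤-reflexive (sym (trans (cong (weight y *_) h′-y) (ℚₚ.*-zeroʳ (weight y))))
          decide (no x≢y)   = subst (λ z → 0ℚ ℚ.≤ weight x * z) (sym (h′-other x x≢y)) (h≥0 x)

    -- The sign of the total weight, which maximises the functional among functions with values in
    -- [-1, 1].
    optimal : X → ℚ
    optimal y with ℚₚ.≤-total 0ℚ (weight y)
    ... | inj₁ _ = 1ℚ
    ... | inj₂ _ = - 1ℚ

    optimal-bounded : Bounded optimal
    optimal-bounded y with ℚₚ.≤-total 0ℚ (weight y)
    ... | inj₁ _ = from-yes (- 1ℚ ℚ.≤? 1ℚ) , ℚₚ.≤-refl
    ... | inj₂ _ = ℚₚ.≤-refl , from-yes (- 1ℚ ℚ.≤? 1ℚ)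

    weigh≤optimal : ∀ φ → Bounded φ → weigh L φ ℚ.≤ weigh L optimal
    weigh≤optimal φ bounded = 0≤-⇒≤ (subst (0ℚ ℚ.≤_)
      (trans (weigh-linear (- 1ℚ) optimal φ) (lem (weigh L optimal) (weigh L φ))) (weigh-nonneg _ pointwise))
      where
      lem : ∀ a b → a + - 1ℚ * b ≡ a - b
      lem = solve-∀ ℚ-ring
      lem⁺ : ∀ a b → a * (1ℚ - b) ≡ a * (1ℚ + - 1ℚ * b)
      lem⁺ = solve-∀ ℚ-ring
      lem⁻ : ∀ a b → (0ℚ - a) * (b - - 1ℚ) ≡ a * (- 1ℚ + - 1ℚ * b)
      lem⁻ = solve-∀ ℚ-ring
      pointwise : ∀ y → 0ℚ ℚ.≤ weight y * (optimal y + - 1ℚ * φ y)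
      pointwise y with ℚₚ.≤-total 0ℚ (weight y)
      ... | inj₁ 0≤w = subst (0ℚ ℚ.≤_) (lem⁺ (weight y) (φ y)) (nonneg-* 0≤w (≤⇒0≤- (proj₂ (bounded y))))
      ... | inj₂ w≤0 = subst (0ℚ ℚ.≤_) (lem⁻ (weight y) (φ y)) (nonneg-* (≤⇒0≤- w≤0) (≤⇒0≤- (proj₁ (bounded y))))

    -- A bounded function that maximises the functional keeps doing so when it
    -- is composed with moves, in particular with a synchronising sequence of
    -- moves, which makes it constant.
    stationary-zero : ∀ (T : ℕ → X → X) n →
      (∀ φ → ∑ (upTo n) (λ i → weigh L (φ ∘ T i)) ≡ ∑ (upTo n) (λ _ → weigh L φ)) →
      ∀ is root → All (_< n) is → All (λ cx → run T is (proj₂ cx) ≡ root) L →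
      weigh L (λ _ → 1ℚ) ≡ 0ℚ → ∀ φ → Bounded φ → weigh L φ ≡ 0ℚ
    stationary-zero T n stationary is root is<n sync total φ bounded =
      ℚₚ.≤-antisym (upper φ bounded) (subst (0ℚ ℚ.≤_) (lem₁ (weigh L φ)) (ℚₚ.neg-antimono-≤
        (subst (ℚ._≤ 0ℚ) (trans (weigh-linear (- 1ℚ) (λ _ → 0ℚ) φ) (cong (_+ - 1ℚ * weigh L φ)
          (trans (weigh-const 0ℚ) (ℚₚ.*-zeroˡ (weigh L (λ _ → 1ℚ))))))
          (upper (λ x → 0ℚ + - 1ℚ * φ x) negated))))
      where
      lem₁ : ∀ a → - (0ℚ + - 1ℚ * a) ≡ a
      lem₁ = solve-∀ ℚ-ring
      lem₂ : ∀ a → - a ≡ 0ℚ + - 1ℚ * a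
      lem₂ = solve-∀ ℚ-ring
      negated : Bounded (λ x → 0ℚ + - 1ℚ * φ x)
      negated x = subst (λ z → - 1ℚ ℚ.≤ z × z ℚ.≤ 1ℚ) (lem₂ (φ x))
        (ℚₚ.neg-antimono-≤ (proj₂ (bounded x)) , ℚₚ.neg-antimono-≤ (proj₁ (bounded x)))
      M = weigh L optimal
      moved : ∀ ψ → Bounded ψ → weigh L ψ ≡ M → ∀ {i} → i < n → weigh L (ψ ∘ T i) ≡ M
      -- None of the n terms exceeds the maximum M and they add up to n times M, so each of them
      -- equals M.
      moved ψ b e i<n = All.lookup
        (∑-squeeze (upTo n) (λ i → weigh≤optimal (ψ ∘ T i) (λ x → b (T i x)))
          (trans (stationary ψ) (∑-cong (upTo n) (λ _ → e))))
        (∈-upTo⁺ i<n)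
      runs : ∀ is → All (_< n) is → ∀ ψ → Bounded ψ → weigh L ψ ≡ M → weigh L (ψ ∘ run T is) ≡ M
      runs []       []         ψ b e = e
      runs (i ∷ is) (i<n ∷ ps) ψ b e = moved (ψ ∘ run T is) (λ x → b (run T is x)) (runs is ps ψ b e) i<n
      M≡0 : M ≡ 0ℚ
      M≡0 = begin
        M                              ≡⟨ sym (runs is is<n optimal optimal-bounded refl) ⟩
        weigh L (optimal ∘ run T is)   ≡⟨ ∑-cong-All (All.map (λ {cx} e → cong (λ x → proj₁ cx * optimal x) e) sync) ⟩
        weigh L (λ _ → optimal root)   ≡⟨ weigh-const (optimal root) ⟩
        optimal root * weigh L (λ _ → 1ℚ) ≡⟨ trans (cong (optimal root *_) total) (ℚₚ.*-zeroʳ (optimal root)) ⟩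
        0ℚ                             ∎
      upper : ∀ ψ → Bounded ψ → weigh L ψ ℚ.≤ 0ℚ
      upper ψ b = subst (weigh L ψ ℚ.≤_) M≡0 (weigh≤optimal ψ b)

-- A sorting network

sorted : ∀ n → ℕ → Word n
sorted zero    c       = []
sorted (suc n) zero    = false ∷ sorted n zero
sorted (suc n) (suc c) = true ∷ sorted n c

-- Insertion sort as a fixed sequence that does not look at the word: sort the tail, then carry the
-- head through it. Being oblivious, it sorts all rows of a tuple at once. In jumps the indices go
-- up by one, which avoids the jump across the cut.
sortingSwaps : ℕ → List ℕ
sortingSwaps zero    = []
sortingSwaps (suc n) = map suc (sortingSwaps n) ++ upTo n

sortingSwaps-< : ∀ n → All (λ i → suc i < n) (sortingSwaps n)
sortingSwaps-< zero    = []
sortingSwaps-< (suc n) = Allₚ.++⁺ (Allₚ.map⁺ (All.map s≤s (sortingSwaps-< n))) (Allₚ.applyUpTo⁺₁ id n s≤s)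

run-++ : ∀ {X : Set} (T : ℕ → X → X) is js x → run T (is ++ js) x ≡ run T js (run T is x)
run-++ T []       js x = refl
run-++ T (i ∷ is) js x = run-++ T is js (T i x)

run-swap-suc : ∀ {n} is b (w : Word n) → run swap (map suc is) (b ∷ w) ≡ b ∷ run swap is w
run-swap-suc []       b w = refl
run-swap-suc (i ∷ is) b w = run-swap-suc is b (swap i w)

bubble : ∀ n c b → c ≤ n → run swap (upTo n) (b ∷ sorted n c) ≡ sorted (suc n) (bit b ℕ.+ c)
bubble zero    zero    false c≤n = refl
bubble zero    zero    true  c≤n = refl
bubble (suc n) c       b     c≤n = begin
  run swap (applyUpTo suc n) (swap 0 (b ∷ sorted (suc n) c))
    ≡⟨ cong (λ is → run swap is (swap 0 (b ∷ sorted (suc n) c))) (sym (Listₚ.map-upTo suc n)) ⟩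
  run swap (map suc (upTo n)) (swap 0 (b ∷ sorted (suc n) c))
    ≡⟨ first c b c≤n ⟩
  sorted (suc (suc n)) (bit b ℕ.+ c) ∎
  where
  first : ∀ c b → c ≤ suc n →
    run swap (map suc (upTo n)) (swap 0 (b ∷ sorted (suc n) c)) ≡ sorted (suc (suc n)) (bit b ℕ.+ c)
  first zero    false c≤n       = trans (run-swap-suc (upTo n) false (false ∷ sorted n zero)) (cong (false ∷_) (bubble n zero false z≤n))
  first zero    true  c≤n       = trans (run-swap-suc (upTo n) true (false ∷ sorted n zero)) (cong (true ∷_) (bubble n zero false z≤n))
  first (suc c) false (s≤s c≤n) = trans (run-swap-suc (upTo n) true (false ∷ sorted n c)) (cong (true ∷_) (bubble n c false c≤n))
  first (suc c) true  (s≤s c≤n) = trans (run-swap-suc (upTo n) true (true ∷ sorted n c)) (cong (true ∷_) (bubble n c true c≤n))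

count-≤ : ∀ {n} (w : Word n) → count w ≤ n
count-≤ []          = z≤n
count-≤ (false ∷ w) = ℕₚ.m≤n⇒m≤1+n (count-≤ w)
count-≤ (true ∷ w)  = s≤s (count-≤ w)

run-sortingSwaps : ∀ {n} (w : Word n) → run swap (sortingSwaps n) w ≡ sorted n (count w)
run-sortingSwaps []              = refl
run-sortingSwaps {suc n} (b ∷ w) = begin
  run swap (map suc (sortingSwaps n) ++ upTo n) (b ∷ w)
    ≡⟨ run-++ swap (map suc (sortingSwaps n)) (upTo n) (b ∷ w) ⟩
  run swap (upTo n) (run swap (map suc (sortingSwaps n)) (b ∷ w))
    ≡⟨ cong (run swap (upTo n)) (trans (run-swap-suc (sortingSwaps n) b w) (cong (b ∷_) (run-sortingSwaps w))) ⟩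
  run swap (upTo n) (b ∷ sorted n (count w))
    ≡⟨ bubble n (count w) b (count-≤ w) ⟩
  sorted (suc n) (count (b ∷ w)) ∎

jumps : ∀ {n} → ℕ → List (Word n) → List (Word n)
jumps i = map (jump i)

run-jumps : ∀ {n} (S : List (Word n)) ts → Sizes S ts →
  run jumps (map suc (sortingSwaps n)) S ≡ map (sorted n) ts
run-jumps {n} S ts p = trans (rowwise (sortingSwaps n) S) (rows p)
  where
  rowwise : ∀ is (S : List (Word n)) → run jumps (map suc is) S ≡ map (run swap is) S
  rowwise []       S = sym (Listₚ.map-id S)
  rowwise (i ∷ is) S = trans (rowwise is (map (swap i) S)) (sym (Listₚ.map-∘ S))
  rows : ∀ {S : List (Word n)} {ts} → Sizes S ts → map (run swap (sortingSwaps n)) S ≡ map (sorted n) ts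
  rows []       = refl
  rows {w ∷ S} (e ∷ p) = cong₂ _∷_ (trans (run-sortingSwaps w) (cong (sorted n) e)) (rows p)

-- The steps of the chain as moves of vectors

labelMove : ∀ {n} → ℕ → Vec ℕ n → Vec ℕ n
labelMove = move ℕ._⊓_ ℕ._⊔_

private
  order : ∀ x y {A : Set} (f : ℕ → ℕ → A) → (if y ℕ.<ᵇ x then f y x else f x y) ≡ f (x ℕ.⊓ y) (x ℕ.⊔ y)
  order x y f = cases (y ℕ.<ᵇ x) refl
    where
    cases : ∀ b → (y ℕ.<ᵇ x) ≡ b → (if b then f y x else f x y) ≡ f (x ℕ.⊓ y) (x ℕ.⊔ y)
    cases true  e = sym (cong₂ f (ℕₚ.m≥n⇒m⊓n≡n y≤x) (ℕₚ.m≥n⇒m⊔n≡m y≤x))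
      where y≤x = ℕₚ.<⇒≤ (ℕₚ.<ᵇ⇒< y x (subst Bool.T (sym e) tt))
    cases false e = sym (cong₂ f (ℕₚ.m≤n⇒m⊓n≡m x≤y) (ℕₚ.m≤n⇒m⊔n≡n x≤y))
      where x≤y = ℕₚ.≮⇒≥ (λ y<x → subst Bool.T e (ℕₚ.<⇒<ᵇ y<x))

  jumpTo : ℕ → ℕ → List ℕ → List ℕ
  jumpTo i j u = if nth u i ℕ.<ᵇ nth u j then setAt (setAt u i (nth u j)) j (nth u i) else u

  step-exchange : ∀ {n} i (v : Vec ℕ n) → suc i < n →
    jumpTo (suc i) i (toList v) ≡ toList (exchange ℕ._⊓_ ℕ._⊔_ i v)
  step-exchange zero    (x ∷ y ∷ v) _       = order x y (λ a b → a ∷ b ∷ toList v)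
  step-exchange zero    (x ∷ [])    (s≤s ())
  step-exchange (suc i) (x ∷ v)     (s≤s i<) = trans
    (sym (Boolₚ.if-float (x ∷_) (nth (toList v) (suc i) ℕ.<ᵇ nth (toList v) i)))
    (cong (x ∷_) (step-exchange i v i<))

  nth-last : ∀ {m} (w : Vec ℕ (suc m)) → nth (toList w) m ≡ Vec.last w
  nth-last (x ∷ [])    = refl
  nth-last (x ∷ y ∷ w) = nth-last (y ∷ w)

  setAt-last : ∀ {m} (w : Vec ℕ (suc m)) a → setAt (toList w) m a ≡ toList (Vec.init w Vec.∷ʳ a)
  setAt-last (x ∷ [])    a = refl
  setAt-last (x ∷ y ∷ w) a = cong (x ∷_) (setAt-last (y ∷ w) a)

step-labelMove : ∀ {n} i (v : Vec ℕ n) → i < n → step n i (toList v) ≡ toList (labelMove i v)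
step-labelMove (suc i) v                  i<n = step-exchange i v i<n
-- On a ring of one site the particle is its own left neighbour, and both branches return the same
-- word.
step-labelMove zero    (x ∷ [])           i<n = Boolₚ.if-eta (x ℕ.<ᵇ x)
step-labelMove {suc (suc m)} zero (x ∷ w) i<n = begin
  jumpTo 0 (suc m) (x ∷ toList w)
    ≡⟨ cong (λ b → if x ℕ.<ᵇ b then b ∷ setAt (toList w) m x else x ∷ toList w) (nth-last w) ⟩
  (if x ℕ.<ᵇ Vec.last w then Vec.last w ∷ setAt (toList w) m x else x ∷ toList w)
    ≡⟨ cong₂ (λ l l′ → if x ℕ.<ᵇ Vec.last w then Vec.last w ∷ l else x ∷ l′)
             (setAt-last w x) (cong toList (sym (init∷ʳlast w))) ⟩
  (if x ℕ.<ᵇ Vec.last w then Vec.last w ∷ toList (Vec.init w Vec.∷ʳ x) else x ∷ toList (Vec.init w Vec.∷ʳ Vec.last w))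
    ≡⟨ order (Vec.last w) x (λ a b → b ∷ toList (Vec.init w Vec.∷ʳ a)) ⟩
  toList (labelMove zero (x ∷ w)) ∎

exchange-↭ : ∀ {n} i (v : Vec ℕ n) → toList (exchange ℕ._⊓_ ℕ._⊔_ i v) ↭ toList v
exchange-↭ zero    []          = ↭-refl
exchange-↭ zero    (x ∷ [])    = ↭-refl
exchange-↭ zero    (x ∷ y ∷ v) with ℕₚ.≤-total x y
... | inj₁ x≤y = ↭-reflexive (cong₂ (λ a b → a ∷ b ∷ toList v) (ℕₚ.m≤n⇒m⊓n≡m x≤y) (ℕₚ.m≤n⇒m⊔n≡n x≤y))
... | inj₂ y≤x = ↭-trans (↭-reflexive (cong₂ (λ a b → a ∷ b ∷ toList v) (ℕₚ.m≥n⇒m⊓n≡n y≤x) (ℕₚ.m≥n⇒m⊔n≡m y≤x)))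
                       (↭-swap y x ↭-refl)
exchange-↭ (suc i) []          = ↭-refl
exchange-↭ (suc i) (x ∷ v)     = ↭-prep x (exchange-↭ i v)

rotate-↭ : ∀ {n} (v : Vec ℕ n) → toList (rotate v) ↭ toList v
rotate-↭ []      = ↭-refl
rotate-↭ (x ∷ v) = ↭-trans (↭-reflexive (Vecₚ.toList-∷ʳ x v)) (↭ₚ.++-comm (toList v) (x ∷ []))

labelMove-↭ : ∀ {n} i (v : Vec ℕ n) → toList (labelMove i v) ↭ toList v
labelMove-↭ (suc i) v = exchange-↭ i v
labelMove-↭ zero    v = ↭-trans (rotate-↭ _) (↭-trans (exchange-↭ zero (rotate⁻¹ v))
  (↭-trans (↭-sym (rotate-↭ (rotate⁻¹ v))) (↭-reflexive (cong toList (rotate-rotate⁻¹ v)))))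

-- Thresholds commute with the moves

module _ {A B : Set} (f : A → B) where

  map-rotate : ∀ {n} (v : Vec A n) → Vec.map f (rotate v) ≡ rotate (Vec.map f v)
  map-rotate []      = refl
  map-rotate (x ∷ v) = Vecₚ.map-∷ʳ f x v

  map-rotate⁻¹ : ∀ {n} (v : Vec A n) → Vec.map f (rotate⁻¹ v) ≡ rotate⁻¹ (Vec.map f v)
  map-rotate⁻¹ v = begin
    Vec.map f (rotate⁻¹ v)                      ≡⟨ sym (rotate⁻¹-rotate (Vec.map f (rotate⁻¹ v))) ⟩
    rotate⁻¹ (rotate (Vec.map f (rotate⁻¹ v)))  ≡⟨ cong rotate⁻¹ (sym (map-rotate (rotate⁻¹ v))) ⟩
    rotate⁻¹ (Vec.map f (rotate (rotate⁻¹ v)))  ≡⟨ cong (rotate⁻¹ ∘ Vec.map f) (rotate-rotate⁻¹ v) ⟩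
    rotate⁻¹ (Vec.map f v)                      ∎

  module _ {lo hi : A → A → A} {lo′ hi′ : B → B → B}
           (lo-hom : ∀ x y → f (lo x y) ≡ lo′ (f x) (f y)) (hi-hom : ∀ x y → f (hi x y) ≡ hi′ (f x) (f y)) where

    map-exchange : ∀ {n} i (v : Vec A n) → Vec.map f (exchange lo hi i v) ≡ exchange lo′ hi′ i (Vec.map f v)
    map-exchange zero    []          = refl
    map-exchange zero    (x ∷ [])    = refl
    map-exchange zero    (x ∷ y ∷ v) = cong₂ (λ a b → a ∷ b ∷ Vec.map f v) (lo-hom x y) (hi-hom x y)
    map-exchange (suc i) []          = refl
    map-exchange (suc i) (x ∷ v)     = cong (f x ∷_) (map-exchange i v)

    map-move : ∀ {n} i (v : Vec A n) → Vec.map f (move lo hi i v) ≡ move lo′ hi′ i (Vec.map f v)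
    map-move (suc i) v = map-exchange i v
    map-move zero    v = trans (map-rotate (exchange lo hi zero (rotate⁻¹ v))) (cong rotate
      (trans (map-exchange zero (rotate⁻¹ v)) (cong (exchange lo′ hi′ zero) (map-rotate⁻¹ v))))

-- The map reverses the order, so it takes minimum to `_∨_` and maximum to `_∧_`. This is why one
-- step of the chain is one simultaneous jump of all threshold words.
below : ℕ → ℕ → Bool
below t x = does (x ℕ.≤? t)

below-mono : ∀ t {x y} → x ≤ y → below t x ∨ below t y ≡ below t x × below t x ∧ below t y ≡ below t y
below-mono t {x} {y} x≤y = compare (x ℕ.≤? t) (y ℕ.≤? t)
  where
  compare : (p : Dec (x ≤ t)) (q : Dec (y ≤ t)) → does p ∨ does q ≡ does p × does p ∧ does q ≡ does q
  compare (yes _)   (yes _)   = refl , refl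
  compare (yes _)   (no _)    = refl , refl
  compare (no x≰t)  (yes y≤t) = ⊥-elim (x≰t (ℕₚ.≤-trans x≤y y≤t))
  compare (no _)    (no _)    = refl , refl

below-⊓ : ∀ t x y → below t (x ℕ.⊓ y) ≡ below t x ∨ below t y
below-⊓ t x y with ℕₚ.≤-total x y
... | inj₁ x≤y = trans (cong (below t) (ℕₚ.m≤n⇒m⊓n≡m x≤y)) (sym (proj₁ (below-mono t x≤y)))
... | inj₂ y≤x = trans (cong (below t) (ℕₚ.m≥n⇒m⊓n≡n y≤x))
  (sym (trans (Boolₚ.∨-comm (below t x) (below t y)) (proj₁ (below-mono t y≤x))))

below-⊔ : ∀ t x y → below t (x ℕ.⊔ y) ≡ below t x ∧ below t y
below-⊔ t x y with ℕₚ.≤-total x y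
... | inj₁ x≤y = trans (cong (below t) (ℕₚ.m≤n⇒m⊔n≡n x≤y)) (sym (proj₂ (below-mono t x≤y)))
... | inj₂ y≤x = trans (cong (below t) (ℕₚ.m≥n⇒m⊔n≡m y≤x))
  (sym (trans (Boolₚ.∧-comm (below t x) (below t y)) (proj₂ (below-mono t y≤x))))

-- The states

insertAll-↭ : ∀ x ys → All (_↭ x ∷ ys) (insertAll x ys)
insertAll-↭ x []       = ↭-refl ∷ []
insertAll-↭ x (y ∷ ys) = ↭-refl ∷ Allₚ.map⁺ (All.map (λ p → ↭-trans (↭-prep y p) (↭-swap y x ↭-refl)) (insertAll-↭ x ys))

perms-↭ : ∀ xs → All (_↭ xs) (perms xs)
perms-↭ []       = ↭-refl ∷ []
perms-↭ (x ∷ xs) = Allₚ.concat⁺ (Allₚ.map⁺ (All.map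
  (λ {ys} p → All.map (λ q → ↭-trans q (↭-prep x p)) (insertAll-↭ x ys)) (perms-↭ xs)))

∈-insertAll : ∀ x ps qs → ps ++ x ∷ qs ∈ insertAll x (ps ++ qs)
∈-insertAll x []       []       = here refl
∈-insertAll x []       (q ∷ qs) = here refl
∈-insertAll x (p ∷ ps) qs       = there (∈-map⁺ (p ∷_) (∈-insertAll x ps qs))

↭⇒∈perms : ∀ {u} xs → u ↭ xs → u ∈ perms xs
↭⇒∈perms []       p = here (↭ₚ.↭-empty-inv p)
↭⇒∈perms (x ∷ xs) p with ∈-∃++ (↭ₚ.∈-resp-↭ (↭-sym p) (here refl))
... | ps , qs , refl = ∈-concatMap⁺ (insertAll x)
  (lose (↭⇒∈perms xs (↭ₚ.drop-mid ps [] p)) (∈-insertAll x ps qs))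

insertAll-unique : ∀ x ys → All (x ≢_) ys → Unique (insertAll x ys)
insertAll-unique x []       []          = [] ∷ []
insertAll-unique x (y ∷ ys) (x≢y ∷ x≢s) =
  Allₚ.map⁺ (All.universal (λ _ e → x≢y (Listₚ.∷-injectiveˡ e)) (insertAll x ys)) ∷
  Uniqueₚ.map⁺ Listₚ.∷-injectiveʳ (insertAll-unique x ys x≢s)

-- Deleting `x` recovers `ys`, so insertions into different lists never coincide; this is what keeps
-- `perms` free of repetitions.
insertAll-remove : ∀ x ys → All (x ≢_) ys → All (λ w → filter (λ y → ¬? (x ℕ.≟ y)) w ≡ ys) (insertAll x ys)
insertAll-remove x []       []            = Listₚ.filter-reject (λ y → ¬? (x ℕ.≟ y)) (λ x≢x → x≢x refl) ∷ []
insertAll-remove x (y ∷ ys) fresh@(x≢y ∷ x≢s) =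
  trans (Listₚ.filter-reject (λ z → ¬? (x ℕ.≟ z)) (λ x≢x → x≢x refl)) (Listₚ.filter-all (λ z → ¬? (x ℕ.≟ z)) fresh) ∷
  Allₚ.map⁺ (All.map (λ e → trans (Listₚ.filter-accept (λ z → ¬? (x ℕ.≟ z)) x≢y) (cong (y ∷_) e)) (insertAll-remove x ys x≢s))

perms-unique : ∀ xs → Unique xs → Unique (perms xs)
perms-unique []       _              = [] ∷ []
perms-unique (x ∷ xs) (x≢s ∷ unique) = Uniqueₚ.concat⁺
  (Allₚ.map⁺ (All.map (λ {ys} → insertAll-unique x ys) fresh)) (disjoint (perms xs) fresh (perms-unique xs unique))
  where
  fresh : All (All (x ≢_)) (perms xs)
  fresh = All.map (λ p → ↭ₚ.All-resp-↭ (↭-sym p) x≢s) (perms-↭ xs)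
  disjoint : ∀ yss → All (All (x ≢_)) yss → Unique yss → AllPairs Disjoint (map (insertAll x) yss)
  disjoint []         []       []          = []
  disjoint (ys ∷ yss) (f ∷ fs) (ys≢ ∷ u) =
    apart yss ys≢ fs ∷ disjoint yss fs u
    where
    apart : ∀ zss → All (ys ≢_) zss → All (All (x ≢_)) zss → All (Disjoint (insertAll x ys)) (map (insertAll x) zss)
    apart []         []              []        = []
    apart (zs ∷ zss) (ys≢zs ∷ ys≢) (f′ ∷ fs) =
      (λ (w∈ys , w∈zs) → ys≢zs
        (trans (sym (All.lookup (insertAll-remove x ys f) w∈ys)) (All.lookup (insertAll-remove x zs f′) w∈zs)))
      ∷ apart zss ys≢ fs

states-unique : ∀ N → Unique (states N)
states-unique N = perms-unique (range N) (Uniqueₚ.map⁺ ℕₚ.suc-injective (Uniqueₚ.upTo⁺ N))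

-- Padding by 0 and truncation only make the map total; a state has length N.
toVec : ∀ n → List ℕ → Vec ℕ n
toVec zero    u       = []
toVec (suc n) []      = 0 ∷ toVec n []
toVec (suc n) (x ∷ u) = x ∷ toVec n u

toVec-toList : ∀ {n} (v : Vec ℕ n) → toVec n (toList v) ≡ v
toVec-toList []      = refl
toVec-toList (x ∷ v) = cong (x ∷_) (toVec-toList v)

toList-toVec : ∀ u → toList (toVec (length u) u) ≡ u
toList-toVec []      = refl
toList-toVec (x ∷ u) = cong (x ∷_) (toList-toVec u)

module _ (N : ℕ) where

  state-↭ : ∀ {u} → u ∈ states N → u ↭ range N
  state-↭ = All.lookup (perms-↭ (range N))

  state-toVec : ∀ {u} → u ∈ states N → toList (toVec N u) ≡ u
  state-toVec {u} u∈ = subst (λ n → toList (toVec n u) ≡ u) length-u (toList-toVec u)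
    where length-u : length u ≡ N
          length-u = trans (↭ₚ.↭-length (state-↭ u∈)) (trans (Listₚ.length-map suc (upTo N)) (Listₚ.length-upTo N))

  state-step : ∀ {u} i → u ∈ states N → i < N → step N i u ≡ toList (labelMove i (toVec N u))
  state-step {u} i u∈ i<N = trans (cong (step N i) (sym (state-toVec u∈))) (step-labelMove i (toVec N u) i<N)

  step∈states : ∀ {u} i → u ∈ states N → i < N → step N i u ∈ states N
  step∈states {u} i u∈ i<N = ↭⇒∈perms (range N) (↭-trans (↭-reflexive (state-step i u∈ i<N))
    (↭-trans (labelMove-↭ i (toVec N u)) (↭-trans (↭-reflexive (state-toVec u∈)) (state-↭ u∈))))

count-below : ∀ t {n} (v : Vec ℕ n) → count (Vec.map (below t) v) ≡ length (filter (ℕ._≤? t) (toList v))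
count-below t []      = refl
count-below t (x ∷ v) with x ℕ.≤ᵇ t
... | true  = cong suc (count-below t v)
... | false = count-below t v

below-range : ∀ t a n (f : ℕ → ℕ) → (∀ i → f i ≡ a ℕ.+ i) →
  length (filter (ℕ._≤? t) (map suc (applyUpTo f n))) ≡ (t ℕ.∸ a) ℕ.⊓ n
below-range t a zero    f f≡ = sym (ℕₚ.⊓-zeroʳ (t ℕ.∸ a))
below-range t a (suc n) f f≡ = first (suc (f 0) ℕ.≤? t)
  where
  rest = filter (ℕ._≤? t) (map suc (applyUpTo (f ∘ suc) n))
  rest≡ : length rest ≡ (t ℕ.∸ suc a) ℕ.⊓ n
  rest≡ = below-range t (suc a) n (f ∘ suc) (λ i → trans (f≡ (suc i)) (ℕₚ.+-suc a i))
  f0≡a : f 0 ≡ a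
  f0≡a = trans (f≡ 0) (ℕₚ.+-identityʳ a)
  first : Dec (suc (f 0) ≤ t) → length (filter (ℕ._≤? t) (map suc (applyUpTo f (suc n)))) ≡ (t ℕ.∸ a) ℕ.⊓ suc n
  first (yes le) = trans (cong length (Listₚ.filter-accept (ℕ._≤? t) le))
    (trans (cong suc rest≡) (cong (ℕ._⊓ suc n) (sym (ℕₚ.+-∸-assoc 1 (subst (_< t) f0≡a le)))))
  first (no ≰)   = trans (cong length (Listₚ.filter-reject (ℕ._≤? t) ≰))
    (trans rest≡ (trans (cong (ℕ._⊓ n) (ℕₚ.m≤n⇒m∸n≡0 (ℕₚ.m≤n⇒m≤1+n t≤a))) (cong (ℕ._⊓ suc n) (sym (ℕₚ.m≤n⇒m∸n≡0 t≤a)))))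
    where t≤a : t ≤ a
          t≤a = subst (t ≤_) f0≡a (ℕ.s≤s⁻¹ (ℕₚ.≰⇒> ≰))

thresholds : ∀ N → List ℕ → List ℕ → List (Word N)
thresholds N ts u = map (λ t → Vec.map (below t) (toVec N u)) ts

module _ (N : ℕ) where

  count-threshold : ∀ {u} t → u ∈ states N → t ≤ N → count (Vec.map (below t) (toVec N u)) ≡ t
  count-threshold {u} t u∈ t≤N = begin
    count (Vec.map (below t) (toVec N u))        ≡⟨ count-below t (toVec N u) ⟩
    length (filter (ℕ._≤? t) (toList (toVec N u))) ≡⟨ cong (length ∘ filter (ℕ._≤? t)) (state-toVec N u∈) ⟩
    length (filter (ℕ._≤? t) u)                  ≡⟨ ↭ₚ.↭-length (↭ₚ.filter-↭ (ℕ._≤? t) (state-↭ N u∈)) ⟩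
    length (filter (ℕ._≤? t) (range N))          ≡⟨ below-range t 0 N id (λ _ → refl) ⟩
    t ℕ.⊓ N                                      ≡⟨ ℕₚ.m≤n⇒m⊓n≡m t≤N ⟩
    t                                            ∎

  thresholds-sizes : ∀ {u} ts → u ∈ states N → All (_≤ N) ts → Sizes (thresholds N ts u) ts
  thresholds-sizes []       u∈ []         = []
  thresholds-sizes (t ∷ ts) u∈ (t≤N ∷ ps) = count-threshold t u∈ t≤N ∷ thresholds-sizes ts u∈ ps

  thresholds-step : ∀ {u} ts i → u ∈ states N → i < N → thresholds N ts (step N i u) ≡ jumps i (thresholds N ts u)
  thresholds-step {u} ts i u∈ i<N = trans (Listₚ.map-cong row ts) (Listₚ.map-∘ ts)
    where
    row : ∀ t → Vec.map (below t) (toVec N (step N i u)) ≡ jump i (Vec.map (below t) (toVec N u))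
    row t = trans (cong (Vec.map (below t)) (trans (cong (toVec N) (state-step N i u∈ i<N)) (toVec-toList (labelMove i (toVec N u)))))
                  (map-move (below t) (below-⊓ t) (below-⊔ t) i (toVec N u))

-- Expectations

fromℕ-/ : ∀ m n .{{_ : NonZero n}} → (+ m / n) * fromℕ n ≡ fromℕ m
fromℕ-/ m (suc k) = ℚₚ.toℚᵘ-injective (ℚᵘₚ.≃-trans (ℚₚ.toℚᵘ-homo-* (+ m / suc k) (fromℕ (suc k)))
  (ℚᵘₚ.≃-trans (ℚᵘₚ.*-cong (ℚₚ.toℚᵘ-fromℚᵘ (ℚᵘ.mkℚᵘ (+ m) k)) (ℚₚ.toℚᵘ-fromℚᵘ (ℚᵘ.mkℚᵘ (+ suc k) 0)))
  (ℚᵘₚ.≃-trans (ℚᵘ.*≡* cross) (ℚᵘₚ.≃-sym (ℚₚ.toℚᵘ-fromℚᵘ (ℚᵘ.mkℚᵘ (+ m) 0))))))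
  where
  cross : (+ m ℤ.* + suc k) ℤ.* + 1 ≡ + m ℤ.* + suc (k ℕ.* 1)
  cross = trans (ℤₚ.*-identityʳ (+ m ℤ.* + suc k)) (cong (λ j → + m ℤ.* + suc j) (sym (ℕₚ.*-identityʳ k)))

fromℕ-length-filter : ∀ {A : Set} {P : A → Set} (P? : ∀ x → Dec (P x)) xs →
  fromℕ (length (filter P? xs)) ≡ ∑ xs (λ x → 𝟙 (P? x))
fromℕ-length-filter P? []       = refl
fromℕ-length-filter P? (x ∷ xs) with P? x
... | yes _ = trans (fromℕ-+ 1 (length (filter P? xs))) (cong (1ℚ ℚ.+_) (fromℕ-length-filter P? xs))
... | no  _ = trans (fromℕ-length-filter P? xs) (sym (ℚₚ.+-identityˡ _))

∑-const : ∀ {A : Set} (xs : List A) c → ∑ xs (λ _ → c) ≡ fromℕ (length xs) * c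
∑-const []       c = sym (ℚₚ.*-zeroˡ c)
∑-const (x ∷ xs) c = trans (cong (c ℚ.+_) (∑-const xs c)) (trans (lem c (fromℕ (length xs)))
  (cong (_* c) (sym (fromℕ-+ 1 (length xs)))))
  where lem : ∀ c n → c + n * c ≡ (1ℚ + n) * c
        lem = solve-∀ ℚ-ring

_≟ˡ_ : (u v : List ℕ) → Dec (u ≡ v)
_≟ˡ_ = Listₚ.≡-dec ℕ._≟_

∑-unique : ∀ {w xs} → Unique xs → w ∈ xs → ∀ (f : List ℕ → ℚ) → ∑ xs (λ v → 𝟙 (w ≟ˡ v) * f v) ≡ f w
∑-unique {w} {x ∷ xs} (x≢s ∷ u) (here refl) f = trans (cong₂ (λ a b → a * f w + b) (𝟙-yes (w ≟ˡ w) refl)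
  (trans (∑-cong-All (All.map (λ {v} w≢v → trans (cong (_* f v) (𝟙-no (w ≟ˡ v) w≢v)) (ℚₚ.*-zeroˡ (f v))) x≢s)) (∑-zero xs)))
  (lem (f w))
  where lem : ∀ a → 1ℚ * a + 0ℚ ≡ a
        lem = solve-∀ ℚ-ring
∑-unique {w} {x ∷ xs} (x≢s ∷ u) (there w∈) f = trans (cong₂ (λ a b → a * f x + b)
  (𝟙-no (w ≟ˡ x) (λ w≡x → All.lookup x≢s w∈ (sym w≡x))) (∑-unique u w∈ f)) (lem (f x) (f w))
  where lem : ∀ a b → 0ℚ * a + b ≡ b
        lem = solve-∀ ℚ-ring

sumℚ-map : ∀ {A : Set} (f : A → ℚ) xs → sumℚ (map f xs) ≡ ∑ xs f
sumℚ-map f []       = refl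
sumℚ-map f (x ∷ xs) = cong (f x ℚ.+_) (sumℚ-map f xs)

module _ (N : ℕ) .{{_ : NonZero N}} (π : List ℕ → ℚ) (stationary : Stationary N π) where

  open Stationary stationary

  expect : (List ℕ → ℚ) → ℚ
  expect f = ∑ (states N) (λ u → π u * f u)

  expect-1 : expect (λ _ → 1ℚ) ≡ 1ℚ
  expect-1 = trans (∑-cong (states N) (λ u → ℚₚ.*-identityʳ (π u))) (trans (sym (sumℚ-map π (states N))) total)

  -- The balance equations tested against `f` and multiplied by N. `moves N u v` counts the sites
  -- whose jump leads from u to v, and the target of each jump occurs exactly once in the list of
  -- states.
  expect-step : ∀ f → ∑ (upTo N) (λ i → expect (f ∘ step N i)) ≡ ∑ (upTo N) (λ _ → expect f)
  expect-step f = sym (begin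
    ∑ (upTo N) (λ _ → expect f)
      ≡⟨ trans (∑-const (upTo N) (expect f)) (cong (λ n → fromℕ n * expect f) (Listₚ.length-upTo N)) ⟩
    fromℕ N * expect f
      ≡⟨ sym (∑-scale (fromℕ N) (λ v → π v * f v) (states N)) ⟩
    ∑ (states N) (λ v → fromℕ N * (π v * f v))
      ≡⟨ ∑-cong-All (All.tabulate (λ {v} v∈ → incoming v v∈)) ⟩
    ∑ (states N) (λ v → ∑ (states N) (λ u → π u * (M u v * f v)))
      ≡⟨ ∑-swap (λ v u → π u * (M u v * f v)) (states N) (states N) ⟩
    ∑ (states N) (λ u → ∑ (states N) (λ v → π u * (M u v * f v)))
      ≡⟨ ∑-cong-All (All.tabulate (λ {u} u∈ → outgoing u u∈)) ⟩
    ∑ (states N) (λ u → ∑ (upTo N) (λ i → π u * f (step N i u)))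
      ≡⟨ ∑-swap (λ u i → π u * f (step N i u)) (states N) (upTo N) ⟩
    ∑ (upTo N) (λ i → expect (f ∘ step N i)) ∎)
    where
    M : List ℕ → List ℕ → ℚ
    M u v = ∑ (upTo N) (λ i → 𝟙 (step N i u ≟ˡ v))
    incoming : ∀ v → v ∈ states N → fromℕ N * (π v * f v) ≡ ∑ (states N) (λ u → π u * (M u v * f v))
    incoming v v∈ = begin
      fromℕ N * (π v * f v)
        ≡⟨ cong (λ z → fromℕ N * (z * f v)) (trans (balance v v∈) (sumℚ-map (λ u → π u * P N u v) (states N))) ⟩
      fromℕ N * (∑ (states N) (λ u → π u * P N u v) * f v)
        ≡⟨ lem₁ (fromℕ N) (∑ (states N) (λ u → π u * P N u v)) (f v) ⟩
      (fromℕ N * f v) * ∑ (states N) (λ u → π u * P N u v)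
        ≡⟨ sym (∑-scale (fromℕ N * f v) (λ u → π u * P N u v) (states N)) ⟩
      ∑ (states N) (λ u → (fromℕ N * f v) * (π u * P N u v))
        ≡⟨ ∑-cong (states N) (λ u → trans (lem₂ (fromℕ N) (f v) (π u) (P N u v))
             (cong (λ z → π u * (z * f v)) (trans (fromℕ-/ (moves N u v) N)
               (fromℕ-length-filter (λ i → step N i u ≟ˡ v) (upTo N))))) ⟩
      ∑ (states N) (λ u → π u * (M u v * f v)) ∎
      where
      lem₁ : ∀ n p x → n * (p * x) ≡ (n * x) * p
      lem₁ = solve-∀ ℚ-ring
      lem₂ : ∀ n x p q → (n * x) * (p * q) ≡ p * ((q * n) * x)
      lem₂ = solve-∀ ℚ-ring
    outgoing : ∀ u → u ∈ states N →
      ∑ (states N) (λ v → π u * (M u v * f v)) ≡ ∑ (upTo N) (λ i → π u * f (step N i u))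
    outgoing u u∈ = begin
      ∑ (states N) (λ v → π u * (M u v * f v))
        ≡⟨ ∑-scale (π u) (λ v → M u v * f v) (states N) ⟩
      π u * ∑ (states N) (λ v → M u v * f v)
        ≡⟨ cong (π u *_) (trans (∑-cong (states N) distribute)
             (∑-swap (λ v i → 𝟙 (step N i u ≟ˡ v) * f v) (states N) (upTo N))) ⟩
      π u * ∑ (upTo N) (λ i → ∑ (states N) (λ v → 𝟙 (step N i u ≟ˡ v) * f v))
        ≡⟨ cong (π u *_) (∑-cong-All (All.map (λ {i} i<N → ∑-unique (states-unique N) (step∈states N i u∈ i<N) f)
             (Allₚ.applyUpTo⁺₁ id N id))) ⟩
      π u * ∑ (upTo N) (λ i → f (step N i u))
        ≡⟨ sym (∑-scale (π u) (λ i → f (step N i u)) (upTo N)) ⟩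
      ∑ (upTo N) (λ i → π u * f (step N i u)) ∎
      where
      distribute : ∀ v → M u v * f v ≡ ∑ (upTo N) (λ i → 𝟙 (step N i u ≟ˡ v) * f v)
      distribute v = trans (ℚₚ.*-comm (M u v) (f v)) (trans (sym (∑-scale (f v) (λ i → 𝟙 (step N i u ≟ˡ v)) (upTo N)))
        (∑-cong (upTo N) (λ i → ℚₚ.*-comm (f v) (𝟙 (step N i u ≟ˡ v)))))

  -- The signed list `L` represents the difference of the two functionals. The factor κ is the
  -- number of multiline queues, so the total weight of `L` is 0. Both parts are invariant under a
  -- random jump and have the same sizes, so the sorting network synchronises all of `L`, and
  -- `stationary-zero` applies.
  expect-thresholds : ∀ ts → StrictlyDescending ts → All (_≤ N) ts → ∀ φ → Bounded φ →
    ∏ ts (λ t → fromℕ (N C t)) * expect (φ ∘ thresholds N ts) ≡ ∑ (mlqs N ts) φ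
  expect-thresholds ts s ts≤N φ bounded = begin
    κ * expect (φ ∘ thresholds N ts)
      ≡⟨ lem₁ (κ * expect (φ ∘ thresholds N ts)) (∑ (mlqs N ts) φ) ⟩
    (κ * expect (φ ∘ thresholds N ts) + - 1ℚ * ∑ (mlqs N ts) φ) + ∑ (mlqs N ts) φ
      ≡⟨ cong (_+ ∑ (mlqs N ts) φ) (trans (sym (weigh-L φ)) (stationary-zero L (Listₚ.≡-dec _≟ʷ_) jumps N stationary-L
           (map suc (sortingSwaps N)) (map (sorted N) ts) (Allₚ.map⁺ (sortingSwaps-< N)) synchronised total-L φ bounded)) ⟩
    0ℚ + ∑ (mlqs N ts) φ
      ≡⟨ ℚₚ.+-identityˡ (∑ (mlqs N ts) φ) ⟩
    ∑ (mlqs N ts) φ ∎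
    where
    lem₁ : ∀ a b → a ≡ (a + - 1ℚ * b) + b
    lem₁ = solve-∀ ℚ-ring
    κ = ∏ ts (λ t → fromℕ (N C t))
    L : List (ℚ × List (Word N))
    L = map (λ u → κ * π u , thresholds N ts u) (states N) ++ map (λ S → - 1ℚ , S) (mlqs N ts)
    weigh-L : ∀ φ → weigh L φ ≡ κ * expect (φ ∘ thresholds N ts) + - 1ℚ * ∑ (mlqs N ts) φ
    weigh-L φ = trans (∑-++ (λ (c , x) → c * φ x) (map (λ u → κ * π u , thresholds N ts u) (states N)) _) (cong₂ _+_
      (trans (∑-map (λ u → κ * π u , thresholds N ts u) (λ (c , x) → c * φ x) (states N))
        (trans (∑-cong (states N) (λ u → ℚₚ.*-assoc κ (π u) (φ (thresholds N ts u))))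
               (∑-scale κ (λ u → π u * φ (thresholds N ts u)) (states N))))
      (trans (∑-map (λ S → - 1ℚ , S) (λ (c , x) → c * φ x) (mlqs N ts)) (∑-scale (- 1ℚ) φ (mlqs N ts))))
    total-L : weigh L (λ _ → 1ℚ) ≡ 0ℚ
    total-L = trans (weigh-L (λ _ → 1ℚ)) (trans (cong₂ (λ a b → κ * a + - 1ℚ * b) expect-1 (∑-mlqs-1 N ts)) (lem κ))
      where lem : ∀ a → a * 1ℚ + - 1ℚ * a ≡ 0ℚ
            lem = solve-∀ ℚ-ring
    synchronised : All (λ cx → run jumps (map suc (sortingSwaps N)) (proj₂ cx) ≡ map (sorted N) ts) L
    synchronised = Allₚ.++⁺
      (Allₚ.map⁺ (All.tabulate (λ {u} u∈ → run-jumps (thresholds N ts u) ts (thresholds-sizes N ts u∈ ts≤N))))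
      (Allₚ.map⁺ (All.map (λ {S} p → run-jumps S ts p) (mlqs-sizes N ts s)))
    stationary-L : ∀ φ → ∑ (upTo N) (λ i → weigh L (φ ∘ jumps i)) ≡ ∑ (upTo N) (λ _ → weigh L φ)
    stationary-L φ = begin
      ∑ (upTo N) (λ i → weigh L (φ ∘ jumps i))
        ≡⟨ ∑-cong-All (All.map (λ {i} i<N → trans (weigh-L (φ ∘ jumps i)) (cong (λ z → κ * z + - 1ℚ * ∑ (mlqs N ts) (φ ∘ jumps i))
             (∑-cong-All (All.tabulate (λ {u} u∈ → cong (λ S → π u * φ S) (sym (thresholds-step N ts i u∈ i<N)))))))
             (Allₚ.applyUpTo⁺₁ id N id)) ⟩
      ∑ (upTo N) (λ i → κ * E i + - 1ℚ * ∑ (mlqs N ts) (φ ∘ jumps i))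
        ≡⟨ split E (λ i → ∑ (mlqs N ts) (φ ∘ jumps i)) ⟩
      κ * ∑ (upTo N) E + - 1ℚ * ∑ (upTo N) (λ i → ∑ (mlqs N ts) (φ ∘ jumps i))
        ≡⟨ cong₂ (λ a b → κ * a + - 1ℚ * b) (expect-step (φ ∘ thresholds N ts)) (mlqs-stationary N ts s φ) ⟩
      κ * ∑ (upTo N) (λ _ → expect (φ ∘ thresholds N ts)) + - 1ℚ * ∑ (upTo N) (λ _ → ∑ (mlqs N ts) φ)
        ≡⟨ sym (split (λ _ → expect (φ ∘ thresholds N ts)) (λ _ → ∑ (mlqs N ts) φ)) ⟩
      ∑ (upTo N) (λ _ → κ * expect (φ ∘ thresholds N ts) + - 1ℚ * ∑ (mlqs N ts) φ)
        ≡⟨ ∑-cong (upTo N) (λ _ → sym (weigh-L φ)) ⟩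
      ∑ (upTo N) (λ _ → weigh L φ) ∎
      where
      E : ℕ → ℚ
      E i = expect (φ ∘ thresholds N ts ∘ step N i)
      split : ∀ (f g : ℕ → ℚ) → ∑ (upTo N) (λ i → κ * f i + - 1ℚ * g i) ≡ κ * ∑ (upTo N) f + - 1ℚ * ∑ (upTo N) g
      split f g = trans (∑-linear (- 1ℚ) (λ i → κ * f i) g (upTo N)) (cong (_+ - 1ℚ * ∑ (upTo N) g) (∑-scale κ f (upTo N)))

-- Inclusion and exclusion over thresholds

-- The indicator of t₁ ≥ u₁ > t₂ ≥ u₂ > ⋯ for weakly descending t.
interlace : List ℕ → List ℕ → ℚ
interlace []       u       = 1ℚ
interlace (t ∷ ts) []      = 0ℚ
interlace (t ∷ ts) (x ∷ u) = 𝟙 (x ℕ.≤? t) * (𝟙 (All.all? (ℕ._<? x) ts) * interlace ts u)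

interlace-degenerate : ∀ {ts} → Descending ts → ¬ StrictlyDescending ts → ∀ u → interlace ts u ≡ 0ℚ
interlace-degenerate []        ¬s u       = ⊥-elim (¬s [])
interlace-degenerate [-]       ¬s u       = ⊥-elim (¬s [-])
interlace-degenerate (_ ∷ _)   ¬s []      = refl
interlace-degenerate {t ∷ t′ ∷ ts} (t≥t′ ∷ d) ¬s (x ∷ u) with ℕₚ.m≤n⇒m<n∨m≡n t≥t′
... | inj₁ t′<t = trans (cong (λ z → 𝟙 (x ℕ.≤? t) * (A * z)) (interlace-degenerate d (λ s → ¬s (t′<t ∷ s)) u)) (lem (𝟙 (x ℕ.≤? t)) A)
  where A = 𝟙 (All.all? (ℕ._<? x) (t′ ∷ ts))
        lem : ∀ a b → a * (b * 0ℚ) ≡ 0ℚ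
        lem = solve-∀ ℚ-ring
... | inj₂ refl = decide (x ℕ.≤? t) (All.all? (ℕ._<? x) (t ∷ ts))
  where
  I = interlace (t ∷ ts) u
  decide : (p : Dec (x ≤ t)) (q : Dec (All (_< x) (t ∷ ts))) → 𝟙 p * (𝟙 q * I) ≡ 0ℚ
  decide (yes x≤t) (yes (t<x ∷ _)) = ⊥-elim (ℕₚ.<⇒≱ t<x x≤t)
  decide (yes _)   (no _)          = trans (ℚₚ.*-identityˡ (0ℚ * I)) (ℚₚ.*-zeroˡ I)
  decide (no _)    q               = ℚₚ.*-zeroˡ (𝟙 q * I)

-- At each position 𝟙(x ≤ d + 1) - 𝟙(x ≤ d) = 𝟙(x = d + 1). Once x equals d + 1, it exceeds all
-- later entries of the strictly descending list, lowered or not, so the strict inequalities of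
-- `interlace` hold. The entries are positive so that each of them can be lowered.
shiftSum-interlace : ∀ {ds} → StrictlyDescending ds → All (1 ≤_) ds → ∀ u →
  shiftSum (- 1ℚ) (λ ts → interlace ts u) ds ≡ 𝟙 (take (length ds) u ≟ˡ ds)
shiftSum-interlace {[]}         s _            u       = refl
shiftSum-interlace {zero ∷ ds}  s (() ∷ _)     u
shiftSum-interlace {suc d ∷ ds} s (_ ∷ 1≤ds)   []      =
  cong₂ (λ a b → a + - 1ℚ * b) (shiftSum-zero (- 1ℚ) ds (λ _ → refl)) (shiftSum-zero (- 1ℚ) ds (λ _ → refl))
shiftSum-interlace {suc d ∷ ds} s (_ ∷ 1≤ds)   (x ∷ u) = begin
  shiftSum (- 1ℚ) (λ ts → 𝟙 (x ℕ.≤? suc d) * h ts) ds + - 1ℚ * shiftSum (- 1ℚ) (λ ts → 𝟙 (x ℕ.≤? d) * h ts) ds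
    ≡⟨ cong₂ (λ a b → a + - 1ℚ * b) (shiftSum-scale (- 1ℚ) (𝟙 (x ℕ.≤? suc d)) h ds) (shiftSum-scale (- 1ℚ) (𝟙 (x ℕ.≤? d)) h ds) ⟩
  𝟙 (x ℕ.≤? suc d) * H + - 1ℚ * (𝟙 (x ℕ.≤? d) * H)
    ≡⟨ compare (x ℕ.≤? suc d) (x ℕ.≤? d) ((x ∷ take (length ds) u) ≟ˡ (suc d ∷ ds)) ⟩
  𝟙 ((x ∷ take (length ds) u) ≟ˡ (suc d ∷ ds)) ∎
  where
  h : List ℕ → ℚ
  h ts = 𝟙 (All.all? (ℕ._<? x) ts) * interlace ts u
  H = shiftSum (- 1ℚ) h ds
  lowered-< : ∀ {ts es} → All (_< suc d) es → Pointwise Lowered ts es → All (_< suc d) ts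
  lowered-< []         []       = []
  lowered-< (e< ∷ es<) (p ∷ ps) = ℕₚ.≤-trans (s≤s (lowered-≤ p)) e< ∷ lowered-< es< ps
  compare : (p : Dec (x ≤ suc d)) (q : Dec (x ≤ d)) (e : Dec (x ∷ take (length ds) u ≡ suc d ∷ ds)) →
            𝟙 p * H + - 1ℚ * (𝟙 q * H) ≡ 𝟙 e
  compare (yes _)   (yes x≤d) e = trans (lem H) (sym (𝟙-no e (λ eq → ℕₚ.<⇒≱ (s≤s x≤d) (ℕₚ.≤-reflexive (sym (Listₚ.∷-injectiveˡ eq))))))
    where lem : ∀ a → 1ℚ * a + - 1ℚ * (1ℚ * a) ≡ 0ℚ
          lem = solve-∀ ℚ-ring
  compare (no x≰)   (yes x≤d) e = ⊥-elim (x≰ (ℕₚ.m≤n⇒m≤1+n x≤d))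
  compare (no x≰)   (no _)    e = trans (lem H) (sym (𝟙-no e (λ eq → x≰ (ℕₚ.≤-reflexive (Listₚ.∷-injectiveˡ eq)))))
    where lem : ∀ a → 0ℚ * a + - 1ℚ * (0ℚ * a) ≡ 0ℚ
          lem = solve-∀ ℚ-ring
  compare (yes x≤)  (no x≰d)  e with ℕₚ.≤-antisym x≤ (ℕₚ.≰⇒> x≰d)
  ... | refl = trans (lem H) (trans (shiftSum-cong (- 1ℚ) ds (λ ts p → trans
          (cong (_* interlace ts u) (𝟙-yes (All.all? (ℕ._<? suc d) ts) (lowered-< (descending-below s) p)))
          (ℚₚ.*-identityˡ (interlace ts u))))
        (trans (shiftSum-interlace (Linked.tail s) 1≤ds u)
               (𝟙-cong (take (length ds) u ≟ˡ ds) e (cong (suc d ∷_)) Listₚ.∷-injectiveʳ)))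
    where lem : ∀ a → 1ℚ * a + - 1ℚ * (0ℚ * a) ≡ a
          lem = solve-∀ ℚ-ring

-- The staircase pattern in the threshold words of a state

module _ {m : ℕ} where

  private
    full : Word m
    full = Vec.replicate m true

    bits : ∀ {n} → Vec ℕ n → ℕ → Word n
    bits v t = Vec.map (below t) v

  final-full : ∀ {n} (w : Word n) → final 0 w (Vec.replicate n true) ≡ 0
  final-full []          = refl
  final-full (false ∷ w) = final-full w
  final-full (true ∷ w)  = final-full w

  staircase-01 : ∀ k z r (S : List (Word (k ℕ.+ m))) → staircase k z r S ≡ 0ℚ ⊎ staircase k z r S ≡ 1ℚ
  staircase-01 k z r []      = inj₂ refl
  staircase-01 k z r (w ∷ S) = product (Vec.take k w ≟ʷ step-word k z ×-dec final 0 (Vec.drop k w) r ℕ.≟ 0) (staircase-01 k (suc z) r S)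
    where
    product : ∀ {P : Set} {a} (p : Dec P) → a ≡ 0ℚ ⊎ a ≡ 1ℚ → 𝟙 p * a ≡ 0ℚ ⊎ 𝟙 p * a ≡ 1ℚ
    product         (yes _) (inj₁ refl) = inj₁ refl
    product         (yes _) (inj₂ refl) = inj₂ refl
    product {a = a} (no _)  _           = inj₁ (ℚₚ.*-zeroˡ a)

  staircase-bounded : ∀ k z r → Bounded (staircase {m} k z r)
  staircase-bounded k z r S with staircase-01 k z r S
  ... | inj₁ e = subst (λ a → - 1ℚ ℚ.≤ a × a ℚ.≤ 1ℚ) (sym e) (from-yes (- 1ℚ ℚ.≤? 0ℚ) , from-yes (0ℚ ℚ.≤? 1ℚ))
  ... | inj₂ e = subst (λ a → - 1ℚ ℚ.≤ a × a ℚ.≤ 1ℚ) (sym e) (from-yes (- 1ℚ ℚ.≤? 1ℚ) , ℚₚ.≤-refl)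

  below-yes : ∀ t x → below t x ≡ true → x ≤ t
  below-yes t x e = decide (x ℕ.≤? t) e
    where decide : (p : Dec (x ≤ t)) → does p ≡ true → x ≤ t
          decide (yes x≤t) _ = x≤t

  below-no : ∀ t x → below t x ≡ false → t < x
  below-no t x e = decide (x ℕ.≤? t) e
    where decide : (p : Dec (x ≤ t)) → does p ≡ false → t < x
          decide (no x≰t) _ = ℕₚ.≰⇒> x≰t

  ≤⇒below : ∀ {t x} → x ≤ t → below t x ≡ true
  ≤⇒below {t} {x} x≤t = dec-true (x ℕ.≤? t) x≤t

  >⇒below : ∀ {t x} → t < x → below t x ≡ false
  >⇒below {t} {x} t<x = dec-false (x ℕ.≤? t) (ℕₚ.<⇒≱ t<x)

  -- A row of positive index has `false` at the first site, which says t < x; without that site the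
  -- index of the row drops by one.
  staircase-suc : ∀ k z x (v : Vec ℕ (k ℕ.+ m)) ts →
    staircase (suc k) (suc z) full (map (bits (x ∷ v)) ts)
      ≡ 𝟙 (All.all? (ℕ._<? x) ts) * staircase k z full (map (bits v) ts)
  staircase-suc k z x v []       = refl
  staircase-suc k z x v (t ∷ ts) = begin
    𝟙 R′ * staircase (suc k) (suc (suc z)) full (map (bits (x ∷ v)) ts)
      ≡⟨ cong₂ _*_ (trans (𝟙-cong R′ (t ℕ.<? x ×-dec R) to fro) (𝟙-× (t ℕ.<? x) R)) (staircase-suc k (suc z) x v ts) ⟩
    (𝟙 (t ℕ.<? x) * 𝟙 R) * (𝟙 As * staircase k (suc z) full (map (bits v) ts))
      ≡⟨ lem (𝟙 (t ℕ.<? x)) (𝟙 R) (𝟙 As) (staircase k (suc z) full (map (bits v) ts)) ⟩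
    (𝟙 (t ℕ.<? x) * 𝟙 As) * (𝟙 R * staircase k (suc z) full (map (bits v) ts))
      ≡⟨ cong (_* staircase k z full (map (bits v) (t ∷ ts))) (trans (sym (𝟙-× (t ℕ.<? x) As))
           (𝟙-cong (t ℕ.<? x ×-dec As) (All.all? (ℕ._<? x) (t ∷ ts)) (λ (p , ps) → p ∷ ps) (λ { (p ∷ ps) → p , ps }))) ⟩
    𝟙 (All.all? (ℕ._<? x) (t ∷ ts)) * staircase k z full (map (bits v) (t ∷ ts)) ∎
    where
    As = All.all? (ℕ._<? x) ts
    R′ = Vec.take (suc k) (bits (x ∷ v) t) ≟ʷ step-word (suc k) (suc z) ×-dec final 0 (Vec.drop (suc k) (bits (x ∷ v) t)) full ℕ.≟ 0
    R  = Vec.take k (bits v t) ≟ʷ step-word k z ×-dec final 0 (Vec.drop k (bits v t)) full ℕ.≟ 0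
    to : Vec.take (suc k) (bits (x ∷ v) t) ≡ step-word (suc k) (suc z) × final 0 (Vec.drop (suc k) (bits (x ∷ v) t)) full ≡ 0 →
         t < x × (Vec.take k (bits v t) ≡ step-word k z × final 0 (Vec.drop k (bits v t)) full ≡ 0)
    to (e , f) = below-no t x (Vecₚ.∷-injectiveˡ e) , (Vecₚ.∷-injectiveʳ e , f)
    fro : t < x × (Vec.take k (bits v t) ≡ step-word k z × final 0 (Vec.drop k (bits v t)) full ≡ 0) →
          Vec.take (suc k) (bits (x ∷ v) t) ≡ step-word (suc k) (suc z) × final 0 (Vec.drop (suc k) (bits (x ∷ v) t)) full ≡ 0
    fro (t<x , (e , f)) = cong₂ _∷_ (>⇒below t<x) e , f
    lem : ∀ a b c d → (a * b) * (c * d) ≡ (a * c) * (b * d)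
    lem = solve-∀ ℚ-ring

  bits-full-mono : ∀ k {t t′} (v : Vec ℕ (k ℕ.+ m)) → t′ ≤ t →
    Vec.take k (bits v t′) ≡ step-word k 0 → Vec.take k (bits v t) ≡ step-word k 0
  bits-full-mono zero            v       t′≤t e = refl
  bits-full-mono (suc k) {t} {t′} (x ∷ v) t′≤t e = cong₂ _∷_
    (≤⇒below (ℕₚ.≤-trans (below-yes t′ x (Vecₚ.∷-injectiveˡ e)) t′≤t)) (bits-full-mono k v t′≤t (Vecₚ.∷-injectiveʳ e))

  -- The first row asks u₁, ..., u_k ≤ t₁. For u₂, ..., u_k this follows from the second row, which
  -- asks them to be at most t₂ ≤ t₁, so u₁ ≤ t₁ is what the first row adds. The service word `full`
  -- serves every word.
  staircase-interlace : ∀ ts (v : Vec ℕ (length ts ℕ.+ m)) → Descending ts →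
    staircase (length ts) 0 full (map (bits v) ts) ≡ interlace ts (toList v)
  staircase-interlace []       v       d = refl
  staircase-interlace (t ∷ ts) (x ∷ v) d = begin
    𝟙 R′ * staircase (suc k) 1 full (map (bits (x ∷ v)) ts)
      ≡⟨ cong₂ _*_ (trans (𝟙-cong R′ (x ℕ.≤? t ×-dec R) to fro) (𝟙-× (x ℕ.≤? t) R)) (staircase-suc k 0 x v ts) ⟩
    (𝟙 (x ℕ.≤? t) * 𝟙 R) * (𝟙 As * St)
      ≡⟨ lem (𝟙 (x ℕ.≤? t)) (𝟙 R) (𝟙 As) St ⟩
    𝟙 (x ℕ.≤? t) * (𝟙 As * (𝟙 R * St))
      ≡⟨ cong (λ z → 𝟙 (x ℕ.≤? t) * (𝟙 As * z)) (trans (redundant ts v d R) (staircase-interlace ts v (Linked.tail d))) ⟩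
    interlace (t ∷ ts) (x ∷ toList v) ∎
    where
    k = length ts
    As = All.all? (ℕ._<? x) ts
    St = staircase k 0 full (map (bits v) ts)
    R′ = Vec.take (suc k) (bits (x ∷ v) t) ≟ʷ step-word (suc k) 0 ×-dec final 0 (Vec.drop (suc k) (bits (x ∷ v) t)) full ℕ.≟ 0
    R  = Vec.take k (bits v t) ≟ʷ step-word k 0
    to : Vec.take (suc k) (bits (x ∷ v) t) ≡ step-word (suc k) 0 × final 0 (Vec.drop (suc k) (bits (x ∷ v) t)) full ≡ 0 →
         x ≤ t × Vec.take k (bits v t) ≡ step-word k 0
    to (e , _) = below-yes t x (Vecₚ.∷-injectiveˡ e) , Vecₚ.∷-injectiveʳ e
    fro : x ≤ t × Vec.take k (bits v t) ≡ step-word k 0 →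
          Vec.take (suc k) (bits (x ∷ v) t) ≡ step-word (suc k) 0 × final 0 (Vec.drop (suc k) (bits (x ∷ v) t)) full ≡ 0
    fro (x≤t , e) = cong₂ _∷_ (≤⇒below x≤t) e , final-full (Vec.drop k (bits v t))
    lem : ∀ a b c d → (a * b) * (c * d) ≡ a * (c * (b * d))
    lem = solve-∀ ℚ-ring
    redundant : ∀ ts (v : Vec ℕ (length ts ℕ.+ m)) → Descending (t ∷ ts) →
      (R : Dec (Vec.take (length ts) (bits v t) ≡ step-word (length ts) 0)) →
      𝟙 R * staircase (length ts) 0 full (map (bits v) ts) ≡ staircase (length ts) 0 full (map (bits v) ts)
    redundant []        v d           R       = trans (ℚₚ.*-identityʳ (𝟙 R)) (𝟙-yes R refl)
    redundant (t′ ∷ ts) v (t′≤t ∷ d)  (yes _) = ℚₚ.*-identityˡ (staircase (length (t′ ∷ ts)) 0 full (map (bits v) (t′ ∷ ts)))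
    redundant (t′ ∷ ts) v (t′≤t ∷ d)  (no ¬e) = trans (ℚₚ.*-zeroˡ (staircase l 0 full (map (bits v) (t′ ∷ ts))))
      (sym (trans (cong (_* staircase l 1 full (map (bits v) ts))
        (𝟙-no (Vec.take l (bits v t′) ≟ʷ step-word l 0 ×-dec final 0 (Vec.drop l (bits v t′)) full ℕ.≟ 0)
              (λ (e , _) → ¬e (bits-full-mono l v t′≤t e))))
        (ℚₚ.*-zeroˡ (staircase l 1 full (map (bits v) ts)))))
      where l = length (t′ ∷ ts)

-- The probability of a prefix as a determinant

binomial-pos : ∀ n t → t ≤ n → 0 < n C t
binomial-pos n       zero    t≤n       = s≤s z≤n
binomial-pos (suc n) (suc t) (s≤s t≤n) = ℕₚ.≤-trans (binomial-pos n t t≤n)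
  (subst (n C t ≤_) (nCk+nC[k+1]≡[n+1]C[k+1] n t) (ℕₚ.m≤m+n (n C t) (n C suc t)))

*-cancelˡ-≡-pos : ∀ r .{{_ : ℚ.Positive r}} {p q} → r * p ≡ r * q → p ≡ q
*-cancelˡ-≡-pos r e = ℚₚ.≤-antisym (ℚₚ.*-cancelˡ-≤-pos r (ℚₚ.≤-reflexive e))
                                   (ℚₚ.*-cancelˡ-≤-pos r (ℚₚ.≤-reflexive (sym e)))

fromℕ-pos : ∀ {n} → 0 < n → ℚ.Positive (fromℕ n)
fromℕ-pos {suc n} _ = ℚₚ.normalize-pos (suc n) 1

binomials-pos : ∀ N ts → All (_≤ N) ts → ℚ.Positive (∏ ts (λ t → fromℕ (N C t)))
binomials-pos N []       []         = _
binomials-pos N (t ∷ ts) (t≤N ∷ ps) = ℚₚ.pos*pos⇒pos (fromℕ (N C t)) {{fromℕ-pos (binomial-pos N t t≤N)}}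
  (∏ ts (λ t → fromℕ (N C t))) {{binomials-pos N ts ps}}

module _ (N : ℕ) .{{_ : NonZero N}} (π : List ℕ → ℚ) (stationary : Stationary N π) where

  E : (List ℕ → ℚ) → ℚ
  E = expect N π stationary

  -- If an entry repeats, the indicator is 0 on every state and the determinant has equal rows.
  -- Otherwise the event is the staircase pattern, whose multiline queues are counted by `pathDet`.
  expect-interlace : ∀ m ts → N ≡ length ts ℕ.+ m → Descending ts → All (_≤ N) ts →
    E (interlace ts) * ∏ (from 1 (length ts)) (λ j → fromℕ (N C j))
      ≡ rowForm (λ l j → fromℕ (l C j)) ts unit (from 1 (length ts))
  expect-interlace m ts refl d ts≤N with strictlyDescending? ts
  ... | no ¬s = trans (trans (cong (_* C₁) (trans (∑-cong (states N) (λ u →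
                  trans (cong (π u *_) (interlace-degenerate d ¬s u)) (ℚₚ.*-zeroʳ (π u)))) (∑-zero (states N)))) (ℚₚ.*-zeroˡ C₁))
                (sym (rowForm-degenerate _ unit d ¬s (from 1 (length ts))))
    where C₁ = ∏ (from 1 (length ts)) (λ j → fromℕ (N C j))
  -- The number C₀ of multiline queues also comes out of the rows of the rescaled determinant; it is
  -- positive since every t is at most N.
  ... | yes s = *-cancelˡ-≡-pos C₀ {{binomials-pos N ts ts≤N}} (begin
    C₀ * (E (interlace ts) * C₁)
      ≡⟨ sym (ℚₚ.*-assoc C₀ (E (interlace ts)) C₁) ⟩
    C₀ * E (interlace ts) * C₁
      ≡⟨ cong (λ z → C₀ * z * C₁) (∑-cong-All (All.tabulate (λ {u} u∈ → cong (π u *_)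
           (trans (cong (interlace ts) (sym (state-toVec N u∈))) (sym (staircase-interlace ts (toVec N u) d)))))) ⟩
    C₀ * E (staircase k 0 full ∘ thresholds N ts) * C₁
      ≡⟨ cong (_* C₁) (expect-thresholds N π stationary ts s ts≤N (staircase k 0 full) (staircase-bounded k 0 full)) ⟩
    ∑ (mlqs N ts) (staircase k 0 full) * C₁
      ≡⟨ cong (_* C₁) (trans (staircase-chains k 0 full ts refl) (chains-pathDet m ts d)) ⟩
    pathDet k m ts * C₁
      ≡⟨ subst (λ n → pathDet k m ts * ∏ (from 1 k) (λ j → fromℕ (n C j)) ≡ ∏ ts (λ t → fromℕ (n C t)) * V) (ℕₚ.+-comm m k) (pathDet-scale k m ts) ⟩
    C₀ * V ∎)
    where
    k = length ts
    full = Vec.replicate m true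
    C₀ = ∏ ts (λ t → fromℕ (N C t))
    C₁ = ∏ (from 1 k) (λ j → fromℕ (N C j))
    V = rowForm (λ l j → fromℕ (l C j)) ts unit (from 1 k)

  probPrefix-shiftSum : ∀ {ds} → StrictlyDescending ds → All (1 ≤_) ds →
    probPrefix N π ds ≡ shiftSum (- 1ℚ) (λ ts → E (interlace ts)) ds
  probPrefix-shiftSum {ds} s 1≤ds = begin
    probPrefix N π ds
      ≡⟨ trans (sumℚ-map π (filter (λ u → take (length ds) u ≟ˡ ds) (states N))) (∑-filter (λ u → take (length ds) u ≟ˡ ds) π (states N)) ⟩
    ∑ (states N) (λ u → 𝟙 (take (length ds) u ≟ˡ ds) * π u)
      ≡⟨ ∑-cong (states N) (λ u → trans (ℚₚ.*-comm (𝟙 (take (length ds) u ≟ˡ ds)) (π u))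
           (trans (cong (π u *_) (sym (shiftSum-interlace s 1≤ds u)))
                  (sym (shiftSum-scale (- 1ℚ) (π u) (λ ts → interlace ts u) ds)))) ⟩
    ∑ (states N) (λ u → shiftSum (- 1ℚ) (λ ts → π u * interlace ts u) ds)
      ≡⟨ sym (shiftSum-∑ (- 1ℚ) (states N) (λ u ts → π u * interlace ts u) ds) ⟩
    shiftSum (- 1ℚ) (λ ts → E (interlace ts)) ds ∎

  probPrefix-det : ∀ m ds → N ≡ length ds ℕ.+ m → StrictlyDescending ds → All (1 ≤_) ds → All (_≤ N) ds →
    probPrefix N π ds * ∏ (from 1 (length ds)) (λ j → fromℕ (N C j))
      ≡ rowForm (λ l j → fromℕ (l C j)) ds unit (from 0 (length ds))
  probPrefix-det m ds N≡ s 1≤ds ds≤N = begin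
    probPrefix N π ds * C₁
      ≡⟨ trans (cong (_* C₁) (probPrefix-shiftSum s 1≤ds)) (ℚₚ.*-comm _ C₁) ⟩
    C₁ * shiftSum (- 1ℚ) (λ ts → E (interlace ts)) ds
      ≡⟨ sym (shiftSum-scale (- 1ℚ) C₁ (λ ts → E (interlace ts)) ds) ⟩
    shiftSum (- 1ℚ) (λ ts → C₁ * E (interlace ts)) ds
      ≡⟨ shiftSum-cong (- 1ℚ) ds (λ ts p → trans (ℚₚ.*-comm C₁ (E (interlace ts))) (below-ds ts p)) ⟩
    shiftSum (- 1ℚ) (λ ts → rowForm B ts unit (from 1 k)) ds
      ≡⟨ subst (λ es → shiftSum (- 1ℚ) (λ ts → rowForm B ts unit (from 1 k)) es ≡ rowForm B es unit (from 0 k))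
               (suc-pred 1≤ds) (shiftSum-binomials k (map ℕ.pred ds)) ⟩
    rowForm B ds unit (from 0 k) ∎
    where
    k = length ds
    C₁ = ∏ (from 1 k) (λ j → fromℕ (N C j))
    B : ℕ → ℕ → ℚ
    B l j = fromℕ (l C j)
    suc-pred : ∀ {es} → All (1 ≤_) es → map suc (map ℕ.pred es) ≡ es
    suc-pred []                = refl
    suc-pred {suc e ∷ es} (_ ∷ ps) = cong (suc e ∷_) (suc-pred ps)
    lowered-≤N : ∀ {ts es} → All (_≤ N) es → Pointwise Lowered ts es → All (_≤ N) ts
    lowered-≤N []       []       = []
    lowered-≤N (e ∷ es) (p ∷ ps) = ℕₚ.≤-trans (lowered-≤ p) e ∷ lowered-≤N es ps
    below-ds : ∀ ts → Pointwise Lowered ts ds → E (interlace ts) * C₁ ≡ rowForm B ts unit (from 1 k)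
    below-ds ts p = subst
      (λ l → E (interlace ts) * ∏ (from 1 l) (λ j → fromℕ (N C j)) ≡ rowForm B ts unit (from 1 l))
      (Pointwise-length p)
      (expect-interlace m ts (trans N≡ (cong (ℕ._+ m) (sym (Pointwise-length p)))) (lowered-descending s p) (lowered-≤N ds≤N p))

-- Translation to the form of the statement

prodBinom-from : ∀ N k → fromℕ (prodBinom N k) ≡ ∏ (from 1 k) (λ j → fromℕ (N C j))
prodBinom-from N zero    = refl
prodBinom-from N (suc k) = begin
  fromℕ (prodBinom N k ℕ.* (N C suc k))
    ≡⟨ fromℕ-* (prodBinom N k) (N C suc k) ⟩
  fromℕ (prodBinom N k) * fromℕ (N C suc k)
    ≡⟨ cong (_* fromℕ (N C suc k)) (prodBinom-from N k) ⟩
  ∏ (from 1 k) (λ j → fromℕ (N C j)) * fromℕ (N C suc k)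
    ≡⟨ sym (last-factor 1 k) ⟩
  ∏ (from 1 (suc k)) (λ j → fromℕ (N C j)) ∎
  where
  last-factor : ∀ a n → ∏ (from a (suc n)) (λ j → fromℕ (N C j))
                      ≡ ∏ (from a n) (λ j → fromℕ (N C j)) * fromℕ (N C (a ℕ.+ n))
  last-factor a zero    = trans (ℚₚ.*-comm (fromℕ (N C a)) 1ℚ) (cong (λ b → 1ℚ * fromℕ (N C b)) (sym (ℕₚ.+-identityʳ a)))
  last-factor a (suc n) = trans (cong (fromℕ (N C a) *_) (last-factor (suc a) n))
    (trans (sym (ℚₚ.*-assoc (fromℕ (N C a)) X (fromℕ (N C (suc a ℕ.+ n)))))
           (cong (λ b → fromℕ (N C a) * X * fromℕ (N C b)) (sym (ℕₚ.+-suc a n))))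
    where X = ∏ (from (suc a) n) (λ j → fromℕ (N C j))

tabulate-from : ∀ n a (f : Fin n → ℕ) → (∀ i → f i ≡ a ℕ.+ toℕ i) → tabulate f ≡ from a n
tabulate-from zero    a f f≡ = refl
tabulate-from (suc n) a f f≡ = cong₂ _∷_ (trans (f≡ Fin.zero) (ℕₚ.+-identityʳ a))
  (tabulate-from n (suc a) (f ∘ Fin.suc) (λ i → trans (f≡ (Fin.suc i)) (ℕₚ.+-suc a (toℕ i))))

strictlyDescending-length : ∀ {N ds} → StrictlyDescending ds → All (1 ≤_) ds → All (_≤ N) ds → length ds ≤ N
strictlyDescending-length {ds = []}         s _        _        = z≤n
strictlyDescending-length {ds = suc d ∷ ds} s (_ ∷ ps) (d≤ ∷ _) = ℕₚ.≤-trans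
  (s≤s (strictlyDescending-length (Linked.tail s) ps (All.map ℕ.s≤s⁻¹ (descending-below s)))) d≤

All-reverse : ∀ {P : ℕ → Set} {k} (xs : Vec ℕ k) → (∀ i → P (lookup xs i)) → All P (toList (reverse xs))
All-reverse         []       p = []
All-reverse {P = P} (x ∷ xs) p = subst (All P) (sym (toList-reverse-∷ x xs))
  (Allₚ.++⁺ (All-reverse xs (p ∘ Fin.suc)) (p Fin.zero ∷ []))

reverse-descending : ∀ {k} (xs : Vec ℕ k) → (∀ (i j : Fin k) → i <ᶠ j → lookup xs i < lookup xs j) →
                     StrictlyDescending (toList (reverse xs))
reverse-descending []       increasing = []
reverse-descending (x ∷ xs) increasing = subst StrictlyDescending (sym (toList-reverse-∷ x xs))
  (append (reverse-descending xs (λ i j i<j → increasing (Fin.suc i) (Fin.suc j) (s≤s i<j)))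
          (All-reverse xs (λ i → increasing Fin.zero (Fin.suc i) (s≤s z≤n))))
  where
  append : ∀ {ls} → StrictlyDescending ls → All (x <_) ls → StrictlyDescending (ls ++ x ∷ [])
  append []      []        = [-]
  append [-]     (p ∷ [])  = p ∷ [-]
  append (q ∷ s) (p ∷ ps)  = q ∷ append s ps

-- `k` is n - 1 and `xs` lists x₂ < ⋯ < xₙ, one label for each row of the matrix; columns are
-- numbered from 0, so `toℕ j` is the lower index of the binomial. The product of binomials,
-- positive because k ≤ N, stands on the left instead of in a denominator.
theoremT : (N : ℕ) → .{{_ : NonZero N}} → (π : List-ℕ-ℚ) → Stationary N π →
    (k : ℕ) → (xs : Vec ℕ k) →
    (∀ (i j : Fin k) → i <ᶠ j → lookup xs i < lookup xs j) →
    (∀ (i : Fin k) → 1 ≤ lookup xs i) →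
    (∀ (i : Fin k) → lookup xs i ≤ N) →
    probPrefix N π (toList (reverse xs)) * ((+ prodBinom N k) / 1)
    ≡ det k (λ i j → + (lookup xs i C toℕ j)) / 1
theoremT N π stationary k xs increasing positive bounded = begin
  probPrefix N π ds * fromℕ (prodBinom N k)
    ≡⟨ cong (probPrefix N π ds *_) (trans (prodBinom-from N k)
         (cong (λ l → ∏ (from 1 l) (λ j → fromℕ (N C j))) (sym length-ds))) ⟩
  probPrefix N π ds * ∏ (from 1 (length ds)) (λ j → fromℕ (N C j))
    -- The number m of sites beyond the prefix is N - k; distinct labels between 1 and N ensure k ≤
    -- N.
    ≡⟨ probPrefix-det N π stationary (N ℕ.∸ length ds) ds (sym (ℕₚ.m+[n∸m]≡n length≤N)) descending 1≤ds ds≤N ⟩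
  rowForm (λ l j → fromℕ (l C j)) ds unit (from 0 (length ds))
    ≡⟨ cong (rowForm _ ds unit) (trans (cong (from 0) length-ds) (sym (tabulate-from k 0 toℕ (λ _ → refl)))) ⟩
  rowForm (λ l j → fromℕ (l C j)) ds unit (tabulate toℕ)
    ≡⟨ sym (det-rowForm k (λ l j → + (l C j)) xs toℕ) ⟩
  fromℤ (det k (λ i j → + (lookup xs i C toℕ j))) ∎
  where
  ds = toList (reverse xs)
  descending : StrictlyDescending ds
  descending = reverse-descending xs increasing
  1≤ds : All (1 ≤_) ds
  1≤ds = All-reverse xs positive
  ds≤N : All (_≤ N) ds
  ds≤N = All-reverse xs bounded
  length-ds : length ds ≡ k
  length-ds = Vecₚ.length-toList (reverse xs)
  length≤N : length ds ≤ N
  length≤N = strictlyDescending-length descending 1≤ds ds≤N
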